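{- Let $\lambda=(\lambda_1,\dots,\lambda_r)$ be a partition of length $r$ with a flagging $f=(f_1,\dots,f_r)$ (where, if $f_1=1$ and $r>1$, it is assumed that $f_2>1$). Then $G_{\lambda,f}$ is equal to $\pi_w(x_1^{a_1}\cdots x_r^{a_r})$, where $$a_i=\lambda_i+f_i-i\quad(i=1,\dots,r)$$ and $$w=s_rs_{r+1}\cdots s_{f_r-1}\cdot s_{r-1}s_r\cdots s_{f_{r-1}-1}\cdots s_1s_2\cdots s_{f_1-1}.$$
   Context: $x=(x_1,x_2,\dots)$ are infinitely many variables and $\beta$ is a parameter. For $h\in\mathbb{Z}[\beta][[x]]$, let $s_i(h)$ be obtained from $h$ by exchanging $x_i$ and $x_{i+1}$, and define $$\pi_i(h)=\frac{(1+\beta x_{i+1})h-(1+\beta x_i)s_i(h)}{x_i-x_{i+1}}.$$ The operators $\pi_i$ satisfy the Coxeter (braid) relations. For a permutation $w=s_{i_1}\cdots s_{i_k}$ with $\ell(w)=k$ (where $s_i$ is the transposition of $i$ and $i+1$ and $\ell$ is the length), define $\pi_w=\pi_{i_k}\cdots\pi_{i_1}$, i.e. $\pi_{i_1}$ is applied first; this is independent of the choice of reduced expression, and $\pi_{\mathrm{id}}$ is the identity. In the expression for $w$, the factor attached to the index $i$ is $s_is_{i+1}\cdots s_{f_i-1}$, which is the empty word when $f_i=i$. A partition $\lambda=(\lambda_1\ge\cdots\ge\lambda_r)$ of length $r$ is a weakly decreasing sequence of $r$ positive integers, identified with its Young diagram $\{(i,j):1\le i\le r,\ 1\le j\le\lambda_i\}$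 (English notation). A flagging of $\lambda$ is a weakly increasing sequence $f=(f_1,\dots,f_r)$ of positive integers. $FSVT(\lambda,f)$ is the set of fillings $T$ of the boxes of $\lambda$ such that the box $(i,j)$ contains a non-empty subset of $\{1,\dots,f_i\}$, and the maximum number at $(i,j)$ is at most the minimum number at $(i,j+1)$ whenever $j+1\le\lambda_i$ and strictly less than the minimum number at $(i+1,j)$ whenever $j\le\lambda_{i+1}$. The flagged Grothendieck polynomial is $$G_{\lambda,f}=G_{\lambda,f}(x)=\sum_{T\in FSVT(\lambda,f)}\beta^{|T|-|\lambda|}\prod_{k\in T}x_k,$$ where $|T|$ is the total number of entries of $T$, $|\lambda|$ is the number of boxes of $\lambda$, and the product is over all entries of $T$ (with multiplicity).
   Formalization: The formal theorem assumes f_i ≥ i for all i. Otherwise the word s_i⋯s_{f_i−1} is undefined, and reading it as empty makes the claim false: λ=(1,1,1), f=(1,2,2) gives G=0 but π_w(x^a)=x_1x_2. -}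

module Defs where

open import Algebra.Bundles using (CommutativeRing)
open import Algebra.Structures using (IsCommutativeRing)
open import Data.Bool using (true; false; if_then_else_)
open import Data.Fin as Fin using (Fin; toℕ)
open import Data.Fin.Properties as Finₚ using (∀-cons)
open import Data.Fin.Subset using (Subset; inside; outside; Nonempty; _∈_)
open import Data.Fin.Subset.Properties using (_∈?_; nonempty?)
open import Data.Integer as ℤ using (ℤ; 0ℤ; 1ℤ)
import Data.Integer.Properties as ℤₚ
open import Data.Integer.Tactic.RingSolver using (solve-∀)
open import Data.List as List
  using (List; []; _∷_; _++_; map; concatMap; cartesianProductWith; filter;
         foldr; length; replicate; reverse; allFin; upTo; tabulate)
open import Data.Nat.ListAction using (sum)
open import Data.Nat as ℕ using (ℕ; zero; suc; _≤_; _<_; _⊔_; _∸_; _≟_; _≤?_; _<?_; z≤n; s≤s)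
import Data.Nat.Properties as ℕₚ
open import Data.Product using (∃-syntax; _×_; _,_)
open import Data.Vec using ([]; _∷_)
open import Function using (_∘_; id; mk⇔)
open import Level using (0ℓ)
open import Relation.Binary.PropositionalEquality
  using (_≡_; _≢_; _≗_; refl; sym; trans; cong; cong₂; module ≡-Reasoning)
open import Relation.Nullary using (Dec; yes; no; does; contradiction)
open import Relation.Nullary.Decidable using (_×-dec_; _→-dec_; map′; does-⇔)

-- A polynomial in β is its list of coefficients, constant term first;
-- lists differing by trailing zeros are identified by _≈ₚ_.
Poly : Set
Poly = List ℤ

coeffₚ : Poly → ℕ → ℤ
coeffₚ []      _       = 0ℤ
coeffₚ (a ∷ p) zero    = a
coeffₚ (a ∷ p) (suc n) = coeffₚ p n

infix 4 _≈ₚ_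
_≈ₚ_ : Poly → Poly → Set
p ≈ₚ q = coeffₚ p ≗ coeffₚ q

infixl 6 _+ₚ_
_+ₚ_ : Poly → Poly → Poly
[]      +ₚ q       = q
(a ∷ p) +ₚ []      = a ∷ p
(a ∷ p) +ₚ (b ∷ q) = (a ℤ.+ b) ∷ (p +ₚ q)

-ₚ_ : Poly → Poly
-ₚ_ = map (λ a → ℤ.- a)

infixl 7 _*ₚ_
_*ₚ_ : Poly → Poly → Poly
[]      *ₚ q = []
(a ∷ p) *ₚ q = map (a ℤ.*_) q +ₚ (0ℤ ∷ (p *ₚ q))

1ₚ βₚ : Poly
1ₚ = 1ℤ ∷ []
βₚ = 0ℤ ∷ 1ℤ ∷ []

coeff-+ : ∀ p q n → coeffₚ (p +ₚ q) n ≡ coeffₚ p n ℤ.+ coeffₚ q n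
coeff-+ []      q       n       = sym (ℤₚ.+-identityˡ _)
coeff-+ (a ∷ p) []      n       = sym (ℤₚ.+-identityʳ _)
coeff-+ (a ∷ p) (b ∷ q) zero    = refl
coeff-+ (a ∷ p) (b ∷ q) (suc n) = coeff-+ p q n

coeff-neg : ∀ p n → coeffₚ (-ₚ p) n ≡ ℤ.- coeffₚ p n
coeff-neg []      n       = refl
coeff-neg (a ∷ p) zero    = refl
coeff-neg (a ∷ p) (suc n) = coeff-neg p n

coeff-scale : ∀ a p n → coeffₚ (map (a ℤ.*_) p) n ≡ a ℤ.* coeffₚ p n
coeff-scale a []      n       = sym (ℤₚ.*-zeroʳ a)
coeff-scale a (b ∷ p) zero    = refl
coeff-scale a (b ∷ p) (suc n) = coeff-scale a p n

conv : (ℕ → ℤ) → (ℕ → ℤ) → ℕ → ℤ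
conv f g zero    = f 0 ℤ.* g 0
conv f g (suc n) = f 0 ℤ.* g (suc n) ℤ.+ conv (f ∘ suc) g n

conv-cong : ∀ {f f′ g g′} → f ≗ f′ → g ≗ g′ → conv f g ≗ conv f′ g′
conv-cong e e′ zero    = cong₂ ℤ._*_ (e 0) (e′ 0)
conv-cong e e′ (suc n) =
  cong₂ ℤ._+_ (cong₂ ℤ._*_ (e 0) (e′ (suc n))) (conv-cong (e ∘ suc) e′ n)

conv-0 : ∀ g n → conv (λ _ → 0ℤ) g n ≡ 0ℤ
conv-0 g zero    = refl
conv-0 g (suc n) = trans (ℤₚ.+-identityˡ _) (conv-0 g n)

conv-sucʳ : ∀ f g n → conv f g (suc n) ≡ conv f (g ∘ suc) n ℤ.+ f (suc n) ℤ.* g 0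
conv-sucʳ f g zero    = refl
conv-sucʳ f g (suc n) =
  trans (cong (ℤ._+_ (f 0 ℤ.* g (suc (suc n)))) (conv-sucʳ (f ∘ suc) g n))
        (sym (ℤₚ.+-assoc (f 0 ℤ.* g (suc (suc n))) _ _))

conv-comm : ∀ f g n → conv f g n ≡ conv g f n
conv-comm f g zero    = ℤₚ.*-comm (f 0) (g 0)
conv-comm f g (suc n) = begin
  f 0 ℤ.* g (suc n) ℤ.+ conv (f ∘ suc) g n  ≡⟨ cong₂ ℤ._+_ (ℤₚ.*-comm (f 0) _) (conv-comm (f ∘ suc) g n) ⟩
  g (suc n) ℤ.* f 0 ℤ.+ conv g (f ∘ suc) n  ≡⟨ ℤₚ.+-comm (g (suc n) ℤ.* f 0) _ ⟩
  conv g (f ∘ suc) n ℤ.+ g (suc n) ℤ.* f 0  ≡⟨ sym (conv-sucʳ g f n) ⟩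
  conv g f (suc n)                          ∎
  where open ≡-Reasoning

conv-+ˡ : ∀ f f′ g n → conv (λ k → f k ℤ.+ f′ k) g n ≡ conv f g n ℤ.+ conv f′ g n
conv-+ˡ f f′ g zero    = ℤₚ.*-distribʳ-+ (g 0) (f 0) (f′ 0)
conv-+ˡ f f′ g (suc n) =
  trans (cong (ℤ._+_ ((f 0 ℤ.+ f′ 0) ℤ.* g (suc n))) (conv-+ˡ (f ∘ suc) (f′ ∘ suc) g n)) (lem (f 0) (f′ 0) (g (suc n)) _ _)
  where
  lem : ∀ a b c d e → (a ℤ.+ b) ℤ.* c ℤ.+ (d ℤ.+ e) ≡ (a ℤ.* c ℤ.+ d) ℤ.+ (b ℤ.* c ℤ.+ e)
  lem = solve-∀

conv-scaleˡ : ∀ a f g n → conv (λ k → a ℤ.* f k) g n ≡ a ℤ.* conv f g n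
conv-scaleˡ a f g zero    = ℤₚ.*-assoc a _ _
conv-scaleˡ a f g (suc n) =
  trans (cong (ℤ._+_ (a ℤ.* f 0 ℤ.* g (suc n))) (conv-scaleˡ a (f ∘ suc) g n)) (lem a (f 0) (g (suc n)) _)
  where
  lem : ∀ a b c d → a ℤ.* b ℤ.* c ℤ.+ a ℤ.* d ≡ a ℤ.* (b ℤ.* c ℤ.+ d)
  lem = solve-∀

conv-assoc : ∀ f g h n → conv (conv f g) h n ≡ conv f (conv g h) n
conv-assoc f g h zero    = ℤₚ.*-assoc (f 0) _ _
conv-assoc f g h (suc n) = begin
  f 0 ℤ.* g 0 ℤ.* h (suc n) ℤ.+ conv (λ k → f 0 ℤ.* g (suc k) ℤ.+ conv (f ∘ suc) g k) h n
    ≡⟨ cong (ℤ._+_ (f 0 ℤ.* g 0 ℤ.* h (suc n))) (conv-+ˡ (λ k → f 0 ℤ.* g (suc k)) _ h n) ⟩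
  f 0 ℤ.* g 0 ℤ.* h (suc n) ℤ.+
    (conv (λ k → f 0 ℤ.* g (suc k)) h n ℤ.+ conv (conv (f ∘ suc) g) h n)
    ≡⟨ cong (ℤ._+_ (f 0 ℤ.* g 0 ℤ.* h (suc n))) (cong₂ ℤ._+_ (conv-scaleˡ (f 0) (g ∘ suc) h n) (conv-assoc (f ∘ suc) g h n)) ⟩
  f 0 ℤ.* g 0 ℤ.* h (suc n) ℤ.+
    (f 0 ℤ.* conv (g ∘ suc) h n ℤ.+ conv (f ∘ suc) (conv g h) n)
    ≡⟨ lem (f 0) (g 0) (h (suc n)) _ _ ⟩
  conv f (conv g h) (suc n) ∎
  where
  open ≡-Reasoning
  lem : ∀ a b c d e →
        a ℤ.* b ℤ.* c ℤ.+ (a ℤ.* d ℤ.+ e) ≡ a ℤ.* (b ℤ.* c ℤ.+ d) ℤ.+ e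
  lem = solve-∀

coeff-* : ∀ p q n → coeffₚ (p *ₚ q) n ≡ conv (coeffₚ p) (coeffₚ q) n
coeff-* []      q n       = sym (conv-0 (coeffₚ q) n)
coeff-* (a ∷ p) q zero    =
  trans (coeff-+ (map (a ℤ.*_) q) _ 0) (trans (ℤₚ.+-identityʳ _) (coeff-scale a q 0))
coeff-* (a ∷ p) q (suc n) =
  trans (coeff-+ (map (a ℤ.*_) q) _ (suc n))
        (cong₂ ℤ._+_ (coeff-scale a q (suc n)) (coeff-* p q n))

ℤ[β] : CommutativeRing 0ℓ 0ℓ
ℤ[β] = record
  { Carrier = Poly ; _≈_ = _≈ₚ_ ; _+_ = _+ₚ_ ; _*_ = _*ₚ_ ; -_ = -ₚ_ ; 0# = [] ; 1# = 1ₚ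
  ; isCommutativeRing = isCR }
  where
  +-congₚ : ∀ {p p′ q q′} → p ≈ₚ p′ → q ≈ₚ q′ → p +ₚ q ≈ₚ p′ +ₚ q′
  +-congₚ {p} {p′} {q} {q′} e e′ n =
    trans (coeff-+ p q n) (trans (cong₂ ℤ._+_ (e n) (e′ n)) (sym (coeff-+ p′ q′ n)))

  +-assocₚ : ∀ p q r → (p +ₚ q) +ₚ r ≈ₚ p +ₚ (q +ₚ r)
  +-assocₚ p q r n = begin
    coeffₚ ((p +ₚ q) +ₚ r) n                      ≡⟨ coeff-+ (p +ₚ q) r n ⟩
    coeffₚ (p +ₚ q) n ℤ.+ coeffₚ r n              ≡⟨ cong (ℤ._+ _) (coeff-+ p q n) ⟩
    coeffₚ p n ℤ.+ coeffₚ q n ℤ.+ coeffₚ r n      ≡⟨ ℤₚ.+-assoc (coeffₚ p n) _ _ ⟩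
    coeffₚ p n ℤ.+ (coeffₚ q n ℤ.+ coeffₚ r n)    ≡⟨ cong (ℤ._+_ (coeffₚ p n)) (sym (coeff-+ q r n)) ⟩
    coeffₚ p n ℤ.+ coeffₚ (q +ₚ r) n              ≡⟨ sym (coeff-+ p (q +ₚ r) n) ⟩
    coeffₚ (p +ₚ (q +ₚ r)) n                      ∎
    where open ≡-Reasoning

  +-commₚ : ∀ p q → p +ₚ q ≈ₚ q +ₚ p
  +-commₚ p q n =
    trans (coeff-+ p q n) (trans (ℤₚ.+-comm (coeffₚ p n) _) (sym (coeff-+ q p n)))

  +-inverseˡₚ : ∀ p → (-ₚ p) +ₚ p ≈ₚ []
  +-inverseˡₚ p n =
    trans (coeff-+ (-ₚ p) p n)
          (trans (cong (ℤ._+ coeffₚ p n) (coeff-neg p n)) (ℤₚ.+-inverseˡ (coeffₚ p n)))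

  *-congₚ : ∀ {p p′ q q′} → p ≈ₚ p′ → q ≈ₚ q′ → p *ₚ q ≈ₚ p′ *ₚ q′
  *-congₚ {p} {p′} {q} {q′} e e′ n =
    trans (coeff-* p q n) (trans (conv-cong e e′ n) (sym (coeff-* p′ q′ n)))

  *-commₚ : ∀ p q → p *ₚ q ≈ₚ q *ₚ p
  *-commₚ p q n =
    trans (coeff-* p q n) (trans (conv-comm (coeffₚ p) _ n) (sym (coeff-* q p n)))

  *-assocₚ : ∀ p q r → (p *ₚ q) *ₚ r ≈ₚ p *ₚ (q *ₚ r)
  *-assocₚ p q r n = begin
    coeffₚ ((p *ₚ q) *ₚ r) n                             ≡⟨ coeff-* (p *ₚ q) r n ⟩
    conv (coeffₚ (p *ₚ q)) (coeffₚ r) n                  ≡⟨ conv-cong (coeff-* p q) (λ _ → refl) n ⟩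
    conv (conv (coeffₚ p) (coeffₚ q)) (coeffₚ r) n       ≡⟨ conv-assoc (coeffₚ p) _ _ n ⟩
    conv (coeffₚ p) (conv (coeffₚ q) (coeffₚ r)) n       ≡⟨ conv-cong (λ _ → refl) (sym ∘ coeff-* q r) n ⟩
    conv (coeffₚ p) (coeffₚ (q *ₚ r)) n                  ≡⟨ sym (coeff-* p (q *ₚ r) n) ⟩
    coeffₚ (p *ₚ (q *ₚ r)) n                             ∎
    where open ≡-Reasoning

  *-identityˡₚ : ∀ p → 1ₚ *ₚ p ≈ₚ p
  *-identityˡₚ p n = trans (coeff-* 1ₚ p n) (lem (coeffₚ p) n)
    where
    lem : ∀ g n → conv (coeffₚ 1ₚ) g n ≡ g n
    lem g zero    = ℤₚ.*-identityˡ _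
    lem g (suc n) = trans (cong₂ ℤ._+_ (ℤₚ.*-identityˡ (g (suc n))) (conv-0 g n)) (ℤₚ.+-identityʳ _)

  distribʳₚ : ∀ r p q → (p +ₚ q) *ₚ r ≈ₚ p *ₚ r +ₚ q *ₚ r
  distribʳₚ r p q n = begin
    coeffₚ ((p +ₚ q) *ₚ r) n                              ≡⟨ coeff-* (p +ₚ q) r n ⟩
    conv (coeffₚ (p +ₚ q)) (coeffₚ r) n                   ≡⟨ conv-cong (coeff-+ p q) (λ _ → refl) n ⟩
    conv (λ k → coeffₚ p k ℤ.+ coeffₚ q k) (coeffₚ r) n   ≡⟨ conv-+ˡ (coeffₚ p) _ _ n ⟩
    conv (coeffₚ p) (coeffₚ r) n ℤ.+ conv (coeffₚ q) (coeffₚ r) n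
      ≡⟨ sym (cong₂ ℤ._+_ (coeff-* p r n) (coeff-* q r n)) ⟩
    coeffₚ (p *ₚ r) n ℤ.+ coeffₚ (q *ₚ r) n               ≡⟨ sym (coeff-+ (p *ₚ r) _ n) ⟩
    coeffₚ (p *ₚ r +ₚ q *ₚ r) n                           ∎
    where open ≡-Reasoning

  transₚ : ∀ {p q r} → p ≈ₚ q → q ≈ₚ r → p ≈ₚ r
  transₚ e e′ n = trans (e n) (e′ n)

  isCR : IsCommutativeRing _≈ₚ_ _+ₚ_ _*ₚ_ -ₚ_ [] 1ₚ
  isCR = record
    { isRing = record
      { +-isAbelianGroup = record
        { isGroup = record
          { isMonoid = record
            { isSemigroup = record
              { isMagma = record
                { isEquivalence = record
                  { refl = λ _ → refl ; sym = λ e n → sym (e n)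
                  ; trans = λ {p} {q} {r} → transₚ {p} {q} {r} }
                ; ∙-cong = λ {p} {p′} {q} {q′} → +-congₚ {p} {p′} {q} {q′} }
              ; assoc = +-assocₚ }
            ; identity = (λ _ _ → refl) , (λ p n → +-commₚ p [] n) }
          ; inverse = +-inverseˡₚ ,
                      (λ p n → trans (+-commₚ p (-ₚ p) n) (+-inverseˡₚ p n))
          ; ⁻¹-cong = λ {p} {q} e n →
              trans (coeff-neg p n) (trans (cong (λ a → ℤ.- a) (e n)) (sym (coeff-neg q n))) }
        ; comm = +-commₚ }
      ; *-cong = λ {p} {p′} {q} {q′} → *-congₚ {p} {p′} {q} {q′}
      ; *-assoc = *-assocₚ
      ; *-identity = *-identityˡₚ , (λ p n → trans (*-commₚ p 1ₚ n) (*-identityˡₚ p n))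
      ; distrib =
          (λ r p q n → trans (*-commₚ r (p +ₚ q) n) (trans (distribʳₚ r p q n)
             (+-congₚ {p *ₚ r} {r *ₚ p} {q *ₚ r} {r *ₚ q} (*-commₚ p r) (*-commₚ q r) n)))
          , distribʳₚ }
    ; *-comm = *-commₚ }

-- Variables, simple transpositions and rows are numbered from 0 in the
-- code and from 1 in the mathematics: variable i is x_{i+1}, and s i is
-- s_{i+1}, which exchanges i and suc i.

s : ℕ → ℕ → ℕ
s zero    zero          = 1
s zero    (suc zero)    = 0
s zero    (suc (suc j)) = suc (suc j)
s (suc i) zero          = zero
s (suc i) (suc j)       = suc (s i j)

s-fix : ∀ i j → suc (suc i) ≤ j → s i j ≡ j
s-fix zero    (suc (suc j)) _         = refl
s-fix zero    (suc zero)    (s≤s ())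
s-fix (suc i) (suc j)       (s≤s i<j) = cong suc (s-fix i j i<j)

s-at : ∀ i → s i i ≡ suc i
s-at zero    = refl
s-at (suc i) = cong suc (s-at i)

s-at-suc : ∀ i → s i (suc i) ≡ i
s-at-suc zero    = refl
s-at-suc (suc i) = cong suc (s-at-suc i)

s-other : ∀ i j → j ≢ i → j ≢ suc i → s i j ≡ j
s-other zero    zero          n _ = contradiction refl n
s-other zero    (suc zero)    _ n = contradiction refl n
s-other zero    (suc (suc j)) _ _ = refl
s-other (suc i) zero          _ _ = refl
s-other (suc i) (suc j)       n m = cong suc (s-other i j (n ∘ cong suc) (m ∘ cong suc))

record Monomial : Set where
  field
    exp      : ℕ → ℕ
    bound    : ℕ
    vanishes : ∀ j → bound ≤ j → exp j ≡ 0

open Monomial public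

infix 4 _≐_
_≐_ : Monomial → Monomial → Set
α ≐ α′ = exp α ≗ exp α′

update : (ℕ → ℕ) → ℕ → ℕ → ℕ → ℕ
update e zero    p zero    = p
update e zero    p (suc j) = e (suc j)
update e (suc i) p zero    = e zero
update e (suc i) p (suc j) = update (e ∘ suc) i p j

update-same : ∀ e i p → update e i p i ≡ p
update-same e zero    p = refl
update-same e (suc i) p = update-same (e ∘ suc) i p

update-other : ∀ e i p j → j ≢ i → update e i p j ≡ e j
update-other e zero    p zero    n = contradiction refl n
update-other e zero    p (suc j) n = refl
update-other e (suc i) p zero    n = refl
update-other e (suc i) p (suc j) n = update-other (e ∘ suc) i p j (n ∘ cong suc)

update-cong : ∀ {e e′} i {p p′} → e ≗ e′ → p ≡ p′ → update e i p ≗ update e′ i p′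
update-cong zero    e≗ refl zero    = refl
update-cong zero    e≗ refl (suc j) = e≗ (suc j)
update-cong (suc i) e≗ refl zero    = e≗ zero
update-cong (suc i) e≗ refl (suc j) = update-cong i (e≗ ∘ suc) refl j

infixl 8 _[_≔_]
_[_≔_] : Monomial → ℕ → ℕ → Monomial
α [ i ≔ p ] = record
  { exp      = update (exp α) i p
  ; bound    = suc i ⊔ bound α
  ; vanishes = λ j b →
      trans (update-other (exp α) i p j (ℕₚ.>⇒≢ (ℕₚ.m⊔n≤o⇒m≤o (suc i) (bound α) b)))
            (vanishes α j (ℕₚ.m⊔n≤o⇒n≤o (suc i) (bound α) b)) }

swap : ℕ → Monomial → Monomial
swap i α = record
  { exp      = exp α ∘ s i
  ; bound    = suc (suc i) ⊔ bound α
  ; vanishes = λ j b →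
      trans (cong (exp α) (s-fix i j (ℕₚ.m⊔n≤o⇒m≤o (suc (suc i)) (bound α) b)))
            (vanishes α j (ℕₚ.m⊔n≤o⇒n≤o (suc (suc i)) (bound α) b)) }

perm : List ℕ → ℕ → ℕ
perm []       = id
perm (i ∷ is) = s i ∘ perm is

-- Being of length ℓ(w), the least number of letters in a word for w.
IsReducedExpression : List ℕ → (ℕ → ℕ) → Set
IsReducedExpression u w = perm u ≗ w × (∀ v → perm v ≗ w → length u ≤ length v)

record IsPartition {r} (lam : Fin r → ℕ) : Set where
  field
    positive   : ∀ i → 1 ≤ lam i
    decreasing : ∀ i j → i Fin.≤ j → lam j ≤ lam i

record IsFlagging {r} (f : Fin r → ℕ) : Set where
  field
    positive   : ∀ i → 1 ≤ f i
    increasing : ∀ i j → i Fin.≤ j → f i ≤ f j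

-- Element k of Fin (f i) stands for the number k + 1 in {1, …, f i}.
Filling : ∀ {r} → (Fin r → ℕ) → (Fin r → ℕ) → Set
Filling {r} lam f = (i : Fin r) → Fin (lam i) → Subset (f i)

IsMax IsMin : ∀ {n} → Subset n → Fin n → Set
IsMax A k = k ∈ A × (∀ l → l ∈ A → l Fin.≤ k)
IsMin A k = k ∈ A × (∀ l → l ∈ A → k Fin.≤ l)

isMax? : ∀ {n} (A : Subset n) k → Dec (IsMax A k)
isMax? A k = (k ∈? A) ×-dec Finₚ.all? (λ l → (l ∈? A) →-dec (l Finₚ.≤? k))

isMin? : ∀ {n} (A : Subset n) k → Dec (IsMin A k)
isMin? A k = (k ∈? A) ×-dec Finₚ.all? (λ l → (l ∈? A) →-dec (k Finₚ.≤? l))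

module _ {r} {lam f : Fin r → ℕ} (T : Filling lam f) where

  BoxesNonempty RowsWeak ColumnsStrict IsFSVT : Set
  BoxesNonempty = ∀ i j → Nonempty (T i j)
  RowsWeak      = ∀ i j j′ → toℕ j′ ≡ suc (toℕ j) →
                  ∀ k l → IsMax (T i j) k → IsMin (T i j′) l → toℕ k ≤ toℕ l
  ColumnsStrict = ∀ i i′ j j′ → toℕ i′ ≡ suc (toℕ i) → toℕ j′ ≡ toℕ j →
                  ∀ k l → IsMax (T i j) k → IsMin (T i′ j′) l → toℕ k < toℕ l
  IsFSVT        = BoxesNonempty × RowsWeak × ColumnsStrict

  isFSVT? : Dec IsFSVT
  isFSVT? =
    (Finₚ.all? λ i → Finₚ.all? λ j → nonempty? (T i j))
    ×-dec
    (Finₚ.all? λ i → Finₚ.all? λ j → Finₚ.all? λ j′ → (toℕ j′ ≟ suc (toℕ j)) →-dec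
      (Finₚ.all? λ k → Finₚ.all? λ l →
        isMax? (T i j) k →-dec (isMin? (T i j′) l →-dec (toℕ k ≤? toℕ l))))
    ×-dec
    (Finₚ.all? λ i → Finₚ.all? λ i′ → Finₚ.all? λ j → Finₚ.all? λ j′ →
      (toℕ i′ ≟ suc (toℕ i)) →-dec ((toℕ j′ ≟ toℕ j) →-dec
        (Finₚ.all? λ k → Finₚ.all? λ l →
          isMax? (T i j) k →-dec (isMin? (T i′ j′) l →-dec (toℕ k <? toℕ l)))))

  -- All entries of T with multiplicity; the number k + 1 is listed as
  -- k, the index of the variable x_{k+1}.
  entries : List ℕ
  entries = concatMap (λ i → concatMap (λ j →
    map toℕ (filter (_∈? T i j) (allFin (f i)))) (allFin (lam i))) (allFin r)

subsets : ∀ n → List (Subset n)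
subsets zero    = [] ∷ []
subsets (suc n) = map (inside ∷_) (subsets n) ++ map (outside ∷_) (subsets n)

-- All functions choosing an element of every list of a finite family.
sections : ∀ {n} {A : Fin n → Set} → (∀ i → List (A i)) → List (∀ i → A i)
sections {zero}  as = (λ ()) ∷ []
sections {suc n} {A} as =
  cartesianProductWith (∀-cons {P = A}) (as Fin.zero) (sections (as ∘ Fin.suc))

FSVT : ∀ {r} (lam f : Fin r → ℕ) → List (Filling lam f)
FSVT lam f = filter isFSVT? (sections λ i → sections λ _ → subsets (f i))

∣_∣ : ∀ {r} → (Fin r → ℕ) → ℕ
∣ lam ∣ = sum (tabulate lam)

-- s_k s_{k+1} ⋯ s_{f_k − 1} for the row k = i + 1, whose letters have
-- indices i, …, f_k − 2 here.
flagFactor : ∀ {r} → (Fin r → ℕ) → Fin r → List ℕ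
flagFactor f i = map (toℕ i ℕ.+_) (upTo (f i ∸ suc (toℕ i)))

flagWord : ∀ {r} → (Fin r → ℕ) → List ℕ
flagWord {r} f = concatMap (flagFactor f) (reverse (allFin r))

-- λ_k + f_k − k for the row k = i + 1; truncation never occurs when k ≤ f_k.
startExponent : ∀ {r} → (Fin r → ℕ) → (Fin r → ℕ) → Fin r → ℕ
startExponent lam f i = lam i ℕ.+ f i ∸ suc (toℕ i)

-- Formal power series in infinitely many variables.  R and β are
-- instantiated to ℤ[β] and its variable at the end of the file.
module PowerSeries {c ℓ} (R : CommutativeRing c ℓ) (β : CommutativeRing.Carrier R) where

  open CommutativeRing R
    using (Carrier; _≈_; _+_; _*_; _-_; -_; 0#; 1#; semiring)
    renaming (refl to ≈-refl; sym to ≈-sym; trans to ≈-trans; reflexive to ≈-reflexive)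
  private module R = CommutativeRing R
  open import Algebra.Properties.Semiring.Exp semiring using (_^_)

  record Series : Set (c Level.⊔ ℓ) where
    field
      coeff      : Monomial → Carrier
      coeff-cong : ∀ α α′ → α ≐ α′ → coeff α ≈ coeff α′

  open Series public

  infix 4 _≈ₛ_
  _≈ₛ_ : Series → Series → Set ℓ
  h ≈ₛ g = ∀ α → coeff h α ≈ coeff g α

  0ₛ : Series
  0ₛ = record { coeff = λ _ → 0# ; coeff-cong = λ _ _ _ → ≈-refl }

  one? : ∀ α → Dec (∀ j → exp α j ≡ 0)
  one? α = map′ fwd (λ e {j} _ → e j) (ℕₚ.allUpTo? (λ j → exp α j ≟ 0) (bound α))
    where
    fwd : (∀ {j} → j < bound α → exp α j ≡ 0) → ∀ j → exp α j ≡ 0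
    fwd e j with j <? bound α
    ... | yes j<b = e j<b
    ... | no  j≮b = vanishes α j (ℕₚ.≮⇒≥ j≮b)

  1ₛ : Series
  1ₛ = record { coeff = λ α → if does (one? α) then 1# else 0# ; coeff-cong = cg }
    where
    cg : ∀ α α′ → α ≐ α′ →
         (if does (one? α) then 1# else 0#) ≈ (if does (one? α′) then 1# else 0#)
    cg α α′ e = ≈-reflexive (cong (if_then 1# else 0#)
      (does-⇔ (mk⇔ (λ z j → trans (sym (e j)) (z j)) (λ z j → trans (e j) (z j)))
              (one? α) (one? α′)))

  infixl 6 _+ₛ_ _-ₛ_
  _+ₛ_ _-ₛ_ : Series → Series → Series
  h +ₛ g = record
    { coeff      = λ α → coeff h α + coeff g α
    ; coeff-cong = λ α α′ e → R.+-cong (coeff-cong h α α′ e) (coeff-cong g α α′ e) }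
  h -ₛ g = record
    { coeff      = λ α → coeff h α - coeff g α
    ; coeff-cong = λ α α′ e → R.+-cong (coeff-cong h α α′ e) (R.-‿cong (coeff-cong g α α′ e)) }

  infixr 7 _•_
  _•_ : Carrier → Series → Series
  a • h = record
    { coeff      = λ α → a * coeff h α
    ; coeff-cong = λ α α′ e → R.*-cong ≈-refl (coeff-cong h α α′ e) }

  lower : ℕ → (ℕ → Carrier) → Carrier
  lower zero    f = 0#
  lower (suc p) f = f p

  lower-cong : ∀ {p q f g} → p ≡ q → (∀ k → f k ≈ g k) → lower p f ≈ lower q g
  lower-cong {zero}  refl e = ≈-refl
  lower-cong {suc p} refl e = e p

  -- Product with variable i: the coefficient at a monomial m is that of h
  -- at m divided by the variable, and 0 if m is not divisible by it.
  infixr 7 x[_]·_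
  x[_]·_ : ℕ → Series → Series
  x[ i ]· h = record
    { coeff      = λ α → lower (exp α i) (λ p → coeff h (α [ i ≔ p ]))
    ; coeff-cong = λ α α′ e → lower-cong (e i) (λ k → coeff-cong h _ _ (update-cong i e refl)) }

  swapₛ : ℕ → Series → Series
  swapₛ i h = record
    { coeff      = λ α → coeff h (swap i α)
    ; coeff-cong = λ α α′ e → coeff-cong h _ _ (λ j → e (s i j)) }

  Σ≤ : ℕ → (ℕ → Carrier) → Carrier
  Σ≤ zero    t = t 0
  Σ≤ (suc n) t = t 0 + Σ≤ n (t ∘ suc)

  Σ≤-cong : ∀ n {t u} → (∀ k → t k ≈ u k) → Σ≤ n t ≈ Σ≤ n u
  Σ≤-cong zero    e = e 0
  Σ≤-cong (suc n) e = R.+-cong (e 0) (Σ≤-cong n (e ∘ suc))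

  numerator : ℕ → Series → Series
  numerator i h =
    (h +ₛ β • (x[ suc i ]· h)) -ₛ (swapₛ i h +ₛ β • (x[ i ]· swapₛ i h))

  -- The quotient of H by y − z, when it exists, for y and z the variables
  -- i and suc i: if (y − z) g = H then, writing [p , q] for a coefficient
  -- at the exponents p of y and q of z,
  -- g[p , q] = H[p+1 , q] + g[p+1 , q−1], which is unfolded down to q = 0.
  quotient : ℕ → Series → Series
  quotient i H = record
    { coeff      = λ α → Σ≤ (exp α (suc i)) (term α)
    ; coeff-cong = λ α α′ e →
        ≈-trans (≈-reflexive (cong (λ q → Σ≤ q (term α)) (e (suc i))))
                (Σ≤-cong (exp α′ (suc i)) (term-cong α α′ e)) }
    where
    term : Monomial → ℕ → Carrier
    term α k = coeff H (α [ i ≔ suc (exp α i ℕ.+ k) ] [ suc i ≔ exp α (suc i) ∸ k ])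
    term-cong : ∀ α α′ → α ≐ α′ → ∀ k → term α k ≈ term α′ k
    term-cong α α′ e k = coeff-cong H _ _
      (update-cong (suc i) (update-cong i e (cong (λ p → suc (p ℕ.+ k)) (e i)))
                        (cong (_∸ k) (e (suc i))))

  π : ℕ → Series → Series
  π i h = quotient i (numerator i h)

  private
    Σ≤-cong< : ∀ n {t u} → (∀ k → k ≤ n → t k ≈ u k) → Σ≤ n t ≈ Σ≤ n u
    Σ≤-cong< zero    e = e 0 z≤n
    Σ≤-cong< (suc n) e = R.+-cong (e 0 z≤n) (Σ≤-cong< n (λ k k≤n → e (suc k) (s≤s k≤n)))

    Σ≤-last : ∀ n t → Σ≤ (suc n) t ≈ Σ≤ n t + t (suc n)
    Σ≤-last zero    t = ≈-refl
    Σ≤-last (suc n) t =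
      ≈-trans (R.+-congˡ (Σ≤-last n (t ∘ suc))) (≈-sym (R.+-assoc _ _ _))

    Σ≤-rev : ∀ n t → Σ≤ n (λ k → t (n ∸ k)) ≈ Σ≤ n t
    Σ≤-rev zero    t = ≈-refl
    Σ≤-rev (suc n) t =
      ≈-trans (R.+-congˡ (Σ≤-rev n t)) (≈-trans (R.+-comm _ _) (≈-sym (Σ≤-last n t)))

    Σ≤-diff : ∀ n t u → Σ≤ n (λ k → t k - u k) ≈ Σ≤ n t - Σ≤ n u
    Σ≤-diff zero    t u = ≈-refl
    Σ≤-diff (suc n) t u =
      ≈-trans (R.+-congˡ (Σ≤-diff n (t ∘ suc) (u ∘ suc)))
        (≈-trans (interchange _ _ _ _) (R.+-congˡ (⁻¹-∙-comm _ _)))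
      where
      open import Algebra.Properties.CommutativeSemigroup R.+-commutativeSemigroup
        using (interchange)
      open import Algebra.Properties.AbelianGroup R.+-abelianGroup using (⁻¹-∙-comm)

    antidiagonal : ∀ (K : ℕ → ℕ → Carrier) n →
                   Σ≤ n (λ k → K k (n ∸ k) - K (n ∸ k) k) ≈ 0#
    antidiagonal K n =
      ≈-trans (Σ≤-diff n _ _)
        (≈-trans (R.+-congˡ (R.-‿cong
           (≈-trans (Σ≤-cong< n (λ k k≤n → ≈-reflexive
                       (cong (K (n ∸ k)) (sym (ℕₚ.m∸[m∸n]≡n k≤n)))))
                    (Σ≤-rev n (λ k → K k (n ∸ k))))))
           (R.-‿inverseʳ _))

    telescope : ∀ (F : ℕ → ℕ → Carrier) → (∀ n → Σ≤ n (λ k → F k (n ∸ k)) ≈ 0#) → ∀ p q →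
      lower p (λ p′ → Σ≤ q  (λ k → F (suc (p′ ℕ.+ k)) (q ∸ k))) -
      lower q (λ q′ → Σ≤ q′ (λ k → F (suc (p ℕ.+ k)) (q′ ∸ k))) ≈ F p q
    telescope F z zero    zero    = ≈-trans (R.-‿inverseʳ 0#) (≈-sym (z 0))
    telescope F z zero    (suc q) =
      ≈-trans (R.+-congʳ (≈-sym (z (suc q)))) (cancelʳ _ _)
      where
      cancelʳ : ∀ a b → a + b - b ≈ a
      cancelʳ a b = ≈-trans (R.+-assoc a b _)
        (≈-trans (R.+-congˡ (R.-‿inverseʳ b)) (R.+-identityʳ a))
    telescope F z (suc p) zero    =
      ≈-trans (R.+-cong (≈-reflexive (cong (λ m → F (suc m) 0) (ℕₚ.+-identityʳ p)))
                        (≈-trans (≈-sym (R.+-identityˡ _)) (R.-‿inverseʳ 0#)))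
              (R.+-identityʳ _)
    telescope F z (suc p) (suc q) =
      ≈-trans (R.+-assoc _ _ _)
        (≈-trans (R.+-cong (≈-reflexive (cong (λ m → F (suc m) (suc q)) (ℕₚ.+-identityʳ p)))
                    (≈-trans (R.+-congʳ (Σ≤-cong q (λ k → ≈-reflexive
                                (cong (λ m → F (suc m) (q ∸ k)) (ℕₚ.+-suc p k)))))
                             (R.-‿inverseʳ _)))
                 (R.+-identityʳ _))

    module _ (i : ℕ) where

      agree : ∀ {γ δ} → exp γ i ≡ exp δ i → exp γ (suc i) ≡ exp δ (suc i) →
              (∀ j → j ≢ i → j ≢ suc i → exp γ j ≡ exp δ j) → γ ≐ δ
      agree a b c j with j ≟ i | j ≟ suc i
      ... | yes refl | _        = a
      ... | no _     | yes refl = b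
      ... | no n     | no m     = c j n m

      si≢i : suc i ≢ i
      si≢i = ℕₚ.1+n≢n

      at : Monomial → ℕ → ℕ → Monomial
      at α p q = α [ i ≔ p ] [ suc i ≔ q ]

      at-i : ∀ α p q → exp (at α p q) i ≡ p
      at-i α p q = trans (update-other (exp (α [ i ≔ p ])) (suc i) q i (si≢i ∘ sym))
                         (update-same (exp α) i p)

      at-suc : ∀ α p q → exp (at α p q) (suc i) ≡ q
      at-suc α p q = update-same (exp (α [ i ≔ p ])) (suc i) q

      at-other : ∀ α p q j → j ≢ i → j ≢ suc i → exp (at α p q) j ≡ exp α j
      at-other α p q j n m = trans (update-other (exp (α [ i ≔ p ])) (suc i) q j m)
                                   (update-other (exp α) i p j n)

      quotient-at : ∀ H {α γ a b} → exp γ i ≡ a → exp γ (suc i) ≡ b →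
        (∀ j → j ≢ i → j ≢ suc i → exp γ j ≡ exp α j) →
        coeff (quotient i H) γ ≈ Σ≤ b (λ k → coeff H (at α (suc (a ℕ.+ k)) (b ∸ k)))
      quotient-at H {α} {γ} refl refl c = Σ≤-cong (exp γ (suc i)) λ k → coeff-cong H _ _
        (agree {at γ _ _} {at α _ _}
          (trans (at-i γ _ _) (sym (at-i α _ _)))
          (trans (at-suc γ _ _) (sym (at-suc α _ _)))
          (λ j n m → trans (at-other γ _ _ j n m) (trans (c j n m) (sym (at-other α _ _ j n m)))))

      quotient-correct : ∀ H →
        (∀ α n → Σ≤ n (λ k → coeff H (at α k (n ∸ k))) ≈ 0#) →
        (x[ i ]· quotient i H) -ₛ (x[ suc i ]· quotient i H) ≈ₛ H
      quotient-correct H z α = ≈-trans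
        (R.+-cong
          (lower-cong {p = exp α i} refl (λ p → quotient-at H {α} {α [ i ≔ p ]}
            (update-same (exp α) i p) (update-other (exp α) i p (suc i) si≢i)
            (λ j n m → update-other (exp α) i p j n)))
          (R.-‿cong (lower-cong {p = exp α (suc i)} refl (λ q → quotient-at H {α} {α [ suc i ≔ q ]}
            (update-other (exp α) (suc i) q i (si≢i ∘ sym)) (update-same (exp α) (suc i) q)
            (λ j n m → update-other (exp α) (suc i) q j m)))))
        (≈-trans (telescope (λ p q → coeff H (at α p q)) (z α) (exp α i) (exp α (suc i)))
          (coeff-cong H _ _ (agree {at α _ _} {α} (at-i α _ _) (at-suc α _ _) (at-other α _ _))))

      swap-update : ∀ γ p → swap i (γ [ i ≔ p ]) ≐ swap i γ [ suc i ≔ p ]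
      swap-update γ p = agree {swap i (γ [ i ≔ p ])} {swap i γ [ suc i ≔ p ]}
        (trans (cong (exp (γ [ i ≔ p ])) (s-at i))
          (trans (update-other (exp γ) i p (suc i) si≢i)
            (sym (trans (update-other (exp (swap i γ)) (suc i) p i (si≢i ∘ sym))
                        (cong (exp γ) (s-at i))))))
        (trans (cong (exp (γ [ i ≔ p ])) (s-at-suc i))
          (trans (update-same (exp γ) i p) (sym (update-same (exp (swap i γ)) (suc i) p))))
        (λ j n m → trans (cong (exp (γ [ i ≔ p ])) (s-other i j n m))
          (trans (update-other (exp γ) i p j n)
            (sym (trans (update-other (exp (swap i γ)) (suc i) p j m)
                        (cong (exp γ) (s-other i j n m))))))

      swap-at : ∀ α p q → swap i (at α p q) ≐ at α q p
      swap-at α p q = agree {swap i (at α p q)} {at α q p}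
        (trans (cong (exp (at α p q)) (s-at i)) (trans (at-suc α p q) (sym (at-i α q p))))
        (trans (cong (exp (at α p q)) (s-at-suc i)) (trans (at-i α p q) (sym (at-suc α q p))))
        (λ j n m → trans (cong (exp (at α p q)) (s-other i j n m))
          (trans (at-other α p q j n m) (sym (at-other α q p j n m))))

      numerator-vanishes : ∀ h α n → Σ≤ n (λ k → coeff (numerator i h) (at α k (n ∸ k))) ≈ 0#
      numerator-vanishes h α n =
        ≈-trans (Σ≤-cong n (λ k → R.+-congˡ (R.-‿cong (swapped k (n ∸ k)))))
                (antidiagonal (λ p q → coeff K (at α p q)) n)
        where
        K : Series
        K = h +ₛ β • (x[ suc i ]· h)
        swapped : ∀ p q → coeff (swapₛ i h +ₛ β • (x[ i ]· swapₛ i h)) (at α p q) ≈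
                          coeff K (at α q p)
        swapped p q = ≈-trans
          (R.+-congˡ (R.*-congˡ (lower-cong
            (cong (exp (at α p q)) (sym (s-at-suc i)))
            (λ a → coeff-cong h _ _ (swap-update (at α p q) a)))))
          (coeff-cong K _ _ (swap-at α p q))

  π-correct : ∀ i h → (x[ i ]· π i h) -ₛ (x[ suc i ]· π i h) ≈ₛ numerator i h
  π-correct i h = quotient-correct i (numerator i h) (numerator-vanishes i h)

  -- The first letter of the word acts first.
  πWord : List ℕ → Series → Series
  πWord []       h = h
  πWord (i ∷ is) h = πWord is (π i h)

  -- g = π_w h, with π_w computed along a reduced expression of w.
  infix 4 _≈π[_]_
  _≈π[_]_ : Series → (ℕ → ℕ) → Series → Set ℓ
  g ≈π[ w ] h = ∃[ u ] (IsReducedExpression u w × g ≈ₛ πWord u h)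

  ∏x : List ℕ → Series
  ∏x = foldr x[_]·_ 1ₛ

  x^ : ∀ {r} → (Fin r → ℕ) → Series
  x^ {r} a = ∏x (concatMap (λ i → replicate (a i) (toℕ i)) (allFin r))

  G : ∀ {r} (lam f : Fin r → ℕ) → Series
  G lam f = foldr _+ₛ_ 0ₛ
    (map (λ T → β ^ (length (entries T) ∸ ∣ lam ∣) • ∏x (entries T)) (FSVT lam f))

open PowerSeries ℤ[β] βₚ public

{-# OPTIONS --safe #-}

-- Group the tableaux by the minima of their boxes: if v_i^k is the number of boxes of
-- row i with minimum at most k, then G is the sum over the arrays v of the products of
-- x_k^(v_i^k − v_i^(k−1)) and of τ_k(v_i^(k−1), v_{i+1}^k), where τ_k(a, p) is
-- 1 + βx_k if p < a, 1 if p = a, and 0 if p > a.  In such a sum v_i^k meets only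
-- v_i^(k±1), v_{i−1}^(k−1) and v_{i+1}^(k+1), so the sums over v_1^k, v_2^k, … with the
-- other counts fixed are independent, and each can be computed.  When all rows below
-- the first may use k + 1, they are symmetric in x_k and x_{k+1} up to a factor which
-- combines with the first row, and π_k turns a first row of length n + 1 with letters
-- up to k into one of length n with letters up to k + 1.  Starting from the row of
-- length λ_i + f_i − i with the single letter i, which only contributes a power of x_i,
-- these steps build G row by row from the bottom, along the word for w.

module Submission where

open import Algebra.Bundles using (CommutativeRing; CommutativeSemiring)
open import Algebra.Morphism.Structures using (IsSemiringHomomorphism)
open import Algebra.Structures.Biased using (isCommutativeSemiringˡ; isCommutativeMonoidˡ)
open import Data.Bool using (Bool; true; false; if_then_else_)
import Data.Bool.Properties as Boolₚ
open import Data.Fin as Fin using (Fin; toℕ; fromℕ<)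
import Data.Fin.Properties as Finₚ
open import Data.Fin.Properties using (∀-cons)
open import Data.Fin.Subset using (Subset; Nonempty; _∈_)
open import Data.Fin.Subset.Properties using (_∈?_; nonempty?)
open import Data.List using (List; []; _∷_; _++_; _∷ʳ_; map; concatMap; cartesianProductWith; filter;
  foldl; foldr; replicate; reverse; allFin; upTo; tabulate; drop; length)
open import Data.List.Membership.Propositional using () renaming (_∈_ to _∈ₗ_)
open import Data.List.Membership.Propositional.Properties using (∈-upTo⁻; ∈-cartesianProductWith⁻)
open import Data.List.Properties using (map-id; map-∘; map-cong; map-++; map-tabulate; map-upTo;
  map-replicate; map-concatMap; concatMap-cong; concatMap-map; concatMap-++; length-++; length-map;
  length-upTo; upTo-∷ʳ; unfold-reverse; reverse-map; tabulate-cong; ++-identityʳ)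
open import Data.List.Relation.Unary.All as All using (All; []; _∷_)
import Data.List.Relation.Unary.All.Properties as Allₚ
open import Data.List.Relation.Unary.Any using (here; there)
open import Data.List.Relation.Unary.Linked using (Linked; []; [-]; _∷_)
open import Data.Nat as ℕ using (ℕ; zero; suc; _∸_; _≤_; _<_; z≤n; s≤s; _≤?_; _<?_; _≟_)
open import Data.Nat.ListAction using (sum)
import Data.Nat.Properties as ℕₚ
open import Data.Product using (∃-syntax; _×_; _,_; proj₁; proj₂)
open import Data.Sum using (_⊎_; inj₁; inj₂)
open import Data.Vec using ([]; _∷_; head; tail; here; there)
open import Function using (_∘_; id; mk⇔)
import Level
open import Relation.Binary.PropositionalEquality as ≡ using (_≡_; _≢_; _≗_)
open import Relation.Binary.Structures using (IsEquivalence)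
open import Relation.Nullary using (Dec; yes; no; does; contradiction; ¬_)
open import Relation.Nullary.Decidable using (_×-dec_; _→-dec_; map′; does-⇔)
open import Relation.Unary using (Pred; Decidable)
open import Defs using (s; s-at; s-at-suc; s-other; exp; _≐_; update-same;
  update-other; update-cong; _[_≔_]; swap; perm; IsReducedExpression; IsPartition; IsFlagging;
  Filling; IsMax; IsMin; BoxesNonempty; RowsWeak; ColumnsStrict; IsFSVT; isFSVT?; entries; subsets;
  sections; FSVT; ∣_∣; flagFactor; flagWord; startExponent; module PowerSeries)

-- Finite sums

module Sums {c ℓ} (A : CommutativeSemiring c ℓ) where

  open CommutativeSemiring A
  open import Algebra.Properties.CommutativeSemigroup +-commutativeSemigroup
    using (interchange)
  open import Relation.Binary.Reasoning.Setoid setoid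

  ∑ : ∀ {i} {I : Set i} → List I → (I → Carrier) → Carrier
  ∑ []      t = 0#
  ∑ (i ∷ L) t = t i + ∑ L t

  infixr 5 ∑-syntax
  ∑-syntax : ∀ {i} {I : Set i} → List I → (I → Carrier) → Carrier
  ∑-syntax = ∑
  syntax ∑-syntax L (λ i → t) = ∑[ i ∈ L ] t

  module _ {i} {I : Set i} where

    ∑-cong-∈ : ∀ (L : List I) {t u} → (∀ {i} → i ∈ₗ L → t i ≈ u i) → ∑ L t ≈ ∑ L u
    ∑-cong-∈ []      e = refl
    ∑-cong-∈ (i ∷ L) e = +-cong (e (here ≡.refl)) (∑-cong-∈ L (e ∘ there))

    ∑-cong : ∀ (L : List I) {t u} → (∀ i → t i ≈ u i) → ∑ L t ≈ ∑ L u
    ∑-cong L e = ∑-cong-∈ L (λ {i} _ → e i)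

    ∑-zero : ∀ (L : List I) {t} → (∀ {i} → i ∈ₗ L → t i ≈ 0#) → ∑ L t ≈ 0#
    ∑-zero []      e = refl
    ∑-zero (i ∷ L) e = trans (+-cong (e (here ≡.refl)) (∑-zero L (e ∘ there))) (+-identityˡ 0#)

    ∑-+ : ∀ (L : List I) t u → ∑[ i ∈ L ] (t i + u i) ≈ ∑ L t + ∑ L u
    ∑-+ []      t u = sym (+-identityˡ 0#)
    ∑-+ (i ∷ L) t u = trans (+-congˡ (∑-+ L t u)) (interchange _ _ _ _)

    *-∑ : ∀ (L : List I) a t → a * ∑ L t ≈ ∑[ i ∈ L ] a * t i
    *-∑ []      a t = zeroʳ a
    *-∑ (i ∷ L) a t = trans (distribˡ _ _ _) (+-congˡ (*-∑ L a t))

    ∑-* : ∀ (L : List I) a t → ∑ L t * a ≈ ∑[ i ∈ L ] t i * a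
    ∑-* L a t = trans (*-comm _ _) (trans (*-∑ L a t) (∑-cong L (λ _ → *-comm _ _)))

    ∑-++ : ∀ (L M : List I) t → ∑ (L ++ M) t ≈ ∑ L t + ∑ M t
    ∑-++ []      M t = sym (+-identityˡ _)
    ∑-++ (i ∷ L) M t = trans (+-congˡ (∑-++ L M t)) (sym (+-assoc _ _ _))

    ∑-map : ∀ {j} {J : Set j} (h : J → I) L t → ∑ (map h L) t ≡ ∑ L (t ∘ h)
    ∑-map h []      t = ≡.refl
    ∑-map h (j ∷ L) t = ≡.cong (t (h j) +_) (∑-map h L t)

  ∑-comm : ∀ {i j} {I : Set i} {J : Set j} (L : List I) (M : List J) (t : I → J → Carrier) →
           ∑[ i ∈ L ] ∑[ j ∈ M ] t i j ≈ ∑[ j ∈ M ] ∑[ i ∈ L ] t i j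
  ∑-comm []      M t = sym (∑-zero M (λ _ → refl))
  ∑-comm (i ∷ L) M t = trans (+-congˡ (∑-comm L M t)) (sym (∑-+ M _ _))

  ∑-cartesianProductWith : ∀ {i j k} {I : Set i} {J : Set j} {K : Set k}
    (h : I → J → K) L M t →
    ∑ (cartesianProductWith h L M) t ≈ ∑[ i ∈ L ] ∑[ j ∈ M ] t (h i j)
  ∑-cartesianProductWith h []      M t = refl
  ∑-cartesianProductWith h (i ∷ L) M t = begin
    ∑ (map (h i) M ++ cartesianProductWith h L M) t
      ≈⟨ ∑-++ (map (h i) M) _ t ⟩
    ∑ (map (h i) M) t + ∑ (cartesianProductWith h L M) t
      ≈⟨ +-cong (reflexive (∑-map (h i) M t)) (∑-cartesianProductWith h L M t) ⟩
    ∑ M (t ∘ h i) + (∑[ i ∈ L ] ∑[ j ∈ M ] t (h i j)) ∎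

  upTo-suc : ∀ n t → ∑ (upTo (suc n)) t ≈ t 0 + ∑ (upTo n) (t ∘ suc)
  upTo-suc n t = +-congˡ (reflexive
    (≡.trans (≡.cong (λ L → ∑ L t) (≡.sym (map-upTo suc n))) (∑-map suc (upTo n) t)))

  upTo-cong : ∀ n {t u} → (∀ k → k ≤ n → t k ≈ u k) → ∑ (upTo (suc n)) t ≈ ∑ (upTo (suc n)) u
  upTo-cong n e = ∑-cong-∈ _ (λ k∈ → e _ (ℕ.s≤s⁻¹ (∈-upTo⁻ k∈)))

  tuples : ℕ → ℕ → List (List ℕ)
  tuples n zero    = [] ∷ []
  tuples n (suc m) = cartesianProductWith _∷_ (upTo (suc n)) (tuples n m)

  ∑-tuples-suc : ∀ n m t → ∑ (tuples n (suc m)) t ≈ ∑[ a ∈ upTo (suc n) ] ∑[ v ∈ tuples n m ] t (a ∷ v)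
  ∑-tuples-suc n m t = ∑-cartesianProductWith _∷_ (upTo (suc n)) (tuples n m) t

-- Sums over the count of one row at one letter

module Weights {c ℓ} (A : CommutativeSemiring c ℓ) (b : CommutativeSemiring.Carrier A) where

  open CommutativeSemiring A
  open import Algebra.Properties.Semiring.Exp semiring using (_^_)

  -- Let a row have a boxes with minimum less than a letter z, and p with minimum at
  -- most z; then e z a p is the contribution of the boxes with minimum z.  If the row
  -- below has p boxes with minimum at most z, then the last of the a boxes may contain z
  -- as well when p < a, but not when p = a, and p > a is impossible; this is τ z a p.
  e τ : Carrier → ℕ → ℕ → Carrier
  e z zero    p       = z ^ p
  e z (suc a) zero    = 0#
  e z (suc a) (suc p) = e z a p

  τ z zero    zero    = 1#
  τ z zero    (suc p) = 0#
  τ z (suc a) zero    = 1# + b * z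
  τ z (suc a) (suc p) = τ z a p

  module TwoVariables
    (σ : Carrier → Carrier) (σ-hom : IsSemiringHomomorphism rawSemiring rawSemiring σ)
    (X Y : Carrier) (σ-X : σ X ≈ Y) (σ-Y : σ Y ≈ X) (σ-b : σ b ≈ b) where

    open Sums A
    open IsSemiringHomomorphism σ-hom
    open import Algebra.Solver.Ring.NaturalCoefficients.Default A
    open import Relation.Binary.Reasoning.Setoid setoid

    Sym : Carrier → Set ℓ
    Sym a = σ a ≈ a

    Sym-resp : ∀ {a a′} → a ≈ a′ → Sym a′ → Sym a
    Sym-resp q s = trans (⟦⟧-cong q) (trans s (sym q))

    Sym-+ : ∀ {a a′} → Sym a → Sym a′ → Sym (a + a′)
    Sym-+ s s′ = trans (+-homo _ _) (+-cong s s′)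

    Sym-* : ∀ {a a′} → Sym a → Sym a′ → Sym (a * a′)
    Sym-* s s′ = trans (*-homo _ _) (*-cong s s′)

    Sym-^ : ∀ {a} n → Sym a → Sym (a ^ n)
    Sym-^ zero    s = 1#-homo
    Sym-^ (suc n) s = Sym-* s (Sym-^ n s)

    Sym-∑ : ∀ {i} {I : Set i} (L : List I) {t} → (∀ {i} → i ∈ₗ L → Sym (t i)) → Sym (∑ L t)
    Sym-∑ []      s = 0#-homo
    Sym-∑ (i ∷ L) s = Sym-+ (s (here ≡.refl)) (Sym-∑ L (s ∘ there))

    Sym-XY : Sym (X * Y)
    Sym-XY = trans (*-homo X Y) (trans (*-cong σ-X σ-Y) (*-comm Y X))

    σ-1+bX : σ (1# + b * X) ≈ 1# + b * Y
    σ-1+bX = trans (+-homo _ _) (+-cong 1#-homo (trans (*-homo _ _) (*-cong σ-b σ-X)))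

    σ-1+bY : σ (1# + b * Y) ≈ 1# + b * X
    σ-1+bY = trans (+-homo _ _) (+-cong 1#-homo (trans (*-homo _ _) (*-cong σ-b σ-Y)))

    Sym-[1+bX][1+bY] : Sym ((1# + b * X) * (1# + b * Y))
    Sym-[1+bX][1+bY] = trans (*-homo _ _) (trans (*-cong σ-1+bX σ-1+bY) (*-comm _ _))

    σ-^ : ∀ {a a′} → σ a ≈ a′ → ∀ n → σ (a ^ n) ≈ a′ ^ n
    σ-^ q zero    = 1#-homo
    σ-^ q (suc n) = trans (*-homo _ _) (*-cong q (σ-^ q n))

    -- (x − y) g = (1 + βy) p − (1 + βx) σ(p), without subtraction
    Π : Carrier → Carrier → Set ℓ
    Π p g = (1# + b * Y) * p + Y * g ≈ (1# + b * X) * σ p + X * g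

    Π-resp : ∀ {p p′ g g′} → p ≈ p′ → g ≈ g′ → Π p′ g′ → Π p g
    Π-resp {p} {p′} {g} {g′} q q′ r = begin
      (1# + b * Y) * p + Y * g      ≈⟨ +-cong (*-congˡ q) (*-congˡ q′) ⟩
      (1# + b * Y) * p′ + Y * g′    ≈⟨ r ⟩
      (1# + b * X) * σ p′ + X * g′  ≈⟨ +-cong (*-congˡ (⟦⟧-cong q)) (*-congˡ q′) ⟨
      (1# + b * X) * σ p + X * g    ∎

    Π-* : ∀ {s p g} → Sym s → Π p g → Π (s * p) (s * g)
    Π-* {s} {p} {g} q r = begin
      (1# + b * Y) * (s * p) + Y * (s * g)
        ≈⟨ solve 5 (λ u v s p g → u :* (s :* p) :+ v :* (s :* g) := s :* (u :* p :+ v :* g))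
             refl (1# + b * Y) Y s p g ⟩
      s * ((1# + b * Y) * p + Y * g)
        ≈⟨ *-congˡ r ⟩
      s * ((1# + b * X) * σ p + X * g)
        ≈⟨ solve 5 (λ u v s p g → s :* (u :* p :+ v :* g) := u :* (s :* p) :+ v :* (s :* g))
             refl (1# + b * X) X s (σ p) g ⟩
      (1# + b * X) * (s * σ p) + X * (s * g)
        ≈⟨ +-congʳ (*-congˡ (trans (*-homo s p) (*-congʳ q))) ⟨
      (1# + b * X) * σ (s * p) + X * (s * g) ∎

    Π-0 : Π 0# 0#
    Π-0 = trans (trans (+-cong (zeroʳ _) (zeroʳ _)) (sym (+-cong (zeroʳ _) (zeroʳ _))))
                (+-congʳ (*-congˡ (sym 0#-homo)))

    Π-+ : ∀ {p p′ g g′} → Π p g → Π p′ g′ → Π (p + p′) (g + g′)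
    Π-+ {p} {p′} {g} {g′} r r′ = begin
      (1# + b * Y) * (p + p′) + Y * (g + g′)
        ≈⟨ lem (1# + b * Y) Y p p′ g g′ ⟩
      ((1# + b * Y) * p + Y * g) + ((1# + b * Y) * p′ + Y * g′)
        ≈⟨ +-cong r r′ ⟩
      ((1# + b * X) * σ p + X * g) + ((1# + b * X) * σ p′ + X * g′)
        ≈⟨ lem (1# + b * X) X (σ p) (σ p′) g g′ ⟨
      (1# + b * X) * (σ p + σ p′) + X * (g + g′)
        ≈⟨ +-congʳ (*-congˡ (+-homo p p′)) ⟨
      (1# + b * X) * σ (p + p′) + X * (g + g′) ∎
      where
      lem = solve 6 (λ u v p p′ g g′ → u :* (p :+ p′) :+ v :* (g :+ g′) :=
                     (u :* p :+ v :* g) :+ (u :* p′ :+ v :* g′)) refl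

    Π-∑ : ∀ {i} {I : Set i} (L : List I) {t u} → (∀ {i} → i ∈ₗ L → Π (t i) (u i)) → Π (∑ L t) (∑ L u)
    Π-∑ []      r = Π-0
    Π-∑ (i ∷ L) r = Π-+ (r (here ≡.refl)) (Π-∑ L (r ∘ there))

    h h′ : ℕ → Carrier
    h zero    = 1#
    h (suc n) = Y ^ suc n + X * h n
    h′ zero    = 0#
    h′ (suc n) = h n

    h-balance : ∀ n → X ^ suc n + Y * h n ≈ Y ^ suc n + X * h n
    h-balance zero    = solve 2 (λ x y → x :* con 1 :+ y :* con 1 := y :* con 1 :+ x :* con 1) refl X Y
    h-balance (suc n) = begin
      X * X ^ suc n + Y * (Y ^ suc n + X * h n)
        ≈⟨ solve 5 (λ x y p q g → x :* p :+ y :* (q :+ x :* g) := y :* q :+ x :* (p :+ y :* g))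
             refl X Y (X ^ suc n) (Y ^ suc n) (h n) ⟩
      Y * Y ^ suc n + X * (X ^ suc n + Y * h n)
        ≈⟨ +-congˡ (*-congˡ (h-balance n)) ⟩
      Y * Y ^ suc n + X * (Y ^ suc n + X * h n) ∎

    h-sym : ∀ n → Sym (h n)
    h-sym zero    = 1#-homo
    h-sym (suc n) = begin
      σ (Y ^ suc n + X * h n)        ≈⟨ +-homo _ _ ⟩
      σ (Y ^ suc n) + σ (X * h n)    ≈⟨ +-cong (σ-^ σ-Y (suc n)) (trans (*-homo _ _) (*-cong σ-X (h-sym n))) ⟩
      X ^ suc n + Y * h n            ≈⟨ h-balance n ⟩
      Y ^ suc n + X * h n            ∎

    h′-sym : ∀ n → Sym (h′ n)
    h′-sym zero    = 0#-homo
    h′-sym (suc n) = h-sym n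

    bXY-sym : Sym (b * (X * Y))
    bXY-sym = Sym-* σ-b Sym-XY

    f₀ f₁ g₀ g₁ : ℕ → ℕ → Carrier
    f₀ p m = e X p m
    f₁ p m = e X p m * τ Y m p
    g₀ m q = e Y m q
    g₁ m q = e Y m q * τ X q m

    h₁ : ℕ → Carrier
    h₁ n = h n + b * (X * Y) * h′ n

    h₁-sym : ∀ n → Sym (h₁ n)
    h₁-sym n = Sym-+ (h-sym n) (Sym-* bXY-sym (h′-sym n))

    h₁-suc : ∀ n → (1# + b * X) * Y ^ suc n + X * h₁ n ≈ h₁ (suc n)
    h₁-suc zero    = solve 3 (λ b x y → (con 1 :+ b :* x) :* (y :* con 1) :+ x :* (con 1 :+ b :* (x :* y) :* con 0) :=
                                       (y :* con 1 :+ x :* con 1) :+ b :* (x :* y) :* con 1) refl b X Y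
    h₁-suc (suc n) = solve 5 (λ b x y q g →
      (con 1 :+ b :* x) :* (y :* q) :+ x :* ((q :+ x :* g) :+ b :* (x :* y) :* g) :=
      (y :* q :+ x :* (q :+ x :* g)) :+ b :* (x :* y) :* (q :+ x :* g)) refl b X Y (Y ^ suc n) (h n)

    interlace : (f g : ℕ → ℕ → Carrier) → ℕ → ℕ → ℕ → Carrier
    interlace f g n p q = ∑[ m ∈ upTo (suc n) ] f p m * g m q

    interlace₀₀ : ∀ {n q} → q ≤ n → interlace f₀ g₀ n 0 q ≈ h q
    interlace₀₀ {n} {zero} _ = begin
      ∑[ m ∈ upTo (suc n) ] X ^ m * e Y m 0  ≈⟨ upTo-suc n _ ⟩
      1# * 1# + (∑[ m ∈ upTo n ] X ^ suc m * 0#)  ≈⟨ +-cong (*-identityˡ 1#) (∑-zero (upTo n) (λ _ → zeroʳ _)) ⟩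
      1# + 0#  ≈⟨ +-identityʳ 1# ⟩
      1# ∎
    interlace₀₀ {suc n} {suc q} (s≤s q≤n) = begin
      ∑[ m ∈ upTo (suc (suc n)) ] X ^ m * e Y m (suc q)  ≈⟨ upTo-suc (suc n) _ ⟩
      1# * Y ^ suc q + (∑[ m ∈ upTo (suc n) ] X ^ suc m * e Y m q)
        ≈⟨ +-cong (*-identityˡ _) (trans (∑-cong (upTo (suc n)) (λ m → *-assoc _ _ _)) (sym (*-∑ (upTo (suc n)) X _))) ⟩
      Y ^ suc q + X * interlace f₀ g₀ n 0 q  ≈⟨ +-congˡ (*-congˡ (interlace₀₀ q≤n)) ⟩
      Y ^ suc q + X * h q ∎

    interlace₁₀ : ∀ {n q} → q ≤ n → interlace f₁ g₀ n 0 q ≈ h₁ q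
    interlace₁₀ {n} {zero} _ = begin
      ∑[ m ∈ upTo (suc n) ] f₁ 0 m * e Y m 0  ≈⟨ upTo-suc n _ ⟩
      1# * 1# * 1# + (∑[ m ∈ upTo n ] f₁ 0 (suc m) * 0#)  ≈⟨ +-congˡ (∑-zero (upTo n) (λ _ → zeroʳ _)) ⟩
      1# * 1# * 1# + 0#  ≈⟨ solve 1 (λ u → con 1 :* con 1 :* con 1 :+ con 0 := con 1 :+ u :* con 0) refl (b * (X * Y)) ⟩
      1# + b * (X * Y) * 0# ∎
    interlace₁₀ {suc n} {suc q} (s≤s q≤n) = begin
      ∑[ m ∈ upTo (suc (suc n)) ] f₁ 0 m * e Y m (suc q)  ≈⟨ upTo-suc (suc n) _ ⟩
      1# * 1# * Y ^ suc q + (∑[ m ∈ upTo (suc n) ] X ^ suc m * (1# + b * Y) * e Y m q)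
        ≈⟨ +-congˡ (trans (∑-cong (upTo (suc n)) (λ m → solve 4 (λ x u v w → x :* u :* v :* w := x :* v :* (u :* w)) refl X (X ^ m) (1# + b * Y) (e Y m q)))
             (sym (*-∑ (upTo (suc n)) (X * (1# + b * Y)) _))) ⟩
      1# * 1# * Y ^ suc q + X * (1# + b * Y) * interlace f₀ g₀ n 0 q  ≈⟨ +-congˡ (*-congˡ (interlace₀₀ q≤n)) ⟩
      1# * 1# * Y ^ suc q + X * (1# + b * Y) * h q
        ≈⟨ solve 5 (λ b x y u w → con 1 :* con 1 :* u :+ x :* (con 1 :+ b :* y) :* w := (u :+ x :* w) :+ b :* (x :* y) :* w) refl b X Y (Y ^ suc q) (h q) ⟩
      h₁ (suc q) ∎

    interlace₀₁ : ∀ {n q} → q ≤ n → interlace f₀ g₁ n 0 q ≈ h₁ q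
    interlace₀₁ {n} {zero} _ = begin
      ∑[ m ∈ upTo (suc n) ] X ^ m * g₁ m 0  ≈⟨ upTo-suc n _ ⟩
      1# * (1# * 1#) + (∑[ m ∈ upTo n ] X ^ suc m * (0# * τ X 0 (suc m)))
        ≈⟨ +-congˡ (∑-zero (upTo n) (λ _ → trans (*-congˡ (zeroˡ _)) (zeroʳ _))) ⟩
      1# * (1# * 1#) + 0#  ≈⟨ solve 1 (λ u → con 1 :* (con 1 :* con 1) :+ con 0 := con 1 :+ u :* con 0) refl (b * (X * Y)) ⟩
      1# + b * (X * Y) * 0# ∎
    interlace₀₁ {suc n} {suc q} (s≤s q≤n) = begin
      ∑[ m ∈ upTo (suc (suc n)) ] X ^ m * g₁ m (suc q)  ≈⟨ upTo-suc (suc n) _ ⟩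
      1# * (Y ^ suc q * (1# + b * X)) + (∑[ m ∈ upTo (suc n) ] X ^ suc m * g₁ m q)
        ≈⟨ +-cong (trans (*-identityˡ _) (*-comm _ _)) (trans (∑-cong (upTo (suc n)) (λ m → *-assoc _ _ _)) (sym (*-∑ (upTo (suc n)) X _))) ⟩
      (1# + b * X) * Y ^ suc q + X * interlace f₀ g₁ n 0 q  ≈⟨ +-congˡ (*-congˡ (interlace₀₁ q≤n)) ⟩
      (1# + b * X) * Y ^ suc q + X * h₁ q  ≈⟨ h₁-suc q ⟩
      h₁ (suc q) ∎

    h₂ : ℕ → Carrier
    h₂ zero    = 1#
    h₂ (suc n) = h (suc n) + b * (X * Y) * (h n + h₁ n)

    h₂-sym : ∀ n → Sym (h₂ n)
    h₂-sym zero    = 1#-homo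
    h₂-sym (suc n) = Sym-+ (h-sym (suc n)) (Sym-* bXY-sym (Sym-+ (h-sym n) (h₁-sym n)))

    h₂-suc : ∀ n → (1# + b * X) * Y ^ suc n + X * (1# + b * Y) * h₁ n ≈ h₂ (suc n)
    h₂-suc n = begin
      (1# + b * X) * Y ^ suc n + X * (1# + b * Y) * h₁ n
        ≈⟨ solve 5 (λ b x y q g → (con 1 :+ b :* x) :* q :+ x :* (con 1 :+ b :* y) :* g :=
             ((con 1 :+ b :* x) :* q :+ x :* g) :+ b :* (x :* y) :* g) refl b X Y (Y ^ suc n) (h₁ n) ⟩
      ((1# + b * X) * Y ^ suc n + X * h₁ n) + b * (X * Y) * h₁ n
        ≈⟨ +-congʳ (h₁-suc n) ⟩
      (h (suc n) + b * (X * Y) * h n) + b * (X * Y) * h₁ n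
        ≈⟨ solve 4 (λ a u v w → (a :+ u :* v) :+ u :* w := a :+ u :* (v :+ w)) refl (h (suc n)) (b * (X * Y)) (h n) (h₁ n) ⟩
      h₂ (suc n) ∎

    interlace₁₁ : ∀ {n q} → q ≤ n → interlace f₁ g₁ n 0 q ≈ h₂ q
    interlace₁₁ {n} {zero} _ = begin
      ∑[ m ∈ upTo (suc n) ] f₁ 0 m * g₁ m 0  ≈⟨ upTo-suc n _ ⟩
      1# * 1# * (1# * 1#) + (∑[ m ∈ upTo n ] f₁ 0 (suc m) * (0# * τ X 0 (suc m)))
        ≈⟨ +-congˡ (∑-zero (upTo n) (λ _ → trans (*-congˡ (zeroˡ _)) (zeroʳ _))) ⟩
      1# * 1# * (1# * 1#) + 0#  ≈⟨ solve 0 (con 1 :* con 1 :* (con 1 :* con 1) :+ con 0 := con 1) refl ⟩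
      1# ∎
    interlace₁₁ {suc n} {suc q} (s≤s q≤n) = begin
      ∑[ m ∈ upTo (suc (suc n)) ] f₁ 0 m * g₁ m (suc q)  ≈⟨ upTo-suc (suc n) _ ⟩
      1# * 1# * (Y ^ suc q * (1# + b * X)) + (∑[ m ∈ upTo (suc n) ] X ^ suc m * (1# + b * Y) * g₁ m q)
        ≈⟨ +-cong (solve 2 (λ u v → con 1 :* con 1 :* (u :* v) := v :* u) refl (Y ^ suc q) (1# + b * X))
             (trans (∑-cong (upTo (suc n)) (λ m → solve 4 (λ x u v w → x :* u :* v :* w := x :* v :* (u :* w)) refl X (X ^ m) (1# + b * Y) (g₁ m q)))
             (sym (*-∑ (upTo (suc n)) (X * (1# + b * Y)) _))) ⟩
      (1# + b * X) * Y ^ suc q + X * (1# + b * Y) * interlace f₀ g₁ n 0 q  ≈⟨ +-congˡ (*-congˡ (interlace₀₁ q≤n)) ⟩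
      (1# + b * X) * Y ^ suc q + X * (1# + b * Y) * h₁ q  ≈⟨ h₂-suc q ⟩
      h₂ (suc q) ∎

    interlace-0 : ∀ f g n p → (∀ p → f (suc p) 0 ≈ 0#) → (∀ m → g (suc m) 0 ≈ 0#) →
                  interlace f g n (suc p) 0 ≈ 0#
    interlace-0 f g n p f0 g0 = trans (upTo-suc n _) (trans
      (+-cong (trans (*-congʳ (f0 p)) (zeroˡ _)) (∑-zero (upTo n) (λ _ → trans (*-congˡ (g0 _)) (zeroʳ _))))
      (+-identityˡ 0#))

    interlace-suc : ∀ f g n p q → (∀ p → f (suc p) 0 ≈ 0#) →
      (∀ m → f (suc p) (suc m) ≡ f p m) → (∀ m → g (suc m) (suc q) ≡ g m q) →
      interlace f g (suc n) (suc p) (suc q) ≈ interlace f g n p q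
    interlace-suc f g n p q f0 fs gs = trans (upTo-suc (suc n) _) (trans
      (+-cong (trans (*-congʳ (f0 p)) (zeroˡ _))
              (∑-cong (upTo (suc n)) (λ m → *-cong (reflexive (fs m)) (reflexive (gs m)))))
      (+-identityˡ _))

    interlace-sym : ∀ f g → (∀ p → f (suc p) 0 ≈ 0#) → (∀ m → g (suc m) 0 ≈ 0#) →
      (∀ p m → f (suc p) (suc m) ≡ f p m) → (∀ m q → g (suc m) (suc q) ≡ g m q) →
      (∀ {n q} → q ≤ n → Sym (interlace f g n 0 q)) →
      ∀ {n} p {q} → q ≤ n → Sym (interlace f g n p q)
    interlace-sym f g f0 g0 fs gs base zero q≤n = base q≤n
    interlace-sym f g f0 g0 fs gs base {n} (suc p) {zero} _ =
      Sym-resp (interlace-0 f g n p f0 g0) 0#-homo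
    interlace-sym f g f0 g0 fs gs base {suc n} (suc p) {suc q} (s≤s q≤n) =
      Sym-resp (interlace-suc f g n p q f0 (fs p) (λ m → gs m q))
               (interlace-sym f g f0 g0 fs gs base p q≤n)

    f₁-0 : ∀ p → f₁ (suc p) 0 ≈ 0#
    f₁-0 p = zeroˡ _

    g₁-0 : ∀ m → g₁ (suc m) 0 ≈ 0#
    g₁-0 m = zeroˡ _

    sym₀₀ : ∀ {n} p {q} → q ≤ n → Sym (interlace f₀ g₀ n p q)
    sym₀₀ = interlace-sym f₀ g₀ (λ _ → refl) (λ _ → refl) (λ _ _ → ≡.refl) (λ _ _ → ≡.refl)
      (λ {_} {q} q≤n → Sym-resp (interlace₀₀ q≤n) (h-sym q))
    sym₀₁ : ∀ {n} p {q} → q ≤ n → Sym (interlace f₀ g₁ n p q)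
    sym₀₁ = interlace-sym f₀ g₁ (λ _ → refl) g₁-0 (λ _ _ → ≡.refl) (λ _ _ → ≡.refl)
      (λ {_} {q} q≤n → Sym-resp (interlace₀₁ q≤n) (h₁-sym q))
    sym₁₀ : ∀ {n} p {q} → q ≤ n → Sym (interlace f₁ g₀ n p q)
    sym₁₀ = interlace-sym f₁ g₀ f₁-0 (λ _ → refl) (λ _ _ → ≡.refl) (λ _ _ → ≡.refl)
      (λ {_} {q} q≤n → Sym-resp (interlace₁₀ q≤n) (h₁-sym q))
    sym₁₁ : ∀ {n} p {q} → q ≤ n → Sym (interlace f₁ g₁ n p q)
    sym₁₁ = interlace-sym f₁ g₁ f₁-0 g₁-0 (λ _ _ → ≡.refl) (λ _ _ → ≡.refl)
      (λ {_} {q} q≤n → Sym-resp (interlace₁₁ q≤n) (h₂-sym q))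

    α : ℕ → ℕ → Carrier
    α zero    q       = Y ^ q
    α (suc p) zero    = 1# + b * X
    α (suc p) (suc q) = α p q

    -- Either p > q or p ≤ q; in the second case the sum over m effectively starts at q.
    data LowerEnd (p q : ℕ) : Set (c Level.⊔ ℓ) where
      above : α p q ≈ 1# + b * X →
              (∀ m → e X p m * (τ Y m q * α p q) ≈ (1# + b * X) * (1# + b * Y) * f₀ p m) →
              LowerEnd p q
      below : ∀ s → Sym s →
              (∀ m → q ≤ m → e X p m * α p q ≈ s * e X q m) →
              (∀ m → e X p m * (τ Y m q * α p q) ≈ s * f₁ q m) →
              LowerEnd p q

    lowerEnd : ∀ p q → LowerEnd p q
    lowerEnd zero q = below ((X * Y) ^ q) (Sym-^ q Sym-XY) (untruncated q) (truncated q)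
      where
      untruncated : ∀ q m → q ≤ m → X ^ m * Y ^ q ≈ (X * Y) ^ q * e X q m
      untruncated zero    m       _         = *-comm _ _
      untruncated (suc q) (suc m) (s≤s q≤m) = begin
        X * X ^ m * (Y * Y ^ q)      ≈⟨ solve 4 (λ x y u v → x :* u :* (y :* v) := x :* y :* (u :* v)) refl X Y (X ^ m) (Y ^ q) ⟩
        X * Y * (X ^ m * Y ^ q)      ≈⟨ *-congˡ (untruncated q m q≤m) ⟩
        X * Y * ((X * Y) ^ q * e X q m)  ≈⟨ *-assoc _ _ _ ⟨
        X * Y * (X * Y) ^ q * e X q m ∎
      truncated : ∀ q m → X ^ m * (τ Y m q * Y ^ q) ≈ (X * Y) ^ q * (e X q m * τ Y m q)
      truncated zero    m       = solve 2 (λ u v → u :* (v :* con 1) := con 1 :* (u :* v)) refl (X ^ m) (τ Y m 0)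
      truncated (suc q) zero    = trans (*-congˡ (zeroˡ _)) (trans (zeroʳ _) (sym (trans (*-congˡ (zeroˡ _)) (zeroʳ _))))
      truncated (suc q) (suc m) = begin
        X * X ^ m * (τ Y m q * (Y * Y ^ q))
          ≈⟨ solve 5 (λ x y u v w → x :* u :* (w :* (y :* v)) := x :* y :* (u :* (w :* v))) refl X Y (X ^ m) (Y ^ q) (τ Y m q) ⟩
        X * Y * (X ^ m * (τ Y m q * Y ^ q))          ≈⟨ *-congˡ (truncated q m) ⟩
        X * Y * ((X * Y) ^ q * (e X q m * τ Y m q))  ≈⟨ *-assoc _ _ _ ⟨
        X * Y * (X * Y) ^ q * (e X q m * τ Y m q) ∎
    lowerEnd (suc p) zero = above refl λ where
      zero    → trans (zeroˡ _) (sym (zeroʳ _))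
      (suc m) → solve 3 (λ u v w → u :* (v :* w) := w :* v :* u) refl (e X p m) (1# + b * Y) (1# + b * X)
    lowerEnd (suc p) (suc q) with lowerEnd p q
    ... | above a t = above a λ where
      zero    → trans (zeroˡ _) (sym (zeroʳ _))
      (suc m) → t m
    ... | below s s-sym u t = below s s-sym
      (λ where (suc m) (s≤s q≤m) → u m q≤m)
      (λ where
        zero    → trans (zeroˡ _) (sym (trans (*-congˡ (zeroˡ _)) (zeroʳ _)))
        (suc m) → t m)

    -- Either p > q or p ≤ q; in the second case the sum over m effectively stops at p.
    data UpperEnd (p q : ℕ) : Set (c Level.⊔ ℓ) where
      above : α p q ≈ 1# + b * X → (∀ m → e Y m q * τ X p m ≈ α p q * g₀ m q) → UpperEnd p q
      below : p ≤ q → α p q * Y ^ p ≈ Y ^ q → (∀ m → e Y m q * τ X p m ≈ α p q * g₁ m p) → UpperEnd p q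

    upperEnd : ∀ p q → UpperEnd p q
    upperEnd zero q = below z≤n (*-identityʳ _) λ where
      zero    → *-congˡ (sym (*-identityˡ 1#))
      (suc m) → trans (zeroʳ _) (sym (trans (*-congˡ (zeroˡ _)) (zeroʳ _)))
    upperEnd (suc p) zero = above refl λ where
      zero    → *-comm _ _
      (suc m) → trans (zeroˡ _) (sym (zeroʳ _))
    upperEnd (suc p) (suc q) with upperEnd p q
    ... | above a t = above a λ where
      zero    → trans (*-comm _ _) (*-congʳ (sym a))
      (suc m) → t m
    ... | below p≤q a t = below (s≤s p≤q) a′ (λ where
        zero    → trans (*-congʳ (sym a′)) (*-assoc _ _ _)
        (suc m) → t m)
      where
      a′ : α p q * Y ^ suc p ≈ Y ^ suc q
      a′ = trans (solve 3 (λ u v w → u :* (v :* w) := v :* (u :* w)) refl (α p q) Y (Y ^ p)) (*-congˡ a)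

    local : ∀ p q r r′ n → ∃[ s ] ((r ≤ n → Sym s) ×
      (∑[ m ∈ upTo (suc n) ] e X p m * (e Y m r * (τ X q m * (τ Y m r′ * α p r′)))) ≈ α q r * s)
    local p q r r′ n = go (lowerEnd p r′) (upperEnd q r)
      where
      factor : ∀ {s a} f g → (∀ m → e X p m * (τ Y m r′ * α p r′) ≈ s * f m) →
               (∀ m → e Y m r * τ X q m ≈ a * g m) →
               (∑[ m ∈ upTo (suc n) ] e X p m * (e Y m r * (τ X q m * (τ Y m r′ * α p r′)))) ≈
               a * (s * (∑[ m ∈ upTo (suc n) ] f m * g m))
      factor {s} {a} f g t u = begin
        ∑[ m ∈ upTo (suc n) ] e X p m * (e Y m r * (τ X q m * (τ Y m r′ * α p r′)))
          ≈⟨ ∑-cong (upTo (suc n)) (λ m → begin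
             e X p m * (e Y m r * (τ X q m * (τ Y m r′ * α p r′)))
               ≈⟨ solve 4 (λ u v w x → u :* (v :* (w :* x)) := (u :* x) :* (v :* w)) refl
                    (e X p m) (e Y m r) (τ X q m) (τ Y m r′ * α p r′) ⟩
             (e X p m * (τ Y m r′ * α p r′)) * (e Y m r * τ X q m)
               ≈⟨ *-cong (t m) (u m) ⟩
             (s * f m) * (a * g m)
               ≈⟨ solve 4 (λ s f a g → (s :* f) :* (a :* g) := (a :* s) :* (f :* g)) refl s (f m) a (g m) ⟩
             (a * s) * (f m * g m) ∎) ⟩
        ∑[ m ∈ upTo (suc n) ] (a * s) * (f m * g m)
          ≈⟨ *-∑ (upTo (suc n)) (a * s) _ ⟨
        (a * s) * (∑[ m ∈ upTo (suc n) ] f m * g m)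
          ≈⟨ *-assoc _ _ _ ⟩
        a * (s * (∑[ m ∈ upTo (suc n) ] f m * g m)) ∎
      go : LowerEnd p r′ → UpperEnd q r → ∃[ s ] ((r ≤ n → Sym s) ×
        (∑[ m ∈ upTo (suc n) ] e X p m * (e Y m r * (τ X q m * (τ Y m r′ * α p r′)))) ≈ α q r * s)
      go (above _ t)         (above _ u)       = _ , (λ r≤n → Sym-* Sym-[1+bX][1+bY] (sym₀₀ p r≤n)) , factor (f₀ p) (λ m → g₀ m r) t u
      go (above _ t)         (below q≤r _ u)   = _ , (λ r≤n → Sym-* Sym-[1+bX][1+bY] (sym₀₁ p (ℕₚ.≤-trans q≤r r≤n))) , factor (f₀ p) (λ m → g₁ m q) t u
      go (below s s-sym _ t) (above _ u)       = _ , (λ r≤n → Sym-* s-sym (sym₁₀ r′ r≤n)) , factor (f₁ r′) (λ m → g₀ m r) t u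
      go (below s s-sym _ t) (below q≤r _ u)   = _ , (λ r≤n → Sym-* s-sym (sym₁₁ r′ (ℕₚ.≤-trans q≤r r≤n))) , factor (f₁ r′) (λ m → g₁ m q) t u

    interlace₀₀-balance : ∀ {n} p {q} → q ≤ n →
      e X p (suc q) + Y * interlace f₀ g₀ n p q ≈ e Y p (suc q) + X * interlace f₀ g₀ n p q
    interlace₀₀-balance {n} zero {q} q≤n = begin
      X ^ suc q + Y * interlace f₀ g₀ n 0 q  ≈⟨ +-congˡ (*-congˡ (interlace₀₀ q≤n)) ⟩
      X ^ suc q + Y * h q                    ≈⟨ h-balance q ⟩
      Y ^ suc q + X * h q                    ≈⟨ +-congˡ (*-congˡ (interlace₀₀ q≤n)) ⟨
      Y ^ suc q + X * interlace f₀ g₀ n 0 q  ∎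
    interlace₀₀-balance {n} (suc p) {zero} _ = begin
      e X p 0 + Y * interlace f₀ g₀ n (suc p) 0  ≈⟨ +-cong (e-0 p) (trans (*-congˡ v) (trans (zeroʳ Y) (sym (trans (*-congˡ v) (zeroʳ X))))) ⟩
      e Y p 0 + X * interlace f₀ g₀ n (suc p) 0  ∎
      where
      v : interlace f₀ g₀ n (suc p) 0 ≈ 0#
      v = interlace-0 f₀ g₀ n p (λ _ → refl) (λ _ → refl)
      e-0 : ∀ p → e X p 0 ≈ e Y p 0
      e-0 zero    = refl
      e-0 (suc p) = refl
    interlace₀₀-balance {suc n} (suc p) {suc q} (s≤s q≤n) = begin
      e X p (suc q) + Y * interlace f₀ g₀ (suc n) (suc p) (suc q)  ≈⟨ +-congˡ (*-congˡ v) ⟩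
      e X p (suc q) + Y * interlace f₀ g₀ n p q                    ≈⟨ interlace₀₀-balance p q≤n ⟩
      e Y p (suc q) + X * interlace f₀ g₀ n p q                    ≈⟨ +-congˡ (*-congˡ v) ⟨
      e Y p (suc q) + X * interlace f₀ g₀ (suc n) (suc p) (suc q)  ∎
      where
      v : interlace f₀ g₀ (suc n) (suc p) (suc q) ≈ interlace f₀ g₀ n p q
      v = interlace-suc f₀ g₀ n p q (λ _ → refl) (λ _ → ≡.refl) (λ _ → ≡.refl)

    h₁-balance : ∀ n → (1# + b * Y) * X ^ suc n + Y * h₁ n ≈ (1# + b * X) * Y ^ suc n + X * h₁ n
    h₁-balance zero    = solve 3 (λ b x y →
      (con 1 :+ b :* y) :* (x :* con 1) :+ y :* (con 1 :+ b :* (x :* y) :* con 0) :=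
      (con 1 :+ b :* x) :* (y :* con 1) :+ x :* (con 1 :+ b :* (x :* y) :* con 0)) refl b X Y
    h₁-balance (suc n) = begin
      (1# + b * Y) * (X * X ^ suc n) + Y * (h (suc n) + b * (X * Y) * h n)
        ≈⟨ solve 6 (λ b x y p u v → (con 1 :+ b :* y) :* (x :* p) :+ y :* (u :+ b :* (x :* y) :* v) :=
             (x :* p :+ y :* u) :+ b :* (x :* y) :* (p :+ y :* v)) refl b X Y (X ^ suc n) (h (suc n)) (h n) ⟩
      (X ^ suc (suc n) + Y * h (suc n)) + b * (X * Y) * (X ^ suc n + Y * h n)
        ≈⟨ +-cong (h-balance (suc n)) (*-congˡ (h-balance n)) ⟩
      (Y ^ suc (suc n) + X * h (suc n)) + b * (X * Y) * (Y ^ suc n + X * h n)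
        ≈⟨ solve 6 (λ b x y q u v → (y :* q :+ x :* u) :+ b :* (x :* y) :* (q :+ x :* v) :=
             (con 1 :+ b :* x) :* (y :* q) :+ x :* (u :+ b :* (x :* y) :* v)) refl b X Y (Y ^ suc n) (h (suc n)) (h n) ⟩
      (1# + b * X) * (Y * Y ^ suc n) + X * (h (suc n) + b * (X * Y) * h n) ∎

    interlace₁₀-balance : ∀ {n} p {q} → p ≤ q → q ≤ n →
      (1# + b * Y) * e X p (suc q) + Y * interlace f₁ g₀ n p q ≈
      (1# + b * X) * e Y p (suc q) + X * interlace f₁ g₀ n p q
    interlace₁₀-balance {n} zero {q} _ q≤n = trans (+-congˡ (*-congˡ (interlace₁₀ q≤n)))
      (trans (h₁-balance q) (+-congˡ (*-congˡ (sym (interlace₁₀ q≤n)))))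
    interlace₁₀-balance {suc n} (suc p) {suc q} (s≤s p≤q) (s≤s q≤n) = trans (+-congˡ (*-congˡ v))
      (trans (interlace₁₀-balance p p≤q q≤n) (+-congˡ (*-congˡ (sym v))))
      where
      v : interlace f₁ g₀ (suc n) (suc p) (suc q) ≈ interlace f₁ g₀ n p q
      v = interlace-suc f₁ g₀ n p q f₁-0 (λ _ → ≡.refl) (λ _ → ≡.refl)

    σ-e : ∀ p q → σ (e X p q) ≈ e Y p q
    σ-e zero    q       = σ-^ σ-X q
    σ-e (suc p) zero    = 0#-homo
    σ-e (suc p) (suc q) = σ-e p q

    Π-topRow : ∀ p q r n → r ≤ q → q ≤ n →
      Π (e X p (suc q) * α p r) (∑[ m ∈ upTo (suc n) ] e X p m * (e Y m q * (τ Y m r * α p r)))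
    Π-topRow p q r n r≤q q≤n = go (lowerEnd p r)
      where
      factor : ∀ {s} f → (∀ m → e X p m * (τ Y m r * α p r) ≈ s * f m) →
               (∑[ m ∈ upTo (suc n) ] e X p m * (e Y m q * (τ Y m r * α p r))) ≈
               s * (∑[ m ∈ upTo (suc n) ] f m * g₀ m q)
      factor {s} f t = trans (∑-cong (upTo (suc n)) (λ m → begin
        e X p m * (e Y m q * (τ Y m r * α p r))
          ≈⟨ solve 3 (λ u v w → u :* (v :* w) := (u :* w) :* v) refl (e X p m) (e Y m q) (τ Y m r * α p r) ⟩
        (e X p m * (τ Y m r * α p r)) * e Y m q
          ≈⟨ *-congʳ (t m) ⟩
        (s * f m) * e Y m q
          ≈⟨ *-assoc _ _ _ ⟩
        s * (f m * e Y m q) ∎)) (sym (*-∑ (upTo (suc n)) s _))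
      go : LowerEnd p r → Π (e X p (suc q) * α p r)
                            (∑[ m ∈ upTo (suc n) ] e X p m * (e Y m q * (τ Y m r * α p r)))
      go (above a t) = begin
        v * (e X p (suc q) * α p r) + Y * S
          ≈⟨ +-cong (*-congˡ (*-congˡ a)) (*-congˡ (factor (f₀ p) t)) ⟩
        v * (e X p (suc q) * u) + Y * (u * v * I)
          ≈⟨ solve 5 (λ u v x y i → v :* (x :* u) :+ y :* (u :* v :* i) := u :* v :* (x :+ y :* i)) refl u v (e X p (suc q)) Y I ⟩
        u * v * (e X p (suc q) + Y * I)
          ≈⟨ *-congˡ (interlace₀₀-balance p q≤n) ⟩
        u * v * (e Y p (suc q) + X * I)
          ≈⟨ solve 5 (λ u v x y i → u :* v :* (x :+ y :* i) := u :* (x :* v) :+ y :* (u :* v :* i)) refl u v (e Y p (suc q)) X I ⟩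
        u * (e Y p (suc q) * v) + X * (u * v * I)
          ≈⟨ +-cong (*-congˡ (trans (*-homo _ _) (*-cong (σ-e p (suc q)) (trans (⟦⟧-cong a) σ-1+bX)))) (*-congˡ (factor (f₀ p) t)) ⟨
        u * σ (e X p (suc q) * α p r) + X * S ∎
        where
        u = 1# + b * X
        v = 1# + b * Y
        S = ∑[ m ∈ upTo (suc n) ] e X p m * (e Y m q * (τ Y m r * α p r))
        I = interlace f₀ g₀ n p q
      go (below s s-sym u t) = Π-resp (u (suc q) (ℕₚ.m≤n⇒m≤1+n r≤q)) (factor (f₁ r) t)
        (Π-* s-sym (trans (interlace₁₀-balance r r≤q q≤n) (+-congʳ (*-congˡ (sym (σ-e r (suc q)))))))

-- Generating functions of arrays of counts

hd : List ℕ → ℕ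
hd []      = 0
hd (a ∷ u) = a

tl : List ℕ → List ℕ
tl []      = []
tl (a ∷ u) = u

last : ℕ → List ℕ → ℕ
last a []      = a
last a (p ∷ u) = last p u

drop-tl : ∀ n u → drop n (tl u) ≡ drop (suc n) u
drop-tl zero    []      = ≡.refl
drop-tl (suc n) []      = ≡.refl
drop-tl n       (a ∷ u) = ≡.refl

drop-[] : ∀ n → drop n [] ≡ [] {A = ℕ}
drop-[] zero    = ≡.refl
drop-[] (suc n) = ≡.refl

drop-length-++ : ∀ (p u : List ℕ) → drop (length p) (p ++ u) ≡ u
drop-length-++ []      u = ≡.refl
drop-length-++ (a ∷ p) u = drop-length-++ p u

module Patterns {c ℓ} (A : CommutativeSemiring c ℓ) (b : CommutativeSemiring.Carrier A)
                (x : ℕ → CommutativeSemiring.Carrier A) where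

  open CommutativeSemiring A
  open import Algebra.Properties.Semiring.Exp semiring using (_^_)
  open import Algebra.Solver.Ring.NaturalCoefficients.Default A
  open import Relation.Binary.Reasoning.Setoid setoid
  open Sums A
  open Weights A b

  upTo-last : ∀ n t → ∑ (upTo (suc n)) t ≈ ∑ (upTo n) t + t n
  upTo-last n t = trans (reflexive (≡.cong (λ L → ∑ L t) (≡.sym (upTo-∷ʳ n))))
    (trans (∑-++ (upTo n) (n ∷ []) t) (+-congˡ (+-identityʳ (t n))))

  δ : ℕ → ℕ → Carrier
  δ zero    zero    = 1#
  δ zero    (suc n) = 0#
  δ (suc m) zero    = 0#
  δ (suc m) (suc n) = δ m n

  ∑-δ : ∀ {n N} (t : ℕ → Carrier) → n ≤ N → ∑[ m ∈ upTo (suc N) ] t m * δ m n ≈ t n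
  ∑-δ {zero} {N} t _ = begin
    ∑[ m ∈ upTo (suc N) ] t m * δ m 0             ≈⟨ upTo-suc N _ ⟩
    t 0 * 1# + (∑[ m ∈ upTo N ] t (suc m) * 0#)   ≈⟨ +-cong (*-identityʳ _) (∑-zero (upTo N) (λ _ → zeroʳ _)) ⟩
    t 0 + 0#                                      ≈⟨ +-identityʳ _ ⟩
    t 0                                           ∎
  ∑-δ {suc n} {suc N} t (s≤s n≤N) = begin
    ∑[ m ∈ upTo (suc (suc N)) ] t m * δ m (suc n)           ≈⟨ upTo-suc (suc N) _ ⟩
    t 0 * 0# + (∑[ m ∈ upTo (suc N) ] t (suc m) * δ m n)    ≈⟨ +-cong (zeroʳ _) (∑-δ (t ∘ suc) n≤N) ⟩
    0# + t (suc n)                                          ≈⟨ +-identityˡ _ ⟩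
    t (suc n)                                               ∎

  ∑-tuples-++ : ∀ n j m t → ∑ (tuples n (j ℕ.+ m)) t ≈ ∑[ p ∈ tuples n j ] ∑[ v ∈ tuples n m ] t (p ++ v)
  ∑-tuples-++ n zero    m t = sym (+-identityʳ _)
  ∑-tuples-++ n (suc j) m t = begin
    ∑ (tuples n (suc (j ℕ.+ m))) t
      ≈⟨ ∑-tuples-suc n (j ℕ.+ m) t ⟩
    ∑[ a ∈ upTo (suc n) ] ∑[ v ∈ tuples n (j ℕ.+ m) ] t (a ∷ v)
      ≈⟨ ∑-cong (upTo (suc n)) (λ a → ∑-tuples-++ n j m (t ∘ (a ∷_))) ⟩
    ∑[ a ∈ upTo (suc n) ] ∑[ p ∈ tuples n j ] ∑[ v ∈ tuples n m ] t (a ∷ p ++ v)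
      ≈⟨ ∑-tuples-suc n j _ ⟨
    ∑[ p ∈ tuples n (suc j) ] ∑[ v ∈ tuples n m ] t (p ++ v) ∎

  tuples-length : ∀ n m {v} → v ∈ₗ tuples n m → length v ≡ m
  tuples-length n zero    (here ≡.refl) = ≡.refl
  tuples-length n (suc m) v∈ with ∈-cartesianProductWith⁻ _∷_ (upTo (suc n)) (tuples n m) v∈
  ... | a , w , _ , w∈ , ≡.refl = ≡.cong suc (tuples-length n m w∈)

  -- A list v counts, for each letter from o on, the boxes of a row whose minimum is at
  -- most that letter; a is the count before o, and n is the length of the row.
  rowWeight : ℕ → ℕ → ℕ → List ℕ → Carrier
  rowWeight o n a []      = δ a n
  rowWeight o n a (p ∷ v) = e (x o) a p * rowWeight (suc o) n p v

  prefixWeight : ℕ → ℕ → List ℕ → Carrier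
  prefixWeight o a []      = 1#
  prefixWeight o a (p ∷ v) = e (x o) a p * prefixWeight (suc o) p v

  columnWeight : ℕ → ℕ → List ℕ → List ℕ → Carrier
  columnWeight o a []      u = 1#
  columnWeight o a (p ∷ w) u = τ (x o) a (hd u) * columnWeight (suc o) p w (tl u)

  -- A row is given by its length and by the number of letters from o on it may use.
  patterns : ℕ → List (ℕ × ℕ) → (List ℕ → Carrier) → Carrier
  patterns o []             g = g []
  patterns o ((n , m) ∷ rs) g =
    ∑[ v ∈ tuples n m ] (rowWeight o n 0 v * patterns o rs (columnWeight o 0 v) * g v)

  patterns-cong : ∀ o rs {g g′} → (∀ u → g u ≈ g′ u) → patterns o rs g ≈ patterns o rs g′
  patterns-cong o []             q = q []
  patterns-cong o ((n , m) ∷ rs) q = ∑-cong (tuples n m) (λ v → *-congˡ (q v))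

  rowWeight-++ : ∀ o n a p v → rowWeight o n a (p ++ v) ≈
    prefixWeight o a p * rowWeight (length p ℕ.+ o) n (last a p) v
  rowWeight-++ o n a []      v = sym (*-identityˡ _)
  rowWeight-++ o n a (q ∷ p) v rewrite ≡.sym (ℕₚ.+-suc (length p) o) =
    trans (*-congˡ (rowWeight-++ (suc o) n q p v)) (sym (*-assoc _ _ _))

  columnWeight-++ : ∀ o a p w u → columnWeight o a (p ++ w) u ≈
    columnWeight o a p u * columnWeight (length p ℕ.+ o) (last a p) w (drop (length p) u)
  columnWeight-++ o a []      w u = sym (*-identityˡ _)
  columnWeight-++ o a (q ∷ p) w u
    rewrite ≡.sym (ℕₚ.+-suc (length p) o) | ≡.sym (drop-tl (length p) u) =
    trans (*-congˡ (columnWeight-++ (suc o) q p w (tl u))) (sym (*-assoc _ _ _))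

  columnWeight-prefix : ∀ o a p q u → length p ≡ length q →
    columnWeight o a p (q ++ u) ≡ columnWeight o a p q
  columnWeight-prefix o a []      []      u _ = ≡.refl
  columnWeight-prefix o a (c ∷ p) (d ∷ q) u r =
    ≡.cong (τ (x o) a d *_) (columnWeight-prefix (suc o) c p q u (ℕₚ.suc-injective r))

  e-> : ∀ z {a p} → p < a → e z a p ≈ 0#
  e-> z {suc a} {zero}  _         = refl
  e-> z {suc a} {suc p} (s≤s p<a) = e-> z p<a

  rowWeight-> : ∀ o {n a} v → n < a → rowWeight o n a v ≈ 0#
  rowWeight-> o {zero}  {suc a} []      _         = refl
  rowWeight-> o {suc n} {suc a} []      (s≤s n<a) = rowWeight-> o [] n<a
  rowWeight-> o {n} {a} (p ∷ v) n<a with p ℕ.<? a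
  ... | yes p<a = trans (*-congʳ (e-> (x o) p<a)) (zeroˡ _)
  ... | no p≮a = trans (*-congˡ (rowWeight-> (suc o) v (ℕₚ.<-≤-trans n<a (ℕₚ.≮⇒≥ p≮a)))) (zeroʳ _)

  ∑-rowWeight-suc : ∀ o n a m (g : List ℕ → Carrier) →
    ∑[ v ∈ tuples (suc n) m ] rowWeight o n a v * g v ≈ ∑[ v ∈ tuples n m ] rowWeight o n a v * g v
  ∑-rowWeight-suc o n a zero    g = refl
  ∑-rowWeight-suc o n a (suc m) g = begin
    ∑[ v ∈ tuples (suc n) (suc m) ] rowWeight o n a v * g v
      ≈⟨ ∑-tuples-suc (suc n) m _ ⟩
    ∑[ p ∈ upTo (suc (suc n)) ] ∑[ v ∈ tuples (suc n) m ] rowWeight o n a (p ∷ v) * g (p ∷ v)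
      ≈⟨ ∑-cong (upTo (suc (suc n))) (λ p → trans (shift p (tuples (suc n) m)) (*-congˡ (∑-rowWeight-suc (suc o) n p m _))) ⟩
    ∑[ p ∈ upTo (suc (suc n)) ] e (x o) a p * (∑[ v ∈ tuples n m ] rowWeight (suc o) n p v * g (p ∷ v))
      ≈⟨ upTo-last (suc n) _ ⟩
    (∑[ p ∈ upTo (suc n) ] e (x o) a p * (∑[ v ∈ tuples n m ] rowWeight (suc o) n p v * g (p ∷ v))) +
      e (x o) a (suc n) * (∑[ v ∈ tuples n m ] rowWeight (suc o) n (suc n) v * g (suc n ∷ v))
      ≈⟨ +-cong (∑-cong (upTo (suc n)) (λ p → sym (shift p (tuples n m))))
           (trans (*-congˡ (∑-zero (tuples n m) (λ {v} _ → trans (*-congʳ (rowWeight-> (suc o) v ℕₚ.≤-refl)) (zeroˡ _)))) (zeroʳ _)) ⟩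
    (∑[ p ∈ upTo (suc n) ] ∑[ v ∈ tuples n m ] rowWeight o n a (p ∷ v) * g (p ∷ v)) + 0#
      ≈⟨ trans (+-identityʳ _) (sym (∑-tuples-suc n m _)) ⟩
    ∑[ v ∈ tuples n (suc m) ] rowWeight o n a v * g v ∎
    where
    shift : ∀ p L → ∑[ v ∈ L ] rowWeight o n a (p ∷ v) * g (p ∷ v) ≈
                    e (x o) a p * (∑[ v ∈ L ] rowWeight (suc o) n p v * g (p ∷ v))
    shift p L = trans (∑-cong L (λ v → *-assoc _ _ _)) (sym (*-∑ L _ _))

  patterns-shift : ∀ o rs g →
    patterns o (map (λ (n , m) → n , suc m) rs) (λ u → τ (x o) 0 (hd u) * g (tl u)) ≈ patterns (suc o) rs g
  patterns-shift o []             g = *-identityˡ _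
  patterns-shift o ((n , m) ∷ rs) g = begin
    ∑[ v ∈ tuples n (suc m) ] t v                      ≈⟨ ∑-tuples-suc n m t ⟩
    ∑[ p ∈ upTo (suc n) ] ∑[ v ∈ tuples n m ] t (p ∷ v)  ≈⟨ upTo-suc n _ ⟩
    (∑[ v ∈ tuples n m ] t (0 ∷ v)) + (∑[ p ∈ upTo n ] ∑[ v ∈ tuples n m ] t (suc p ∷ v))
      ≈⟨ +-cong (∑-cong (tuples n m) (λ v → *-cong
                   (*-cong (*-identityˡ _) (patterns-shift o rs (columnWeight (suc o) 0 v)))
                   (*-identityˡ _)))
           (∑-zero (upTo n) (λ _ → ∑-zero (tuples n m) (λ _ → trans (*-congˡ (zeroˡ _)) (zeroʳ _)))) ⟩
    patterns (suc o) ((n , m) ∷ rs) g + 0#             ≈⟨ +-identityʳ _ ⟩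
    patterns (suc o) ((n , m) ∷ rs) g                  ∎
    where
    t : List ℕ → Carrier
    t v = rowWeight o n 0 v * patterns o (map (λ (n , m) → n , suc m) rs) (columnWeight o 0 v) *
          (τ (x o) 0 (hd v) * g (tl v))

  patterns-peel : ∀ o N rs →
    patterns o ((N , 1) ∷ map (λ (n , m) → n , suc m) rs) (λ _ → 1#) ≈ x o ^ N * patterns (suc o) rs (λ _ → 1#)
  patterns-peel o N rs = begin
    ∑[ v ∈ tuples N 1 ] t v                              ≈⟨ ∑-tuples-suc N 0 t ⟩
    ∑[ p ∈ upTo (suc N) ] (t (p ∷ []) + 0#)              ≈⟨ ∑-cong (upTo (suc N)) (λ p → trans (+-identityʳ _)
      (trans (*-identityʳ _) (solve 3 (λ u v w → u :* v :* w := u :* w :* v) refl (x o ^ p) (δ p N) _))) ⟩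
    ∑[ p ∈ upTo (suc N) ] x o ^ p * patterns o rs′ (columnWeight o 0 (p ∷ [])) * δ p N
      ≈⟨ ∑-δ {N} {N} (λ p → x o ^ p * patterns o rs′ (columnWeight o 0 (p ∷ []))) ℕₚ.≤-refl ⟩
    x o ^ N * patterns o rs′ (columnWeight o 0 (N ∷ []))  ≈⟨ *-congˡ (patterns-shift o rs (λ _ → 1#)) ⟩
    x o ^ N * patterns (suc o) rs (λ _ → 1#)              ∎
    where
    rs′ = map (λ (n , m) → n , suc m) rs
    t : List ℕ → Carrier
    t v = rowWeight o N 0 v * patterns o rs′ (columnWeight o 0 v) * 1#

module Step {c ℓ} (A : CommutativeSemiring c ℓ) (b : CommutativeSemiring.Carrier A)
            (x : ℕ → CommutativeSemiring.Carrier A) (o j : ℕ)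
            (σ : CommutativeSemiring.Carrier A → CommutativeSemiring.Carrier A)
            (σ-hom : IsSemiringHomomorphism (CommutativeSemiring.rawSemiring A) (CommutativeSemiring.rawSemiring A) σ)
            (σ-b : CommutativeSemiring._≈_ A (σ b) b)
            (σ-X : CommutativeSemiring._≈_ A (σ (x (j ℕ.+ o))) (x (suc (j ℕ.+ o))))
            (σ-Y : CommutativeSemiring._≈_ A (σ (x (suc (j ℕ.+ o)))) (x (j ℕ.+ o)))
            (σ-x : ∀ i → i ≢ j ℕ.+ o → i ≢ suc (j ℕ.+ o) → CommutativeSemiring._≈_ A (σ (x i)) (x i)) where

  open CommutativeSemiring A
  open IsSemiringHomomorphism σ-hom
  open import Algebra.Solver.Ring.NaturalCoefficients.Default A
  open import Relation.Binary.Reasoning.Setoid setoid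
  open Sums A
  open Weights A b
  open Patterns A b x

  k : ℕ
  k = j ℕ.+ o

  X Y : Carrier
  X = x k
  Y = x (suc k)

  open TwoVariables σ σ-hom X Y σ-X σ-Y σ-b 

  module _ {z : Carrier} (z-sym : Sym z) where

    e-sym : ∀ a p → Sym (e z a p)
    e-sym zero    p       = Sym-^ p z-sym
    e-sym (suc a) zero    = 0#-homo
    e-sym (suc a) (suc p) = e-sym a p

    τ-sym : ∀ a p → Sym (τ z a p)
    τ-sym zero    zero    = 1#-homo
    τ-sym zero    (suc p) = 0#-homo
    τ-sym (suc a) zero    = Sym-+ 1#-homo (Sym-* σ-b z-sym)
    τ-sym (suc a) (suc p) = τ-sym a p

  δ-sym : ∀ m n → Sym (δ m n)
  δ-sym zero    zero    = 1#-homo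
  δ-sym zero    (suc n) = 0#-homo
  δ-sym (suc m) zero    = 0#-homo
  δ-sym (suc m) (suc n) = δ-sym m n

  x-sym-< : ∀ {i} → i < k → Sym (x i)
  x-sym-< i<k = σ-x _ (ℕₚ.<⇒≢ i<k) (ℕₚ.<⇒≢ (ℕₚ.m≤n⇒m≤1+n i<k))

  x-sym-> : ∀ {i} → suc (suc k) ≤ i → Sym (x i)
  x-sym-> k<i = σ-x _ (ℕₚ.>⇒≢ (ℕₚ.≤-trans (ℕₚ.n≤1+n _) k<i)) (ℕₚ.>⇒≢ k<i)

  prefixWeight-sym : ∀ i a p → length p ℕ.+ i ≤ k → Sym (prefixWeight i a p)
  prefixWeight-sym i a []      _ = 1#-homo
  prefixWeight-sym i a (q ∷ p) l = Sym-* (e-sym (x-sym-< (ℕₚ.m+n≤o⇒n≤o (length p) l′)) a q)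
    (prefixWeight-sym (suc i) q p l′)
    where
    l′ : length p ℕ.+ suc i ≤ k
    l′ = ≡.subst (_≤ k) (≡.sym (ℕₚ.+-suc (length p) i)) l

  columnWeight-sym-< : ∀ i a p u → length p ℕ.+ i ≤ k → Sym (columnWeight i a p u)
  columnWeight-sym-< i a []      u _ = 1#-homo
  columnWeight-sym-< i a (q ∷ p) u l = Sym-* (τ-sym (x-sym-< (ℕₚ.m+n≤o⇒n≤o (length p) l′)) a (hd u))
    (columnWeight-sym-< (suc i) q p (tl u) l′)
    where
    l′ : length p ℕ.+ suc i ≤ k
    l′ = ≡.subst (_≤ k) (≡.sym (ℕₚ.+-suc (length p) i)) l

  columnWeight-sym-> : ∀ i a p u → suc (suc k) ≤ i → Sym (columnWeight i a p u)
  columnWeight-sym-> i a []      u _ = 1#-homo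
  columnWeight-sym-> i a (q ∷ p) u l =
    Sym-* (τ-sym (x-sym-> l) a (hd u)) (columnWeight-sym-> (suc i) q p (tl u) (ℕₚ.m≤n⇒m≤1+n l))

  rowWeight-sym : ∀ i n a v → suc (suc k) ≤ i → Sym (rowWeight i n a v)
  rowWeight-sym i n a []      _ = δ-sym a n
  rowWeight-sym i n a (q ∷ v) l =
    Sym-* (e-sym (x-sym-> l) a q) (rowWeight-sym (suc i) n q v (ℕₚ.m≤n⇒m≤1+n l))

  data LowerRows : ℕ → List (ℕ × ℕ) → Set where
    []  : ∀ {N} → LowerRows N []
    _∷_ : ∀ {N n l rs} → n ≤ N → LowerRows n rs → LowerRows N ((n , j ℕ.+ (2 ℕ.+ l)) ∷ rs)

  twoLetters : List ℕ → (ℕ → Carrier) → (List ℕ → Carrier) → List ℕ → Carrier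
  twoLetters p t K u = columnWeight o 0 p u *
    (τ X (last 0 p) (hd (drop j u)) * (t (hd (tl (drop j u))) * K (tl (tl (drop j u)))))

  α-0 : ∀ p → α p 0 ≈ τ X p 0
  α-0 zero    = refl
  α-0 (suc p) = refl

  module _ (p : List ℕ) (lp : length p ≡ j) where

    drop-++ : ∀ u → drop j (p ++ u) ≡ u
    drop-++ u = ≡.trans (≡.cong (λ i → drop i (p ++ u)) (≡.sym lp)) (drop-length-++ p u)

    rowWeight-split : ∀ n v → rowWeight o n 0 (p ++ v) ≈ prefixWeight o 0 p * rowWeight k n (last 0 p) v
    rowWeight-split n v = trans (rowWeight-++ o n 0 p v)
      (*-congˡ (reflexive (≡.cong (λ i → rowWeight (i ℕ.+ o) n (last 0 p) v) lp)))

    columnWeight-split : ∀ w u → columnWeight o 0 (p ++ w) u ≈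
      columnWeight o 0 p u * columnWeight k (last 0 p) w (drop j u)
    columnWeight-split w u = trans (columnWeight-++ o 0 p w u)
      (*-congˡ (reflexive (≡.cong (λ i → columnWeight (i ℕ.+ o) (last 0 p) w (drop i u)) lp)))

  -- The count of each row at the letter k interacts only with counts at k − 1 and k + 1,
  -- so these sums factor over the rows; by local, all that is not symmetric in x_k and
  -- x_{k+1} is the factor α of the topmost row.
  lowerRows : ∀ {N rs} → LowerRows N rs → ∀ p (K : List ℕ → Carrier) → (∀ u → Sym (K u)) →
    ∃[ n ] ∃[ S ] (n ≤ N × (length p ≡ j → (∀ r → r ≤ n → Sym (S r)) × (∀ t →
      patterns o rs (twoLetters p t K) ≈ ∑[ r ∈ upTo (suc n) ] t r * (α (last 0 p) r * S r))))
  lowerRows []                            p K K-sym =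
    0 , (λ _ → columnWeight o 0 p [] * K []) , z≤n ,
    λ lp → (λ _ _ → Sym-* (columnWeight-sym-< o 0 p [] (ℕₚ.≤-reflexive (≡.cong (ℕ._+ o) lp))) (K-sym [])) , eq
    where
    eq : ∀ t → twoLetters p t K [] ≈ t 0 * (α (last 0 p) 0 * (columnWeight o 0 p [] * K [])) + 0#
    eq t rewrite drop-[] j = begin
      columnWeight o 0 p [] * (τ X (last 0 p) 0 * (t 0 * K []))
        ≈⟨ solve 4 (λ u v w x → u :* (v :* (w :* x)) := w :* (v :* (u :* x)) :+ con 0) refl
             (columnWeight o 0 p []) (τ X (last 0 p) 0) (t 0) (K []) ⟩
      t 0 * (τ X (last 0 p) 0 * (columnWeight o 0 p [] * K [])) + 0#
        ≈⟨ +-congʳ (*-congˡ (*-congʳ (α-0 (last 0 p)))) ⟨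
      t 0 * (α (last 0 p) 0 * (columnWeight o 0 p [] * K [])) + 0# ∎
  lowerRows {N} {(n , _) ∷ rs} (_∷_ {l = l} n≤N low) p′ K K-sym =
    n , S , n≤N , λ lp′ → (λ r r≤n → S-sym lp′ r r≤n) , eq lp′
    where
    K′ : ℕ → List ℕ → List ℕ → Carrier
    K′ r q = columnWeight (suc (suc k)) r q

    rec = λ p r q → lowerRows low p (K′ r q) (λ u → columnWeight-sym-> _ r q u ℕₚ.≤-refl)

    n′ : List ℕ → ℕ → List ℕ → ℕ
    n′ p r q = proj₁ (rec p r q)
    S′ : List ℕ → ℕ → List ℕ → ℕ → Carrier
    S′ p r q = proj₁ (proj₂ (rec p r q))
    n′≤n : ∀ p r q → n′ p r q ≤ n
    n′≤n p r q = proj₁ (proj₂ (proj₂ (rec p r q)))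
    S′-sym : ∀ p r q → length p ≡ j → ∀ r′ → r′ ≤ n′ p r q → Sym (S′ p r q r′)
    S′-sym p r q lp = proj₁ (proj₂ (proj₂ (proj₂ (rec p r q))) lp)
    S′-eq : ∀ p r q → length p ≡ j → ∀ t → patterns o rs (twoLetters p t (K′ r q)) ≈
            ∑[ r′ ∈ upTo (suc (n′ p r q)) ] t r′ * (α (last 0 p) r′ * S′ p r q r′)
    S′-eq p r q lp = proj₂ (proj₂ (proj₂ (proj₂ (rec p r q))) lp)

    κ′ : ℕ
    κ′ = last 0 p′

    W : List ℕ → ℕ → List ℕ → ℕ → Carrier
    W p r q r′ = prefixWeight o 0 p * (rowWeight (suc (suc k)) n r q *
      (columnWeight o 0 p′ p * (K q * S′ p r q r′)))

    M : List ℕ → ℕ → ℕ → ℕ → Carrier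
    M p r r′ m = e X (last 0 p) m * (e Y m r * (τ X κ′ m * (τ Y m r′ * α (last 0 p) r′)))

    L : List ℕ → ℕ → ℕ → Carrier
    L p r r′ = proj₁ (local (last 0 p) κ′ r r′ n)

    S : ℕ → Carrier
    S r = ∑[ p ∈ tuples n j ] ∑[ q ∈ tuples n l ] ∑[ r′ ∈ upTo (suc (n′ p r q)) ] W p r q r′ * L p r r′

    S-sym : length p′ ≡ j → ∀ r → r ≤ n → Sym (S r)
    S-sym lp′ r r≤n = Sym-∑ (tuples n j) λ {p} p∈ → Sym-∑ (tuples n l) λ {q} _ →
      Sym-∑ (upTo (suc (n′ p r q))) λ {r′} r′∈ →
      Sym-* (Sym-* (prefixWeight-sym o 0 p (ℕₚ.≤-reflexive (≡.cong (ℕ._+ o) (tuples-length n j p∈))))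
              (Sym-* (rowWeight-sym _ n r q ℕₚ.≤-refl)
                (Sym-* (columnWeight-sym-< o 0 p′ p (ℕₚ.≤-reflexive (≡.cong (ℕ._+ o) lp′)))
                  (Sym-* (K-sym q) (S′-sym p r q (tuples-length n j p∈) r′ (ℕ.s≤s⁻¹ (∈-upTo⁻ r′∈)))))))
            (proj₁ (proj₂ (local (last 0 p) κ′ r r′ n)) r≤n)

    module _ (lp′ : length p′ ≡ j) (t : ℕ → Carrier) where

      term : List ℕ → Carrier
      term v = rowWeight o n 0 v * patterns o rs (columnWeight o 0 v) * twoLetters p′ t K v

      expand : ∀ p m r q → length p ≡ j → term (p ++ m ∷ r ∷ q) ≈
               ∑[ r′ ∈ upTo (suc (n′ p r q)) ] (t r * W p r q r′) * M p r r′ m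
      expand p m r q lp = begin
        term v
          ≈⟨ *-cong (*-cong (rowWeight-split p lp n (m ∷ r ∷ q))
                            (trans (patterns-cong o rs (columnWeight-split p lp (m ∷ r ∷ q)))
                                   (S′-eq p r q lp (τ Y m))))
                    (reflexive (≡.cong₂ _*_ (columnWeight-prefix o 0 p′ p _ (≡.trans lp′ (≡.sym lp)))
                      (≡.cong (λ d → τ X κ′ (hd d) * (t (hd (tl d)) * K (tl (tl d)))) (drop-++ p lp (m ∷ r ∷ q))))) ⟩
        (P * (ex * (ey * R))) * (∑[ r′ ∈ Q ] τ Y m r′ * (α (last 0 p) r′ * S′ p r q r′)) * (C * (τx * (t r * K q)))
          ≈⟨ *-congʳ (*-∑ Q _ _) ⟩
        (∑[ r′ ∈ Q ] (P * (ex * (ey * R))) * (τ Y m r′ * (α (last 0 p) r′ * S′ p r q r′))) * (C * (τx * (t r * K q)))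
          ≈⟨ ∑-* Q _ _ ⟩
        ∑[ r′ ∈ Q ] (P * (ex * (ey * R))) * (τ Y m r′ * (α (last 0 p) r′ * S′ p r q r′)) * (C * (τx * (t r * K q)))
          ≈⟨ ∑-cong Q (λ r′ → solve 11 (λ P ex ey R ty al S C tx t K →
               (P :* (ex :* (ey :* R))) :* (ty :* (al :* S)) :* (C :* (tx :* (t :* K))) :=
               (t :* (P :* (R :* (C :* (K :* S))))) :* (ex :* (ey :* (tx :* (ty :* al))))) refl
               P ex ey R (τ Y m r′) (α (last 0 p) r′) (S′ p r q r′) C τx (t r) (K q)) ⟩
        ∑[ r′ ∈ Q ] (t r * W p r q r′) * M p r r′ m ∎
        where
        v = p ++ m ∷ r ∷ q
        Q = upTo (suc (n′ p r q))
        P = prefixWeight o 0 p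
        R = rowWeight (suc (suc k)) n r q
        C = columnWeight o 0 p′ p
        ex = e X (last 0 p) m
        ey = e Y m r
        τx = τ X κ′ m

      U : List ℕ
      U = upTo (suc n)

      eq : patterns o ((n , j ℕ.+ (2 ℕ.+ l)) ∷ rs) (twoLetters p′ t K) ≈ ∑[ r ∈ U ] t r * (α κ′ r * S r)
      eq = begin
        ∑ (tuples n (j ℕ.+ (2 ℕ.+ l))) term
          ≈⟨ ∑-tuples-++ n j (2 ℕ.+ l) term ⟩
        ∑[ p ∈ tuples n j ] ∑[ v ∈ tuples n (2 ℕ.+ l) ] term (p ++ v)
          ≈⟨ ∑-cong-∈ (tuples n j) (λ {p} p∈ → trans (∑-tuples-suc n (suc l) _) (∑-cong U (λ m →
               trans (∑-tuples-suc n l _) (∑-cong U (λ r → ∑-cong (tuples n l) (λ q →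
               expand p m r q (tuples-length n j p∈))))))) ⟩
        ∑[ p ∈ tuples n j ] ∑[ m ∈ U ] ∑[ r ∈ U ] ∑[ q ∈ tuples n l ] ∑[ r′ ∈ upTo (suc (n′ p r q)) ]
          (t r * W p r q r′) * M p r r′ m
          ≈⟨ ∑-cong (tuples n j) (λ p → ∑-comm U U _) ⟩
        ∑[ p ∈ tuples n j ] ∑[ r ∈ U ] ∑[ m ∈ U ] ∑[ q ∈ tuples n l ] ∑[ r′ ∈ upTo (suc (n′ p r q)) ]
          (t r * W p r q r′) * M p r r′ m
          ≈⟨ ∑-comm (tuples n j) U _ ⟩
        ∑[ r ∈ U ] ∑[ p ∈ tuples n j ] ∑[ m ∈ U ] ∑[ q ∈ tuples n l ] ∑[ r′ ∈ upTo (suc (n′ p r q)) ]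
          (t r * W p r q r′) * M p r r′ m
          ≈⟨ ∑-cong U (λ r → ∑-cong (tuples n j) (λ p → trans (∑-comm U (tuples n l) _)
               (∑-cong (tuples n l) (λ q → trans (∑-comm U (upTo (suc (n′ p r q))) _)
               (∑-cong (upTo (suc (n′ p r q))) (λ r′ → sumM p r q r′)))))) ⟩
        ∑[ r ∈ U ] ∑[ p ∈ tuples n j ] ∑[ q ∈ tuples n l ] ∑[ r′ ∈ upTo (suc (n′ p r q)) ]
          (t r * α κ′ r) * (W p r q r′ * L p r r′)
          ≈⟨ ∑-cong U (λ r → trans
               (∑-cong (tuples n j) (λ p → trans (∑-cong (tuples n l) (λ q → sym (*-∑ (upTo (suc (n′ p r q))) _ _)))
                 (sym (*-∑ (tuples n l) _ _))))
               (trans (sym (*-∑ (tuples n j) _ _)) (*-assoc _ _ _))) ⟩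
        ∑[ r ∈ U ] t r * (α κ′ r * S r) ∎
        where
        sumM : ∀ p r q r′ → ∑[ m ∈ U ] (t r * W p r q r′) * M p r r′ m ≈ (t r * α κ′ r) * (W p r q r′ * L p r r′)
        sumM p r q r′ = begin
          ∑[ m ∈ U ] (t r * W p r q r′) * M p r r′ m    ≈⟨ *-∑ U _ _ ⟨
          (t r * W p r q r′) * (∑[ m ∈ U ] M p r r′ m)  ≈⟨ *-congˡ (proj₂ (proj₂ (local (last 0 p) κ′ r r′ n))) ⟩
          (t r * W p r q r′) * (α κ′ r * L p r r′)      ≈⟨ solve 4 (λ u v w x → u :* v :* (w :* x) := u :* w :* (v :* x)) refl (t r) (W p r q r′) (α κ′ r) (L p r r′) ⟩
          (t r * α κ′ r) * (W p r q r′ * L p r r′)      ∎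

  patterns-Π : ∀ {N rs} → LowerRows N rs →
    Π (patterns o ((suc N , j ℕ.+ 1) ∷ rs) (λ _ → 1#)) (patterns o ((N , j ℕ.+ 2) ∷ rs) (λ _ → 1#))
  patterns-Π {N} {rs} low = Π-resp before after
    (Π-∑ P λ {p} p∈ → Π-* (prefixWeight-sym o 0 p (ℕₚ.≤-reflexive (≡.cong (ℕ._+ o) (tuples-length (suc N) j p∈))))
      (Π-∑ (Q p) λ {r} r∈ → Π-* (S-sym p (tuples-length (suc N) j p∈) r (ℕ.s≤s⁻¹ (∈-upTo⁻ r∈)))
        (Π-topRow (last 0 p) N r (suc N) (ℕₚ.≤-trans (ℕ.s≤s⁻¹ (∈-upTo⁻ r∈)) (n≤N p)) (ℕₚ.n≤1+n N))))
    where
    P : List (List ℕ)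
    P = tuples (suc N) j
    U : List ℕ
    U = upTo (suc (suc N))

    rec = λ p → lowerRows low p (λ _ → 1#) (λ _ → 1#-homo)

    Q : List ℕ → List ℕ
    Q p = upTo (suc (proj₁ (rec p)))
    S : List ℕ → ℕ → Carrier
    S p = proj₁ (proj₂ (rec p))
    n≤N : ∀ p → proj₁ (rec p) ≤ N
    n≤N p = proj₁ (proj₂ (proj₂ (rec p)))
    S-sym : ∀ p → length p ≡ j → ∀ r → r ≤ proj₁ (rec p) → Sym (S p r)
    S-sym p lp = proj₁ (proj₂ (proj₂ (proj₂ (rec p))) lp)
    S-eq : ∀ p → length p ≡ j → ∀ t → patterns o rs (twoLetters p t (λ _ → 1#)) ≈
           ∑[ r ∈ Q p ] t r * (α (last 0 p) r * S p r)
    S-eq p lp = proj₂ (proj₂ (proj₂ (proj₂ (rec p))) lp)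

    before : patterns o ((suc N , j ℕ.+ 1) ∷ rs) (λ _ → 1#) ≈
             ∑[ p ∈ P ] prefixWeight o 0 p * (∑[ r ∈ Q p ] S p r * (e X (last 0 p) (suc N) * α (last 0 p) r))
    before = trans (∑-tuples-++ (suc N) j 1 _) (∑-cong-∈ P (λ {p} p∈ → inner p (tuples-length (suc N) j p∈)))
      where
      term : List ℕ → Carrier
      term v = rowWeight o (suc N) 0 v * patterns o rs (columnWeight o 0 v) * 1#

      module _ (p : List ℕ) (lp : length p ≡ j) where

        w : Carrier
        w = ∑[ r ∈ Q p ] S p r * α (last 0 p) r

        column : ∀ m → patterns o rs (columnWeight o 0 (p ++ m ∷ [])) ≈ w
        column m = begin
          patterns o rs (columnWeight o 0 (p ++ m ∷ []))
            ≈⟨ patterns-cong o rs (λ u → trans (columnWeight-split p lp (m ∷ []) u)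
                 (*-congˡ (*-congˡ (sym (*-identityˡ _))))) ⟩
          patterns o rs (twoLetters p (λ _ → 1#) (λ _ → 1#))
            ≈⟨ S-eq p lp (λ _ → 1#) ⟩
          ∑[ r ∈ Q p ] 1# * (α (last 0 p) r * S p r)
            ≈⟨ ∑-cong (Q p) (λ r → trans (*-identityˡ _) (*-comm _ _)) ⟩
          w ∎

        inner : ∑[ v ∈ tuples (suc N) 1 ] term (p ++ v) ≈
          prefixWeight o 0 p * (∑[ r ∈ Q p ] S p r * (e X (last 0 p) (suc N) * α (last 0 p) r))
        inner = begin
          ∑[ v ∈ tuples (suc N) 1 ] term (p ++ v)
            ≈⟨ ∑-tuples-suc (suc N) 0 _ ⟩
          ∑[ m ∈ U ] (term (p ++ m ∷ []) + 0#)
            ≈⟨ ∑-cong U (λ m → trans (+-identityʳ _) (trans (*-identityʳ _) (trans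
                 (*-cong (rowWeight-split p lp (suc N) (m ∷ [])) (column m))
                 (solve 4 (λ u v d w → (u :* (v :* d)) :* w := (u :* (w :* v)) :* d) refl
                    (prefixWeight o 0 p) (e X (last 0 p) m) (δ m (suc N)) w)))) ⟩
          ∑[ m ∈ U ] (prefixWeight o 0 p * (w * e X (last 0 p) m)) * δ m (suc N)
            ≈⟨ ∑-δ {suc N} {suc N} (λ m → prefixWeight o 0 p * (w * e X (last 0 p) m)) ℕₚ.≤-refl ⟩
          prefixWeight o 0 p * (w * e X (last 0 p) (suc N))
            ≈⟨ *-congˡ (trans (∑-* (Q p) _ _) (∑-cong (Q p) (λ r → trans (*-assoc _ _ _) (*-congˡ (*-comm _ _))))) ⟩
          prefixWeight o 0 p * (∑[ r ∈ Q p ] S p r * (e X (last 0 p) (suc N) * α (last 0 p) r)) ∎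

    after : patterns o ((N , j ℕ.+ 2) ∷ rs) (λ _ → 1#) ≈
            ∑[ p ∈ P ] prefixWeight o 0 p * (∑[ r ∈ Q p ] S p r *
              (∑[ m ∈ U ] e X (last 0 p) m * (e Y m N * (τ Y m r * α (last 0 p) r))))
    after = begin
      ∑[ v ∈ tuples N (j ℕ.+ 2) ] rowWeight o N 0 v * patterns o rs (columnWeight o 0 v) * 1#
        ≈⟨ ∑-cong (tuples N (j ℕ.+ 2)) (λ v → *-identityʳ _) ⟩
      ∑[ v ∈ tuples N (j ℕ.+ 2) ] rowWeight o N 0 v * patterns o rs (columnWeight o 0 v)
        ≈⟨ ∑-rowWeight-suc o N 0 (j ℕ.+ 2) (λ v → patterns o rs (columnWeight o 0 v)) ⟨
      ∑ (tuples (suc N) (j ℕ.+ 2)) term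
        ≈⟨ ∑-tuples-++ (suc N) j 2 term ⟩
      ∑[ p ∈ P ] ∑[ v ∈ tuples (suc N) 2 ] term (p ++ v)
        ≈⟨ ∑-cong-∈ P (λ {p} p∈ → inner p (tuples-length (suc N) j p∈)) ⟩
      _ ∎
      where
      term : List ℕ → Carrier
      term v = rowWeight o N 0 v * patterns o rs (columnWeight o 0 v)

      module _ (p : List ℕ) (lp : length p ≡ j) where

        w : ℕ → Carrier
        w m = ∑[ r ∈ Q p ] τ Y m r * (α (last 0 p) r * S p r)

        a : Carrier
        a = prefixWeight o 0 p

        column : ∀ m r → patterns o rs (columnWeight o 0 (p ++ m ∷ r ∷ [])) ≈ w m
        column m r = trans (patterns-cong o rs (columnWeight-split p lp (m ∷ r ∷ []))) (S-eq p lp (τ Y m))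

        inner : ∑[ v ∈ tuples (suc N) 2 ] term (p ++ v) ≈
          a * (∑[ r ∈ Q p ] S p r * (∑[ m ∈ U ] e X (last 0 p) m * (e Y m N * (τ Y m r * α (last 0 p) r))))
        inner = begin
          ∑[ v ∈ tuples (suc N) 2 ] term (p ++ v)
            ≈⟨ trans (∑-tuples-suc (suc N) 1 _) (∑-cong U (λ m → ∑-tuples-suc (suc N) 0 _)) ⟩
          ∑[ m ∈ U ] ∑[ r ∈ U ] (term (p ++ m ∷ r ∷ []) + 0#)
            ≈⟨ ∑-cong U (λ m → ∑-cong U (λ r → trans (+-identityʳ _) (trans
                 (*-cong (rowWeight-split p lp N (m ∷ r ∷ [])) (column m r))
                 (solve 5 (λ a u v d w → a :* (u :* (v :* d)) :* w := a :* (u :* v :* w) :* d) refl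
                    a (e X (last 0 p) m) (e Y m r) (δ r N) (w m))))) ⟩
          ∑[ m ∈ U ] ∑[ r ∈ U ] (a * (e X (last 0 p) m * e Y m r * w m)) * δ r N
            ≈⟨ ∑-cong U (λ m → ∑-δ {N} {suc N} (λ r → a * (e X (last 0 p) m * e Y m r * w m)) (ℕₚ.n≤1+n N)) ⟩
          ∑[ m ∈ U ] a * (e X (last 0 p) m * e Y m N * w m)
            ≈⟨ *-∑ U a _ ⟨
          a * (∑[ m ∈ U ] e X (last 0 p) m * e Y m N * w m)
            ≈⟨ *-congˡ (trans (∑-cong U (λ m → *-∑ (Q p) _ _)) (∑-comm U (Q p) _)) ⟩
          a * (∑[ r ∈ Q p ] ∑[ m ∈ U ] e X (last 0 p) m * e Y m N * (τ Y m r * (α (last 0 p) r * S p r)))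
            ≈⟨ *-congˡ (∑-cong (Q p) (λ r → trans (∑-cong U (λ m →
                 solve 5 (λ u v t w s → u :* v :* (t :* (w :* s)) := s :* (u :* (v :* (t :* w)))) refl
                   (e X (last 0 p) m) (e Y m N) (τ Y m r) (α (last 0 p) r) (S p r)))
                 (sym (*-∑ U (S p r) _)))) ⟩
          a * (∑[ r ∈ Q p ] S p r * (∑[ m ∈ U ] e X (last 0 p) m * (e Y m N * (τ Y m r * α (last 0 p) r)))) ∎

-- Polynomials as operators on power series

s-involutive : ∀ i j → s i (s i j) ≡ j
s-involutive zero    zero          = ≡.refl
s-involutive zero    (suc zero)    = ≡.refl
s-involutive zero    (suc (suc j)) = ≡.refl
s-involutive (suc i) zero          = ≡.refl
s-involutive (suc i) (suc j)       = ≡.cong suc (s-involutive i j)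

update-comm : ∀ α i j p q → i ≢ j → α [ i ≔ p ] [ j ≔ q ] ≐ α [ j ≔ q ] [ i ≔ p ]
update-comm α i j p q i≢j l with l ℕ.≟ j | l ℕ.≟ i
... | yes ≡.refl | yes ≡.refl = contradiction ≡.refl i≢j
... | yes ≡.refl | no l≢i = ≡.trans (update-same (exp (α [ i ≔ p ])) l q)
  (≡.sym (≡.trans (update-other (exp (α [ l ≔ q ])) i p l l≢i) (update-same (exp α) l q)))
... | no l≢j | yes ≡.refl = ≡.trans (update-other (exp (α [ l ≔ p ])) j q l l≢j)
  (≡.trans (update-same (exp α) l p) (≡.sym (update-same (exp (α [ j ≔ q ])) l p)))
... | no l≢j | no l≢i = ≡.trans (update-other (exp (α [ i ≔ p ])) j q l l≢j) (≡.trans (update-other (exp α) i p l l≢i)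
  (≡.sym (≡.trans (update-other (exp (α [ j ≔ q ])) i p l l≢i) (update-other (exp α) j q l l≢j))))

update-idem : ∀ α i p q → α [ i ≔ p ] [ i ≔ q ] ≐ α [ i ≔ q ]
update-idem α i p q l with l ℕ.≟ i
... | yes ≡.refl = ≡.trans (update-same (exp (α [ l ≔ p ])) l q) (≡.sym (update-same (exp α) l q))
... | no l≢i = ≡.trans (update-other (exp (α [ i ≔ p ])) i q l l≢i) (≡.trans (update-other (exp α) i p l l≢i)
  (≡.sym (update-other (exp α) i q l l≢i)))

update-id : ∀ α i → α [ i ≔ exp α i ] ≐ α
update-id α i l with l ℕ.≟ i
... | yes ≡.refl = update-same (exp α) l _
... | no l≢i     = update-other (exp α) i _ l l≢i

swap-update : ∀ i j p α → swap i α [ j ≔ p ] ≐ swap i (α [ s i j ≔ p ])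
swap-update i j p α l with l ℕ.≟ j
... | yes ≡.refl = ≡.trans (update-same (exp (swap i α)) l p) (≡.sym (update-same (exp α) (s i l) p))
... | no l≢j     = ≡.trans (update-other (exp (swap i α)) j p l l≢j)
  (≡.sym (update-other (exp α) (s i j) p (s i l) (λ e → l≢j
    (≡.trans (≡.sym (s-involutive i l)) (≡.trans (≡.cong (s i) e) (s-involutive i j))))))

module Polynomials {c ℓ} (R : CommutativeRing c ℓ) (β : CommutativeRing.Carrier R) where

  private module R = CommutativeRing R
  open PowerSeries R β
  open import Algebra.Properties.AbelianGroup R.+-abelianGroup using (⁻¹-∙-comm; ε⁻¹≈ε)
  open import Relation.Binary.Reasoning.Setoid R.setoid

  ≈ₛ-sym : ∀ {h g} → h ≈ₛ g → g ≈ₛ h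
  ≈ₛ-sym q α = R.sym (q α)

  +ₛ-cong : ∀ {h h′ g g′} → h ≈ₛ h′ → g ≈ₛ g′ → h +ₛ g ≈ₛ h′ +ₛ g′
  +ₛ-cong q r α = R.+-cong (q α) (r α)

  •-cong : ∀ {a h h′} → h ≈ₛ h′ → a • h ≈ₛ a • h′
  •-cong q α = R.*-congˡ (q α)

  x-cong : ∀ {i h h′} → h ≈ₛ h′ → x[ i ]· h ≈ₛ x[ i ]· h′
  x-cong {i} q α = lower-cong {exp α i} ≡.refl (λ p → q _)

  x-+ : ∀ i h g → x[ i ]· (h +ₛ g) ≈ₛ (x[ i ]· h) +ₛ (x[ i ]· g)
  x-+ i h g α with exp α i
  ... | zero  = R.sym (R.+-identityˡ R.0#)
  ... | suc p = R.refl

  x-• : ∀ i a h → x[ i ]· (a • h) ≈ₛ a • (x[ i ]· h)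
  x-• i a h α with exp α i
  ... | zero  = R.sym (R.zeroʳ a)
  ... | suc p = R.refl

  lower-comm : ∀ m n (F F′ : ℕ → ℕ → R.Carrier) → (∀ p q → F p q R.≈ F′ q p) →
    lower m (λ p → lower n (F p)) R.≈ lower n (λ q → lower m (F′ q))
  lower-comm zero    zero    F F′ e = R.refl
  lower-comm zero    (suc n) F F′ e = R.refl
  lower-comm (suc m) zero    F F′ e = R.refl
  lower-comm (suc m) (suc n) F F′ e = e m n

  x-comm : ∀ i j h → x[ i ]· x[ j ]· h ≈ₛ x[ j ]· x[ i ]· h
  x-comm i j h α with i ℕ.≟ j
  ... | yes ≡.refl = R.refl
  ... | no i≢j     = begin
    lower (exp α i) (λ p → lower (exp (α [ i ≔ p ]) j) (λ q → coeff h (α [ i ≔ p ] [ j ≔ q ])))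
      ≈⟨ lower-cong {exp α i} ≡.refl (λ p → lower-cong (update-other (exp α) i p j (i≢j ∘ ≡.sym)) (λ _ → R.refl)) ⟩
    lower (exp α i) (λ p → lower (exp α j) (λ q → coeff h (α [ i ≔ p ] [ j ≔ q ])))
      ≈⟨ lower-comm (exp α i) (exp α j) _ _ (λ p q → coeff-cong h _ _ (update-comm α i j p q i≢j)) ⟩
    lower (exp α j) (λ q → lower (exp α i) (λ p → coeff h (α [ j ≔ q ] [ i ≔ p ])))
      ≈⟨ lower-cong {exp α j} ≡.refl (λ q → lower-cong (update-other (exp α) j q i i≢j) (λ _ → R.refl)) ⟨
    lower (exp α j) (λ q → lower (exp (α [ j ≔ q ]) i) (λ p → coeff h (α [ j ≔ q ] [ i ≔ p ]))) ∎

  infixl 6 _⊕_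
  infixl 7 _⊗_
  data Polynomial : Set c where
    con     : R.Carrier → Polynomial
    var     : ℕ → Polynomial
    _⊕_ _⊗_ : Polynomial → Polynomial → Polynomial

  act : Polynomial → Series → Series
  act (con a)  h = a • h
  act (var i)  h = x[ i ]· h
  act (f ⊕ g)  h = act f h +ₛ act g h
  act (f ⊗ g)  h = act f (act g h)

  -- Polynomials are identified when they act alike on series.
  infix 4 _≈ₑ_
  _≈ₑ_ : Polynomial → Polynomial → Set (c Level.⊔ ℓ)
  f ≈ₑ g = ∀ h → act f h ≈ₛ act g h

  act-cong : ∀ f {h h′} → h ≈ₛ h′ → act f h ≈ₛ act f h′
  act-cong (con a) {h} {h′} q = •-cong {a} {h} {h′} q
  act-cong (var i) {h} {h′} q = x-cong {i} {h} {h′} q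
  act-cong (f ⊕ g) q = +ₛ-cong {act f _} {act f _} {act g _} {act g _} (act-cong f q) (act-cong g q)
  act-cong (f ⊗ g) q = act-cong f (act-cong g q)

  record Linear (T : Series → Series) : Set (c Level.⊔ ℓ) where
    field
      T-cong : ∀ {h g} → h ≈ₛ g → T h ≈ₛ T g
      T-+    : ∀ h g → T (h +ₛ g) ≈ₛ T h +ₛ T g
      T-•    : ∀ a h → T (a • h) ≈ₛ a • T h
      T-x    : ∀ i h → T (x[ i ]· h) ≈ₛ x[ i ]· T h

  act-comm : ∀ f {T} → Linear T → ∀ h → T (act f h) ≈ₛ act f (T h)
  act-comm (con a) L h = Linear.T-• L a h
  act-comm (var i) L h = Linear.T-x L i h
  act-comm (f ⊕ g) L h α = R.trans (Linear.T-+ L (act f h) (act g h) α)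
    (R.+-cong (act-comm f L h α) (act-comm g L h α))
  act-comm (f ⊗ g) L h α = R.trans (act-comm f L (act g h) α) (act-cong f (act-comm g L h) α)

  •-linear : ∀ a → Linear (a •_)
  •-linear a = record
    { T-cong = λ {h} {g} → •-cong {a} {h} {g}
    ; T-+    = λ h g α → R.distribˡ _ _ _
    ; T-•    = λ a′ h α → R.trans (R.sym (R.*-assoc _ _ _)) (R.trans (R.*-congʳ (R.*-comm a a′)) (R.*-assoc _ _ _))
    ; T-x    = λ i h α → R.sym (x-• i a h α) }

  x-linear : ∀ i → Linear (x[ i ]·_)
  x-linear i = record { T-cong = λ {h} {g} → x-cong {i} {h} {g} ; T-+ = x-+ i ; T-• = x-• i ; T-x = x-comm i }

  act-linear : ∀ f → Linear (act f)
  act-linear f = record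
    { T-cong = act-cong f
    ; T-+    = act-+ f
    ; T-•    = λ a h α → R.sym (act-comm f (•-linear a) h α)
    ; T-x    = λ i h α → R.sym (act-comm f (x-linear i) h α) }
    where
    act-+ : ∀ f h g → act f (h +ₛ g) ≈ₛ act f h +ₛ act f g
    act-+ (con a) h g = λ α → R.distribˡ _ _ _
    act-+ (var i) h g = x-+ i h g
    act-+ (f ⊕ f′) h g α = R.trans (R.+-cong (act-+ f h g α) (act-+ f′ h g α)) (interchange _ _ _ _)
      where open import Algebra.Properties.CommutativeSemigroup R.+-commutativeSemigroup using (interchange)
    act-+ (f ⊗ f′) h g α = R.trans (act-cong f (act-+ f′ h g) α) (act-+ f (act f′ h) (act f′ g) α)

  polynomials : CommutativeSemiring c (c Level.⊔ ℓ)
  polynomials = record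
    { Carrier = Polynomial ; _≈_ = _≈ₑ_ ; _+_ = _⊕_ ; _*_ = _⊗_ ; 0# = con R.0# ; 1# = con R.1#
    ; isCommutativeSemiring = isCommutativeSemiringˡ (record
      { +-isCommutativeMonoid = isCommutativeMonoidˡ (record
        { isSemigroup = record
          { isMagma = record { isEquivalence = equiv ; ∙-cong = λ q r h α → R.+-cong (q h α) (r h α) }
          ; assoc = λ f g k h α → R.+-assoc _ _ _ }
        ; identityˡ = λ f h α → R.trans (R.+-congʳ (R.zeroˡ _)) (R.+-identityˡ _)
        ; comm = λ f g h α → R.+-comm _ _ })
      ; *-isCommutativeMonoid = isCommutativeMonoidˡ (record
        { isSemigroup = record
          { isMagma = record { isEquivalence = equiv
            ; ∙-cong = λ {f} {f′} {g} {g′} q r h α → R.trans (q (act g h) α) (act-cong f′ (r h) α) }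
          ; assoc = λ f g k h α → R.refl }
        ; identityˡ = λ f h α → R.*-identityˡ _
        ; comm = λ f g h → act-comm g (act-linear f) h })
      ; distribʳ = λ f g k h α → R.refl
      ; zeroˡ = λ f h α → R.trans (R.zeroˡ _) (R.sym (R.zeroˡ _)) }) }
    where
    open import Relation.Binary.Structures using (IsEquivalence)
    equiv : IsEquivalence _≈ₑ_
    equiv = record { refl = λ h α → R.refl ; sym = λ q h α → R.sym (q h α) ; trans = λ q r h α → R.trans (q h α) (r h α) }

  rename : ℕ → Polynomial → Polynomial
  rename i (con a) = con a
  rename i (var j) = var (s i j)
  rename i (f ⊕ g) = rename i f ⊕ rename i g
  rename i (f ⊗ g) = rename i f ⊗ rename i g

  swapₛ-cong : ∀ i {h g} → h ≈ₛ g → swapₛ i h ≈ₛ swapₛ i g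
  swapₛ-cong i q α = q (swap i α)

  swapₛ-involutive : ∀ i h → swapₛ i (swapₛ i h) ≈ₛ h
  swapₛ-involutive i h α = coeff-cong h _ _ (λ j → ≡.cong (exp α) (s-involutive i j))

  swapₛ-act : ∀ i f h → swapₛ i (act f h) ≈ₛ act (rename i f) (swapₛ i h)
  swapₛ-act i (con a) h α = R.refl
  swapₛ-act i (var j) h α = lower-cong {exp α (s i j)} ≡.refl (λ p → coeff-cong h _ _ (swap-update i j p α))
  swapₛ-act i (f ⊕ g) h α = R.+-cong (swapₛ-act i f h α) (swapₛ-act i g h α)
  swapₛ-act i (f ⊗ g) h α = R.trans (swapₛ-act i f (act g h) α) (act-cong (rename i f) (swapₛ-act i g h) α)

  swapₛ-1 : ∀ i → swapₛ i 1ₛ ≈ₛ 1ₛ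
  swapₛ-1 i α = R.reflexive (≡.cong (if_then R.1# else R.0#)
    (does-⇔ (mk⇔ (λ z j → ≡.trans (≡.cong (exp α) (≡.sym (s-involutive i j))) (z (s i j))) (λ z j → z (s i j)))
            (one? (swap i α)) (one? α)))
    
  rename-cong : ∀ i {f g} → f ≈ₑ g → rename i f ≈ₑ rename i g
  rename-cong i {f} {g} q h α = begin
    coeff (act (rename i f) h) α                         ≈⟨ act-cong (rename i f) (swapₛ-involutive i h) α ⟨
    coeff (act (rename i f) (swapₛ i (swapₛ i h))) α     ≈⟨ swapₛ-act i f (swapₛ i h) α ⟨
    coeff (swapₛ i (act f (swapₛ i h))) α                ≈⟨ q (swapₛ i h) (swap i α) ⟩
    coeff (swapₛ i (act g (swapₛ i h))) α                ≈⟨ swapₛ-act i g (swapₛ i h) α ⟩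
    coeff (act (rename i g) (swapₛ i (swapₛ i h))) α     ≈⟨ act-cong (rename i g) (swapₛ-involutive i h) α ⟩
    coeff (act (rename i g) h) α                         ∎

  open CommutativeSemiring polynomials using (rawSemiring)

  rename-hom : ∀ i → IsSemiringHomomorphism rawSemiring rawSemiring (rename i)
  rename-hom i = record
    { isNearSemiringHomomorphism = record
      { +-isMonoidHomomorphism = record
        { isMagmaHomomorphism = record
          { isRelHomomorphism = record { cong = λ {f} {g} → rename-cong i {f} {g} }
          ; homo = λ f g h α → R.refl }
        ; ε-homo = λ h α → R.refl }
      ; *-homo = λ f g h α → R.refl }
    ; 1#-homo = λ h α → R.refl }

  quotient-unique : ∀ i g → quotient i ((x[ i ]· g) -ₛ (x[ suc i ]· g)) ≈ₛ g
  quotient-unique i g α = begin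
    coeff (quotient i H) α
      ≈⟨ Σ≤-cong (exp α (suc i)) (λ k → difference (suc (exp α i ℕ.+ k)) (exp α (suc i) ∸ k)) ⟩
    Σ≤ (exp α (suc i)) (λ k → F (exp α i ℕ.+ k) (exp α (suc i) ∸ k) R.- lower (exp α (suc i) ∸ k) (F (suc (exp α i ℕ.+ k))))
      ≈⟨ telescope (exp α i) (exp α (suc i)) ⟩
    F (exp α i) (exp α (suc i))
      ≈⟨ coeff-cong g _ _ (λ j → ≡.trans (update-cong (suc i) (update-id α i) ≡.refl j) (update-id α (suc i) j)) ⟩
    coeff g α ∎
    where
    H = (x[ i ]· g) -ₛ (x[ suc i ]· g)
    F : ℕ → ℕ → R.Carrier
    F p q = coeff g (α [ i ≔ p ] [ suc i ≔ q ])
    difference : ∀ p q → coeff H (α [ i ≔ p ] [ suc i ≔ q ]) R.≈ lower p (λ p′ → F p′ q) R.- lower q (F p)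
    difference p q = R.+-cong
      (lower-cong (≡.trans (update-other _ (suc i) q i (ℕₚ.1+n≢n ∘ ≡.sym)) (update-same (exp α) i p))
        (λ p′ → coeff-cong g _ _ (λ j → ≡.trans (update-comm (α [ i ≔ p ]) (suc i) i q p′ ℕₚ.1+n≢n j)
          (update-cong (suc i) (update-idem α i p p′) ≡.refl j))))
      (R.-‿cong (lower-cong (update-same (exp (α [ i ≔ p ])) (suc i) q)
        (λ q′ → coeff-cong g _ _ (update-idem (α [ i ≔ p ]) (suc i) q q′))))
    telescope : ∀ p q → Σ≤ q (λ k → F (p ℕ.+ k) (q ∸ k) R.- lower (q ∸ k) (F (suc (p ℕ.+ k)))) R.≈ F p q
    telescope p zero rewrite ℕₚ.+-identityʳ p = R.trans (R.+-congˡ ε⁻¹≈ε) (R.+-identityʳ _)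
    telescope p (suc q) rewrite ℕₚ.+-identityʳ p = begin
      (F p (suc q) R.- F (suc p) q) R.+
        Σ≤ q (λ k → F (p ℕ.+ suc k) (q ∸ k) R.- lower (q ∸ k) (F (suc (p ℕ.+ suc k))))
        ≈⟨ R.+-congˡ (Σ≤-cong q (λ k → R.reflexive
             (≡.cong (λ m → F m (q ∸ k) R.- lower (q ∸ k) (F (suc m))) (ℕₚ.+-suc p k)))) ⟩
      (F p (suc q) R.- F (suc p) q) R.+ Σ≤ q (λ k → F (suc p ℕ.+ k) (q ∸ k) R.- lower (q ∸ k) (F (suc (suc p ℕ.+ k))))
        ≈⟨ R.+-congˡ (telescope (suc p) q) ⟩
      (F p (suc q) R.- F (suc p) q) R.+ F (suc p) q
        ≈⟨ R.trans (R.+-assoc _ _ _) (R.trans (R.+-congˡ (R.-‿inverseˡ _)) (R.+-identityʳ _)) ⟩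
      F p (suc q) ∎

  quotient-cong : ∀ i {H H′} → H ≈ₛ H′ → quotient i H ≈ₛ quotient i H′
  quotient-cong i q α = Σ≤-cong (exp α (suc i)) (λ k → q _)

  numerator-cong : ∀ i {h h′} → h ≈ₛ h′ → numerator i h ≈ₛ numerator i h′
  numerator-cong i {h} {h′} q α = R.+-cong
    (R.+-cong (q α) (R.*-congˡ (x-cong {suc i} {h} {h′} q α)))
    (R.-‿cong (R.+-cong (q (swap i α)) (R.*-congˡ (x-cong {i} {swapₛ i h} {swapₛ i h′} (swapₛ-cong i {h} {h′} q) α))))

  π-cong : ∀ i {h h′} → h ≈ₛ h′ → π i h ≈ₛ π i h′
  π-cong i {h} {h′} q = quotient-cong i {numerator i h} {numerator i h′} (numerator-cong i {h} {h′} q)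

  πWord-cong : ∀ u {h h′} → h ≈ₛ h′ → πWord u h ≈ₛ πWord u h′
  πWord-cong []      q = q
  πWord-cong (i ∷ u) {h} {h′} q = πWord-cong u (π-cong i {h} {h′} q)

  ⟦_⟧ : Polynomial → Series
  ⟦ f ⟧ = act f 1ₛ

  open Weights polynomials (con β)

  module At (i : ℕ) = TwoVariables (rename i) (rename-hom i) (var i) (var (suc i))
    (λ h α → R.reflexive (≡.cong (λ j → coeff (x[ j ]· h) α) (s-at i)))
    (λ h α → R.reflexive (≡.cong (λ j → coeff (x[ j ]· h) α) (s-at-suc i)))
    (λ h α → R.refl)

  π-act : ∀ i f g → At.Π i f g → π i ⟦ f ⟧ ≈ₛ ⟦ g ⟧
  π-act i f g r α = R.trans (quotient-cong i {numerator i h} {(x[ i ]· ⟦ g ⟧) -ₛ (x[ suc i ]· ⟦ g ⟧)} difference α) (quotient-unique i ⟦ g ⟧ α)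
    where
    h = ⟦ f ⟧
    transpose : ∀ {a b d e} → a R.+ b R.≈ d R.+ e → a R.- d R.≈ e R.- b
    transpose {a} {b} {d} {e} q = begin
      a R.- d                             ≈⟨ R.+-congʳ (R.trans (R.+-congˡ (R.-‿inverseʳ b)) (R.+-identityʳ a)) ⟨
      (a R.+ (b R.- b)) R.- d             ≈⟨ R.+-congʳ (R.+-assoc _ _ _) ⟨
      ((a R.+ b) R.- b) R.- d             ≈⟨ R.+-congʳ (R.+-congʳ q) ⟩
      ((d R.+ e) R.- b) R.- d             ≈⟨ R.+-congʳ (R.+-congʳ (R.+-comm d e)) ⟩
      ((e R.+ d) R.- b) R.- d             ≈⟨ R.+-congʳ (R.+-assoc _ _ _) ⟩
      (e R.+ (d R.- b)) R.- d             ≈⟨ R.+-congʳ (R.+-congˡ (R.+-comm _ _)) ⟩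
      (e R.+ (R.- b R.+ d)) R.- d         ≈⟨ R.+-congʳ (R.+-assoc _ _ _) ⟨
      ((e R.- b) R.+ d) R.- d             ≈⟨ R.+-assoc _ _ _ ⟩
      (e R.- b) R.+ (d R.- d)             ≈⟨ R.trans (R.+-congˡ (R.-‿inverseʳ d)) (R.+-identityʳ _) ⟩
      e R.- b                             ∎
    swapped : act (rename i f) 1ₛ ≈ₛ swapₛ i h
    swapped γ = R.trans (act-cong (rename i f) (≈ₛ-sym {swapₛ i 1ₛ} {1ₛ} (swapₛ-1 i)) γ) (R.sym (swapₛ-act i f 1ₛ γ))
    difference : numerator i h ≈ₛ (x[ i ]· ⟦ g ⟧) -ₛ (x[ suc i ]· ⟦ g ⟧)
    difference γ = transpose (begin
      (coeff h γ R.+ β R.* coeff (x[ suc i ]· h) γ) R.+ coeff (x[ suc i ]· ⟦ g ⟧) γ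
        ≈⟨ R.+-congʳ (R.+-congʳ (R.*-identityˡ _)) ⟨
      (R.1# R.* coeff h γ R.+ β R.* coeff (x[ suc i ]· h) γ) R.+ coeff (x[ suc i ]· ⟦ g ⟧) γ
        ≈⟨ r 1ₛ γ ⟩
      (R.1# R.* coeff (act (rename i f) 1ₛ) γ R.+ β R.* coeff (x[ i ]· act (rename i f) 1ₛ) γ) R.+ coeff (x[ i ]· ⟦ g ⟧) γ
        ≈⟨ R.+-congʳ (R.+-cong (R.trans (R.*-identityˡ _) (swapped γ)) (R.*-congˡ (x-cong {i} {act (rename i f) 1ₛ} {swapₛ i h} swapped γ))) ⟩
      (coeff (swapₛ i h) γ R.+ β R.* coeff (x[ i ]· swapₛ i h) γ) R.+ coeff (x[ i ]· ⟦ g ⟧) γ ∎)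

-- Codes of permutations

lift : (ℕ → ℕ) → ℕ → ℕ
lift g zero    = zero
lift g (suc j) = suc (g j)

lift-cong : ∀ {g g′} → g ≗ g′ → lift g ≗ lift g′
lift-cong q zero    = ≡.refl
lift-cong q (suc j) = ≡.cong suc (q j)

lift-∘ : ∀ g g′ → lift g ∘ lift g′ ≗ lift (g ∘ g′)
lift-∘ g g′ zero    = ≡.refl
lift-∘ g g′ (suc j) = ≡.refl

lift-s : ∀ i → lift (s i) ≗ s (suc i)
lift-s i zero    = ≡.refl
lift-s i (suc j) = ≡.refl

-- cycle m = s₀ s₁ ⋯ s_{m − 1}
cycle : ℕ → ℕ → ℕ
cycle zero    = id
cycle (suc m) = s 0 ∘ lift (cycle m)

-- Every permutation has a unique code m ∷ ms, namely m is the preimage of 0.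
fromCode : List ℕ → ℕ → ℕ
fromCode []       = id
fromCode (m ∷ ms) = lift (fromCode ms) ∘ cycle m

codeWord : List ℕ → List ℕ
codeWord []       = []
codeWord (m ∷ ms) = map suc (codeWord ms) ++ upTo m

perm-++ : ∀ u v → perm (u ++ v) ≗ perm u ∘ perm v
perm-++ []      v j = ≡.refl
perm-++ (i ∷ u) v j = ≡.cong (s i) (perm-++ u v j)

perm-map-suc : ∀ u → perm (map suc u) ≗ lift (perm u)
perm-map-suc []      zero    = ≡.refl
perm-map-suc []      (suc j) = ≡.refl
perm-map-suc (i ∷ u) j = ≡.trans (≡.cong (s (suc i)) (perm-map-suc u j))
  (≡.trans (≡.sym (lift-s i _)) (lift-∘ (s i) (perm u) j))

perm-upTo : ∀ m → perm (upTo m) ≗ cycle m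
perm-upTo zero    j = ≡.refl
perm-upTo (suc m) j = ≡.cong (s 0) (≡.trans
  (≡.cong (λ u → perm u j) (≡.sym (map-upTo suc m)))
  (≡.trans (perm-map-suc (upTo m) j) (lift-cong (perm-upTo m) j)))

perm-codeWord : ∀ c → perm (codeWord c) ≗ fromCode c
perm-codeWord []       j = ≡.refl
perm-codeWord (m ∷ ms) j = ≡.trans (perm-++ (map suc (codeWord ms)) (upTo m) j)
  (≡.trans (perm-map-suc (codeWord ms) _)
  (≡.trans (lift-cong (perm-codeWord ms) _) (≡.cong (lift (fromCode ms)) (perm-upTo m j))))

length-codeWord : ∀ c → length (codeWord c) ≡ sum c
length-codeWord []       = ≡.refl
length-codeWord (m ∷ ms) = ≡.trans (length-++ (map suc (codeWord ms)))
  (≡.trans (≡.cong₂ ℕ._+_ (≡.trans (length-map suc (codeWord ms)) (length-codeWord ms)) (length-upTo m))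
           (ℕₚ.+-comm (sum ms) m))

data Move (m i : ℕ) : Set where
  resize : ∀ m′ → m′ ≤ suc m → cycle m ∘ s i ≗ cycle m′ → Move m i
  pass   : ∀ i′ → cycle m ∘ s i ≗ lift (s i′) ∘ cycle m → Move m i

move : ∀ m i → Move m i
move zero          zero    = resize 1 ℕₚ.≤-refl λ where
  zero          → ≡.refl
  (suc zero)    → ≡.refl
  (suc (suc j)) → ≡.refl
move zero          (suc i) = pass i (λ j → ≡.sym (lift-s i j))
move (suc zero)    zero    = resize 0 z≤n λ where
  zero          → ≡.refl
  (suc zero)    → ≡.refl
  (suc (suc j)) → ≡.refl
move (suc (suc m)) zero    = pass 0 braid
  where
  braid : cycle (suc (suc m)) ∘ s 0 ≗ lift (s 0) ∘ cycle (suc (suc m))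
  braid zero          = ≡.refl
  braid (suc zero)    = ≡.refl
  braid (suc (suc j)) with cycle m j
  ... | zero  = ≡.refl
  ... | suc _ = ≡.refl
move (suc m) (suc i) with move m i
... | resize m′ b q = resize (suc m′) (s≤s b) (λ j → ≡.cong (s 0) (step j))
  where
  step : lift (cycle m) ∘ s (suc i) ≗ lift (cycle m′)
  step j = ≡.trans (≡.cong (lift (cycle m)) (≡.sym (lift-s i j))) (≡.trans (lift-∘ _ _ j) (lift-cong q j))
... | pass i′ q = pass (suc i′) λ j → ≡.trans (≡.cong (s 0) (step j)) (commute (lift (cycle m) j))
  where
  step : lift (cycle m) ∘ s (suc i) ≗ lift (lift (s i′)) ∘ lift (cycle m)
  step j = ≡.trans (≡.cong (lift (cycle m)) (≡.sym (lift-s i j)))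
    (≡.trans (lift-∘ _ _ j) (≡.trans (lift-cong q j) (≡.sym (lift-∘ _ _ j))))
  commute : s 0 ∘ lift (lift (s i′)) ≗ lift (s (suc i′)) ∘ s 0
  commute zero          = ≡.refl
  commute (suc zero)    = ≡.refl
  commute (suc (suc j)) = ≡.refl

codeStep : List ℕ → ℕ → List ℕ
codeStep []       zero    = 1 ∷ []
codeStep []       (suc i) = 0 ∷ codeStep [] i
codeStep (m ∷ ms) i with move m i
... | resize m′ _ _ = m′ ∷ ms
... | pass i′ _     = m ∷ codeStep ms i′

fromCode-codeStep : ∀ c i → fromCode (codeStep c i) ≗ fromCode c ∘ s i
fromCode-codeStep []       zero    zero          = ≡.refl
fromCode-codeStep []       zero    (suc zero)    = ≡.refl
fromCode-codeStep []       zero    (suc (suc j)) = ≡.refl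
fromCode-codeStep []       (suc i) zero    = ≡.refl
fromCode-codeStep []       (suc i) (suc j) = ≡.cong suc (fromCode-codeStep [] i j)
fromCode-codeStep (m ∷ ms) i j with move m i
... | resize m′ _ q = ≡.cong (lift (fromCode ms)) (≡.sym (q j))
... | pass i′ q     = ≡.trans (lift-cong (fromCode-codeStep ms i′) _)
  (≡.trans (≡.sym (lift-∘ _ _ (cycle m j))) (≡.cong (lift (fromCode ms)) (≡.sym (q j))))

sum-codeStep : ∀ c i → sum (codeStep c i) ≤ suc (sum c)
sum-codeStep []       zero    = ℕₚ.≤-refl
sum-codeStep []       (suc i) = sum-codeStep [] i
sum-codeStep (m ∷ ms) i with move m i
... | resize m′ b _ = ℕₚ.+-monoˡ-≤ (sum ms) b
... | pass i′ _     = ℕₚ.≤-trans (ℕₚ.+-monoʳ-≤ m (sum-codeStep ms i′)) (ℕₚ.≤-reflexive (ℕₚ.+-suc m (sum ms)))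

fromCode-foldl : ∀ v c → fromCode (foldl codeStep c v) ≗ fromCode c ∘ perm v
fromCode-foldl []      c j = ≡.refl
fromCode-foldl (i ∷ v) c j = ≡.trans (fromCode-foldl v (codeStep c i) j) (fromCode-codeStep c i (perm v j))

sum-foldl : ∀ v c → sum (foldl codeStep c v) ≤ length v ℕ.+ sum c
sum-foldl []      c = ℕₚ.≤-refl
sum-foldl (i ∷ v) c = ℕₚ.≤-trans (sum-foldl v (codeStep c i))
  (ℕₚ.≤-trans (ℕₚ.+-monoʳ-≤ (length v) (sum-codeStep c i)) (ℕₚ.≤-reflexive (ℕₚ.+-suc (length v) (sum c))))

cycle-zero : ∀ m → cycle m m ≡ 0
cycle-zero zero    = ≡.refl
cycle-zero (suc m) rewrite cycle-zero m = ≡.refl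

cycle-zero⁻ : ∀ m j → cycle m j ≡ 0 → j ≡ m
cycle-zero⁻ zero    j       q = q
cycle-zero⁻ (suc m) zero    ()
cycle-zero⁻ (suc m) (suc j) q with cycle m j in eq
... | zero = ≡.cong suc (cycle-zero⁻ m j eq)

lift-zero⁻ : ∀ g j → lift g j ≡ 0 → j ≡ 0
lift-zero⁻ g zero _ = ≡.refl

cycle-surjective : ∀ m j → ∃[ i ] cycle m i ≡ j
cycle-surjective zero    j = j , ≡.refl
cycle-surjective (suc m) zero with cycle-surjective m 0
... | i , q = suc i , ≡.cong (s 0 ∘ suc) q
cycle-surjective (suc m) (suc zero) = 0 , ≡.refl
cycle-surjective (suc m) (suc (suc j)) with cycle-surjective m (suc j)
... | i , q = suc i , ≡.cong (s 0 ∘ suc) q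

fromCode-∷-injective : ∀ {m m′} g g′ → lift g ∘ cycle m ≗ lift g′ ∘ cycle m′ → m ≡ m′ × g ≗ g′
fromCode-∷-injective {m} {m′} g g′ q with
  cycle-zero⁻ m′ m (lift-zero⁻ g′ _ (≡.trans (≡.sym (q m)) (≡.cong (lift g) (cycle-zero m))))
... | ≡.refl = ≡.refl , λ j → let i , p = cycle-surjective m (suc j) in
  ℕₚ.suc-injective (≡.trans (≡.sym (≡.cong (lift g) p)) (≡.trans (q i) (≡.cong (lift g′) p)))

lift-id : id ≗ lift id
lift-id zero    = ≡.refl
lift-id (suc j) = ≡.refl

sum-unique : ∀ c c′ → fromCode c ≗ fromCode c′ → sum c ≡ sum c′
sum-unique []       []         q = ≡.refl
sum-unique []       (m ∷ ms)   q with fromCode-∷-injective {0} {m} id (fromCode ms) (λ j → ≡.trans (≡.sym (lift-id j)) (q j))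
... | ≡.refl , q′ = sum-unique [] ms q′
sum-unique (m ∷ ms) []         q with fromCode-∷-injective {0} {m} id (fromCode ms) (λ j → ≡.trans (≡.sym (lift-id j)) (≡.sym (q j)))
... | ≡.refl , q′ = sum-unique ms [] (λ j → ≡.sym (q′ j))
sum-unique (m ∷ ms) (m′ ∷ ms′) q with fromCode-∷-injective {m} {m′} (fromCode ms) (fromCode ms′) q
... | ≡.refl , q′ = ≡.cong (m ℕ.+_) (sum-unique ms ms′ q′)

codeWord-reduced : ∀ c → IsReducedExpression (codeWord c) (perm (codeWord c))
codeWord-reduced c = (λ _ → ≡.refl) , λ v q → ≡.subst₂ _≤_
  (≡.trans (sum-unique (foldl codeStep [] v) c (λ j → ≡.trans (fromCode-foldl v [] j) (≡.trans (q j) (perm-codeWord c j))))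
           (≡.sym (length-codeWord c)))
  (ℕₚ.+-identityʳ (length v))
  (sum-foldl v [])

flagCode : ∀ {r} → (Fin r → ℕ) → List ℕ
flagCode f = tabulate (λ i → f i ∸ suc (toℕ i))

flagWord-codeWord : ∀ {r} (f : Fin r → ℕ) → flagWord f ≡ codeWord (flagCode f)
flagWord-codeWord {zero}  f = ≡.refl
flagWord-codeWord {suc r} f = begin
  concatMap (flagFactor f) (reverse (Fin.zero ∷ tabulate Fin.suc))
    ≡⟨ ≡.cong (concatMap (flagFactor f)) (unfold-reverse Fin.zero (tabulate Fin.suc)) ⟩
  concatMap (flagFactor f) (reverse (tabulate Fin.suc) ∷ʳ Fin.zero)
    ≡⟨ concatMap-++ (flagFactor f) (reverse (tabulate Fin.suc)) (Fin.zero ∷ []) ⟩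
  concatMap (flagFactor f) (reverse (tabulate Fin.suc)) ++ (flagFactor f Fin.zero ++ [])
    ≡⟨ ≡.cong₂ _++_ rest (≡.trans (++-identityʳ _) (map-id _)) ⟩
  map suc (codeWord (tabulate (λ i → f (Fin.suc i) ∸ suc (suc (toℕ i))))) ++ upTo (f Fin.zero ∸ 1) ∎
  where
  open ≡.≡-Reasoning
  f′ : Fin r → ℕ
  f′ i = f (Fin.suc i) ∸ 1
  shifted : ∀ i → f (Fin.suc i) ∸ suc (suc (toℕ i)) ≡ f′ i ∸ suc (toℕ i)
  shifted i = ≡.sym (ℕₚ.∸-+-assoc (f (Fin.suc i)) 1 (suc (toℕ i)))
  rest : concatMap (flagFactor f) (reverse (tabulate Fin.suc)) ≡
         map suc (codeWord (tabulate (λ i → f (Fin.suc i) ∸ suc (suc (toℕ i)))))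
  rest = begin
    concatMap (flagFactor f) (reverse (tabulate Fin.suc))
      ≡⟨ ≡.cong (concatMap (flagFactor f) ∘ reverse) (map-tabulate id Fin.suc) ⟨
    concatMap (flagFactor f) (reverse (map Fin.suc (allFin r)))
      ≡⟨ ≡.cong (concatMap (flagFactor f)) (reverse-map Fin.suc (allFin r)) ⟨
    concatMap (flagFactor f) (map Fin.suc (reverse (allFin r)))
      ≡⟨ concatMap-map (flagFactor f) Fin.suc (reverse (allFin r)) ⟩
    concatMap (flagFactor f ∘ Fin.suc) (reverse (allFin r))
      ≡⟨ concatMap-cong (λ i → ≡.trans (≡.cong (map ((suc (toℕ i)) ℕ.+_) ∘ upTo) (shifted i)) (map-∘ {g = suc} {f = toℕ i ℕ.+_} (upTo (f′ i ∸ suc (toℕ i))))) (reverse (allFin r)) ⟩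
    concatMap (map suc ∘ flagFactor f′) (reverse (allFin r))
      ≡⟨ map-concatMap suc (flagFactor f′) (reverse (allFin r)) ⟨
    map suc (flagWord f′)
      ≡⟨ ≡.cong (map suc) (flagWord-codeWord f′) ⟩
    map suc (codeWord (flagCode f′))
      ≡⟨ ≡.cong (map suc ∘ codeWord) (tabulate-cong shifted) ⟨
    map suc (codeWord (tabulate (λ i → f (Fin.suc i) ∸ suc (suc (toℕ i))))) ∎

-- Counts of set-valued tableaux

nth : List ℕ → ℕ → ℕ
nth u zero    = hd u
nth u (suc k) = nth (tl u) k

Row : ℕ → ℕ → Set
Row n m = Fin n → Subset m

zero∈ : ∀ {m} {A : Subset (suc m)} → Fin.zero ∈ A → head A ≡ true
zero∈ here = ≡.refl

∈zero : ∀ {m} {A : Subset (suc m)} → head A ≡ true → Fin.zero ∈ A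
∈zero {A = true ∷ A} ≡.refl = here

suc∈ : ∀ {m k} {A : Subset (suc m)} → Fin.suc k ∈ A → k ∈ tail A
suc∈ (there k∈) = k∈

∈suc : ∀ {m k} {A : Subset (suc m)} → k ∈ tail A → Fin.suc k ∈ A
∈suc {A = _ ∷ A} k∈ = there k∈

-- The first position from a on at which B fails, or n if there is none.
next : ∀ {n} → ℕ → (Fin n → Bool) → ℕ
next {zero}  a       B = a
next {suc n} (suc a) B = suc (next a (B ∘ Fin.suc))
next {suc n} zero    B = if B Fin.zero then suc (next 0 (B ∘ Fin.suc)) else 0

next-≥ : ∀ {n} a (B : Fin n → Bool) → a ≤ next a B
next-≥ {zero}  a       B = ℕₚ.≤-refl
next-≥ {suc n} zero    B = z≤n
next-≥ {suc n} (suc a) B = s≤s (next-≥ a (B ∘ Fin.suc))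

next-≤ : ∀ {n} a (B : Fin n → Bool) → a ≤ n → next a B ≤ n
next-≤ {zero}  a       B a≤n       = a≤n
next-≤ {suc n} (suc a) B (s≤s a≤n) = s≤s (next-≤ a (B ∘ Fin.suc) a≤n)
next-≤ {suc n} zero    B _ with B Fin.zero
... | true  = s≤s (next-≤ 0 (B ∘ Fin.suc) z≤n)
... | false = z≤n

next-run : ∀ {n} a (B : Fin n → Bool) j → a ≤ toℕ j → toℕ j < next a B → B j ≡ true
next-run {suc n} (suc a) B (Fin.suc j) (s≤s a≤j) (s≤s j<c) = next-run a (B ∘ Fin.suc) j a≤j j<c
next-run {suc n} zero    B j           _         j<c with B Fin.zero in eq
next-run {suc n} zero    B Fin.zero    _         j<c       | true = eq
next-run {suc n} zero    B (Fin.suc j) _         (s≤s j<c) | true = next-run 0 (B ∘ Fin.suc) j z≤n j<c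

next-stop : ∀ {n} a (B : Fin n → Bool) j → toℕ j ≡ next a B → B j ≡ false
next-stop {suc n} (suc a) B (Fin.suc j) q = next-stop a (B ∘ Fin.suc) j (ℕₚ.suc-injective q)
next-stop {suc n} zero    B j           q with B Fin.zero in eq
next-stop {suc n} zero    B Fin.zero    q | false = eq
next-stop {suc n} zero    B (Fin.suc j) q | true  = next-stop 0 (B ∘ Fin.suc) j (ℕₚ.suc-injective q)

next-cong : ∀ {n} a {B B′ : Fin n → Bool} → B ≗ B′ → next a B ≡ next a B′
next-cong {zero}  a       q = ≡.refl
next-cong {suc n} (suc a) q = ≡.cong suc (next-cong a (q ∘ Fin.suc))
next-cong {suc n} zero    q rewrite q Fin.zero | next-cong 0 (q ∘ Fin.suc) = ≡.refl

-- The boxes j < a of the row already contain smaller letters, which are not recorded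
-- in R, and u gives the counts of the row below.
record Valid {n m} (a : ℕ) (u : List ℕ) (R : Row n m) : Set where
  constructor valid
  field
    nonempty : ∀ j → a ≤ toℕ j → Nonempty (R j)
    closed   : ∀ j k → k ∈ R j → a ≤ suc (toℕ j)
    weak     : ∀ j j′ → toℕ j′ ≡ suc (toℕ j) → ∀ k l → k ∈ R j → l ∈ R j′ → toℕ k ≤ toℕ l
    column   : ∀ j k → k ∈ R j → nth u (toℕ k) ≤ toℕ j

valid? : ∀ {n m} a u (R : Row n m) → Dec (Valid a u R)
valid? a u R = map′ (λ (p , q , r , s) → valid p q r s) (λ (valid p q r s) → p , q , r , s)
  ((Finₚ.all? λ j → (a ≤? toℕ j) →-dec nonempty? (R j)) ×-dec
   (Finₚ.all? λ j → Finₚ.all? λ k → (k ∈? R j) →-dec (a ≤? suc (toℕ j))) ×-dec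
   (Finₚ.all? λ j → Finₚ.all? λ j′ → (toℕ j′ ≟ suc (toℕ j)) →-dec (Finₚ.all? λ k → Finₚ.all? λ l →
     (k ∈? R j) →-dec ((l ∈? R j′) →-dec (toℕ k ≤? toℕ l)))) ×-dec
   (Finₚ.all? λ j → Finₚ.all? λ k → (k ∈? R j) →-dec (nth u (toℕ k) ≤? toℕ j)))

Valid-resp : ∀ {n m a u} {R R′ : Row n m} → R ≗ R′ → Valid a u R → Valid a u R′
Valid-resp q (valid ne cl wk co) = valid
  (λ j a≤j → ≡.subst Nonempty (q j) (ne j a≤j))
  (λ j k k∈ → cl j k (back j k∈))
  (λ j j′ s k l k∈ l∈ → wk j j′ s k l (back j k∈) (back j′ l∈))
  (λ j k k∈ → co j k (back j k∈))
  where
  back : ∀ j {k} → k ∈ _ → k ∈ _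
  back j {k} = ≡.subst (k ∈_) (≡.sym (q j))

LetterOK : ∀ {n} → ℕ → ℕ → (Fin n → Bool) → Set
LetterOK a u B = ∀ j → B j ≡ true → a ≤ suc (toℕ j) × u ≤ toℕ j × toℕ j < next a B

letterOK? : ∀ {n} a u (B : Fin n → Bool) → Dec (LetterOK a u B)
letterOK? a u B = Finₚ.all? λ j → (B j Boolₚ.≟ true) →-dec
  ((a ≤? suc (toℕ j)) ×-dec (u ≤? toℕ j) ×-dec (toℕ j <? next a B))

module _ {n m a : ℕ} {u : List ℕ} {R : Row n (suc m)} (a≤n : a ≤ n) where

  private
    B : Fin n → Bool
    B = head ∘ R
    c : ℕ
    c = next a B

  Valid-uncons : Valid a u R → LetterOK a (hd u) B × Valid c (tl u) (tail ∘ R)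
  Valid-uncons (valid ne cl wk co) = ok , valid ne′ cl′
    (λ j j′ s k l k∈ l∈ → ℕ.s≤s⁻¹ (wk j j′ s _ _ (∈suc k∈) (∈suc l∈)))
    (λ j k k∈ → co j _ (∈suc k∈))
    where
    down : ∀ d i j → a ≤ toℕ i → toℕ j ≡ d ℕ.+ toℕ i → B j ≡ true → B i ≡ true
    down zero    i j a≤i q t = ≡.subst (λ j → B j ≡ true) (Finₚ.toℕ-injective q) t
    down (suc d) i j a≤i q t = down d i j′ a≤i (Finₚ.toℕ-fromℕ< j′<n) t′
      where
      j′<n : d ℕ.+ toℕ i < n
      j′<n = ℕₚ.<-trans (ℕₚ.≤-reflexive (≡.sym q)) (Finₚ.toℕ<n j)
      j′ : Fin n
      j′ = fromℕ< j′<n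
      t′ : B j′ ≡ true
      t′ with ne j′ (ℕₚ.≤-trans a≤i (ℕₚ.≤-trans (ℕₚ.m≤n+m (toℕ i) d) (ℕₚ.≤-reflexive (≡.sym (Finₚ.toℕ-fromℕ< j′<n)))))
      ... | Fin.zero  , k∈ = zero∈ k∈
      ... | Fin.suc k , k∈ = contradiction
        (wk j′ j (≡.trans q (≡.cong suc (≡.sym (Finₚ.toℕ-fromℕ< j′<n)))) _ _ k∈ (∈zero t)) λ ()
    ok : LetterOK a (hd u) B
    ok j t = cl j _ (∈zero t) , co j _ (∈zero t) , ℕₚ.≰⇒> λ c≤j →
      let c<n = ℕₚ.≤-<-trans c≤j (Finₚ.toℕ<n j)
          i   = fromℕ< c<n
          i≡c = Finₚ.toℕ-fromℕ< c<n
      in contradiction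
        (≡.trans (≡.sym (next-stop a B i i≡c))
          (down (toℕ j ∸ c) i j (≡.subst (a ≤_) (≡.sym i≡c) (next-≥ a B))
            (≡.trans (≡.sym (ℕₚ.m∸n+n≡m c≤j)) (≡.cong (toℕ j ∸ c ℕ.+_) (≡.sym i≡c))) t)) λ ()
    ne′ : ∀ j → c ≤ toℕ j → Nonempty (tail (R j))
    ne′ j c≤j with ne j (ℕₚ.≤-trans (next-≥ a B) c≤j)
    ... | Fin.zero  , k∈ = contradiction c≤j (ℕₚ.<⇒≱ (proj₂ (proj₂ (ok j (zero∈ k∈)))))
    ... | Fin.suc k , k∈ = k , suc∈ k∈
    cl′ : ∀ j k → k ∈ tail (R j) → c ≤ suc (toℕ j)
    cl′ j k k∈ = ℕₚ.≮⇒≥ λ sj<c →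
      let sj<n = ℕₚ.<-≤-trans sj<c (next-≤ a B a≤n)
          j′   = fromℕ< sj<n
          q    = Finₚ.toℕ-fromℕ< sj<n
      in contradiction
        (wk j j′ q _ _ (∈suc k∈) (∈zero (next-run a B j′
          (ℕₚ.≤-trans (cl j _ (∈suc k∈)) (ℕₚ.≤-reflexive (≡.sym q)))
          (≡.subst (_< c) (≡.sym q) sj<c)))) λ ()

  Valid-cons : LetterOK a (hd u) B → Valid c (tl u) (tail ∘ R) → Valid a u R
  Valid-cons ok (valid ne cl wk co) = valid ne′ cl′ wk′ co′
    where
    ne′ : ∀ j → a ≤ toℕ j → Nonempty (R j)
    ne′ j a≤j with toℕ j <? c
    ... | yes j<c = Fin.zero , ∈zero (next-run a B j a≤j j<c)
    ... | no j≮c  = let k , k∈ = ne j (ℕₚ.≮⇒≥ j≮c) in Fin.suc k , ∈suc k∈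
    cl′ : ∀ j k → k ∈ R j → a ≤ suc (toℕ j)
    cl′ j Fin.zero    k∈ = proj₁ (ok j (zero∈ k∈))
    cl′ j (Fin.suc k) k∈ = ℕₚ.≤-trans (next-≥ a B) (cl j k (suc∈ k∈))
    wk′ : ∀ j j′ → toℕ j′ ≡ suc (toℕ j) → ∀ k l → k ∈ R j → l ∈ R j′ → toℕ k ≤ toℕ l
    wk′ j j′ s Fin.zero    l           k∈ l∈ = z≤n
    wk′ j j′ s (Fin.suc k) (Fin.suc l) k∈ l∈ = s≤s (wk j j′ s k l (suc∈ k∈) (suc∈ l∈))
    wk′ j j′ s (Fin.suc k) Fin.zero    k∈ l∈ = contradiction (cl j k (suc∈ k∈))
      (ℕₚ.<⇒≱ (≡.subst (_< c) s (proj₂ (proj₂ (ok j′ (zero∈ l∈))))))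
    co′ : ∀ j k → k ∈ R j → nth u (toℕ k) ≤ toℕ j
    co′ j Fin.zero    k∈ = proj₁ (proj₂ (ok j (zero∈ k∈)))
    co′ j (Fin.suc k) k∈ = co j k (suc∈ k∈)

-- The k-th count of a row is the number of its boxes with an entry at most k.
profile : ∀ {n m} → ℕ → Row n m → List ℕ
profile {m = zero}  a R = []
profile {m = suc m} a R = next a (head ∘ R) ∷ profile (next a (head ∘ R)) (tail ∘ R)

profile-cong : ∀ {n m} a {R R′ : Row n m} → R ≗ R′ → profile a R ≡ profile a R′
profile-cong {m = zero}  a q = ≡.refl
profile-cong {m = suc m} a {R} {R′} q rewrite next-cong a {head ∘ R} {head ∘ R′} (≡.cong head ∘ q) =
  ≡.cong (next a (head ∘ R′) ∷_) (profile-cong (next a (head ∘ R′)) (≡.cong tail ∘ q))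

profile-≤ : ∀ {n m} a (R : Row n m) k → a ≤ n → nth (profile a R) k ≤ n
profile-≤ {m = zero}  a R zero    a≤n = z≤n
profile-≤ {m = zero}  a R (suc k) a≤n = profile-≤ {m = zero} a R k a≤n
profile-≤ {m = suc m} a R zero    a≤n = next-≤ a (head ∘ R) a≤n
profile-≤ {m = suc m} a R (suc k) a≤n = profile-≤ (next a (head ∘ R)) (tail ∘ R) k (next-≤ a (head ∘ R) a≤n)

profile-≤⇒ : ∀ {n m a u} {R : Row n m} → a ≤ n → Valid a u R → ∀ j k → k < m →
  nth (profile a R) k ≤ toℕ j → a ≤ toℕ j × (∀ l → l ∈ R j → k < toℕ l)
profile-≤⇒ {m = suc m} {a} {u} {R} a≤n V j k k<m q with Valid-uncons a≤n V
profile-≤⇒ {m = suc m} {a} {u} {R} a≤n V j zero k<m q | ok , V′ =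
  ℕₚ.≤-trans (next-≥ a (head ∘ R)) q , λ where
    Fin.zero    l∈ → contradiction q (ℕₚ.<⇒≱ (proj₂ (proj₂ (ok j (zero∈ l∈)))))
    (Fin.suc l) l∈ → s≤s z≤n
profile-≤⇒ {m = suc m} {a} {u} {R} a≤n V j (suc k) (s≤s k<m) q | ok , V′
  with profile-≤⇒ (next-≤ a (head ∘ R) a≤n) V′ j k k<m q
... | c≤j , k< = ℕₚ.≤-trans (next-≥ a (head ∘ R)) c≤j , λ where
    Fin.zero    l∈ → contradiction c≤j (ℕₚ.<⇒≱ (proj₂ (proj₂ (ok j (zero∈ l∈)))))
    (Fin.suc l) l∈ → s≤s (k< l (suc∈ l∈))

profile-≤⇐ : ∀ {n m} a (R : Row n m) j k →
  a ≤ toℕ j → (∀ l → l ∈ R j → k < toℕ l) → nth (profile a R) k ≤ toℕ j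
profile-≤⇐ {m = zero}  a R j zero    a≤j k< = z≤n
profile-≤⇐ {m = zero}  a R j (suc k) a≤j k< = profile-≤⇐ {m = zero} a R j k a≤j (λ l l∈ → ℕₚ.<-trans (ℕₚ.n<1+n k) (k< l l∈))
profile-≤⇐ {m = suc m} a R j k a≤j k< = go k k<
  where
  c≤j : next a (head ∘ R) ≤ toℕ j
  c≤j = ℕₚ.≮⇒≥ λ j<c → ℕₚ.n≮0 (k< Fin.zero (∈zero (next-run a (head ∘ R) j a≤j j<c)))
  go : ∀ k → (∀ l → l ∈ R j → k < toℕ l) → nth (profile a R) k ≤ toℕ j
  go zero    k< = c≤j
  go (suc k) k< = profile-≤⇐ _ (tail ∘ R) j k c≤j (λ l l∈ → ℕ.s≤s⁻¹ (k< _ (∈suc l∈)))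

max-exists : ∀ {n} {A : Subset n} → Nonempty A → ∃[ k ] IsMax A k
max-exists {suc n} {a ∷ A} (k , k∈) with nonempty? A
max-exists {suc n} {a ∷ A} (k , k∈) | yes ne with max-exists ne
... | m , m∈ , m≥ = Fin.suc m , there m∈ , λ where
  Fin.zero    _          → z≤n
  (Fin.suc l) (there l∈) → s≤s (m≥ l l∈)
max-exists {suc n} {a ∷ A} (Fin.zero  , k∈)       | no ∅ = Fin.zero , k∈ , λ where
  Fin.zero    _          → z≤n
  (Fin.suc l) (there l∈) → contradiction (l , l∈) ∅
max-exists {suc n} {a ∷ A} (Fin.suc k , there k∈) | no ∅ = contradiction (k , k∈) ∅

min-exists : ∀ {n} {A : Subset n} → Nonempty A → ∃[ k ] IsMin A k
min-exists {suc n} {true  ∷ A} _ = Fin.zero , here , λ _ _ → z≤n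
min-exists {suc n} {false ∷ A} (Fin.suc k , there k∈) with min-exists (k , k∈)
... | m , m∈ , m≤ = Fin.suc m , there m∈ , λ where (Fin.suc l) (there l∈) → s≤s (m≤ l l∈)

nth-[] : ∀ k → nth [] k ≡ 0
nth-[] zero    = ≡.refl
nth-[] (suc k) = nth-[] k

top : ∀ {r} {lam f : Fin r → ℕ} → Filling lam f → List ℕ
top {zero}  T = []
top {suc r} T = profile 0 (T Fin.zero)

module _ {r} {lam f : Fin r → ℕ} {T : Filling lam f} (ok : IsFSVT T) where

  weak-all : ∀ i j j′ → toℕ j′ ≡ suc (toℕ j) → ∀ k l → k ∈ T i j → l ∈ T i j′ → toℕ k ≤ toℕ l
  weak-all i j j′ q k l k∈ l∈ =
    let M , M-max = max-exists (k , k∈)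
        m , m-min = min-exists (l , l∈)
    in ℕₚ.≤-trans (proj₂ M-max k k∈) (ℕₚ.≤-trans (proj₁ (proj₂ ok) i j j′ q M m M-max m-min) (proj₂ m-min l l∈))

  strict-all : ∀ i i′ j j′ → toℕ i′ ≡ suc (toℕ i) → toℕ j′ ≡ toℕ j →
               ∀ k l → k ∈ T i j → l ∈ T i′ j′ → toℕ k < toℕ l
  strict-all i i′ j j′ p q k l k∈ l∈ =
    let M , M-max = max-exists (k , k∈)
        m , m-min = min-exists (l , l∈)
    in ℕₚ.≤-<-trans (proj₂ M-max k k∈) (ℕₚ.<-≤-trans (proj₂ (proj₂ ok) i i′ j j′ p q M m M-max m-min) (proj₂ m-min l l∈))

IsFSVT-uncons : ∀ {r} {lam f : Fin (suc r) → ℕ} {T : Filling lam f} →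
  IsFSVT T → Valid 0 (top (T ∘ Fin.suc)) (T Fin.zero) × IsFSVT (T ∘ Fin.suc)
IsFSVT-uncons {r} {lam} {f} {T} ok@(ne , wk , st) =
  valid (λ j _ → ne Fin.zero j) (λ _ _ _ → z≤n) (weak-all {T = T} ok Fin.zero) (below T ok) ,
  (λ i → ne (Fin.suc i)) , (λ i → wk (Fin.suc i)) ,
  λ i i′ j j′ p → st (Fin.suc i) (Fin.suc i′) j j′ (≡.cong suc p)
  where
  below : ∀ {r} {lam f : Fin (suc r) → ℕ} (T : Filling lam f) → IsFSVT T →
    ∀ j k → k ∈ T Fin.zero j → nth (top (T ∘ Fin.suc)) (toℕ k) ≤ toℕ j
  below {zero}  T ok j k k∈ rewrite nth-[] (toℕ k) = z≤n
  below {suc r} {lam} T ok j k k∈ with toℕ j <? lam (Fin.suc Fin.zero)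
  ... | no j≮  = ℕₚ.≤-trans (profile-≤ 0 (T (Fin.suc Fin.zero)) (toℕ k) z≤n) (ℕₚ.≮⇒≥ j≮)
  ... | yes j< = ℕₚ.≤-trans (profile-≤⇐ 0 (T (Fin.suc Fin.zero)) (fromℕ< j<) (toℕ k) z≤n
      (λ l l∈ → strict-all {T = T} ok Fin.zero (Fin.suc Fin.zero) j (fromℕ< j<) ≡.refl (Finₚ.toℕ-fromℕ< j<) k l k∈ l∈))
    (ℕₚ.≤-reflexive (Finₚ.toℕ-fromℕ< j<))

IsFSVT-cons : ∀ {r} {lam f : Fin (suc r) → ℕ} {T : Filling lam f} → (∀ i j → i Fin.≤ j → f i ≤ f j) →
  Valid 0 (top (T ∘ Fin.suc)) (T Fin.zero) → IsFSVT (T ∘ Fin.suc) → IsFSVT T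
IsFSVT-cons {r} {lam} {f} {T} inc V ok@(ne , wk , st) = ne′ , wk′ , st′
  where
  open Valid V
  ne′ : BoxesNonempty T
  ne′ Fin.zero    j = nonempty j z≤n
  ne′ (Fin.suc i) j = ne i j
  wk′ : RowsWeak T
  wk′ Fin.zero    j j′ q k l k-max l-min = weak j j′ q k l (proj₁ k-max) (proj₁ l-min)
  wk′ (Fin.suc i) = wk i
  below : ∀ {r} {lam f : Fin (suc (suc r)) → ℕ} {T : Filling lam f} → f Fin.zero ≤ f (Fin.suc Fin.zero) →
    Valid 0 (top (T ∘ Fin.suc)) (T Fin.zero) → IsFSVT (T ∘ Fin.suc) →
    ∀ j j′ → toℕ j′ ≡ toℕ j → ∀ k l → k ∈ T Fin.zero j → l ∈ T (Fin.suc Fin.zero) j′ → toℕ k < toℕ l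
  below {T = T} f≤ V ok j j′ q k l k∈ l∈ = proj₂ (profile-≤⇒ z≤n (proj₁ (IsFSVT-uncons {T = T ∘ Fin.suc} ok)) j′ (toℕ k)
    (ℕₚ.<-≤-trans (Finₚ.toℕ<n k) f≤)
    (ℕₚ.≤-trans (Valid.column V j k k∈) (ℕₚ.≤-reflexive (≡.sym q)))) l l∈
  st′ : ColumnsStrict T
  st′ Fin.zero    (Fin.suc Fin.zero) j j′ p q k l k-max l-min =
    below {T = T} (inc Fin.zero (Fin.suc Fin.zero) z≤n) V ok j j′ q k l (proj₁ k-max) (proj₁ l-min)
  st′ (Fin.suc i) (Fin.suc i′)       j j′ p = st i i′ j j′ (ℕₚ.suc-injective p)

record Counts (m n : ℕ) (u : List ℕ) : Set where
  constructor counts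
  field
    monotone : ∀ i j → i ≤ j → j < m → nth u i ≤ nth u j
    bounded  : ∀ i → i < m → nth u i ≤ n

Counts-tl : ∀ {m n u} → Counts (suc m) n u → Counts m n (tl u)
Counts-tl (counts mo bd) = counts (λ i j i≤j j<m → mo (suc i) (suc j) (s≤s i≤j) (s≤s j<m)) (λ i i<m → bd (suc i) (s≤s i<m))

Counts-mono : ∀ {m m′ n n′ u} → m ≤ m′ → n′ ≤ n → Counts m′ n′ u → Counts m n u
Counts-mono m≤ n≤ (counts mo bd) = counts (λ i j i≤j j<m → mo i j i≤j (ℕₚ.<-≤-trans j<m m≤))
  (λ i i<m → ℕₚ.≤-trans (bd i (ℕₚ.<-≤-trans i<m m≤)) n≤)

Counts-[] : ∀ {m n} → Counts m n []
Counts-[] {m} {n} = counts (λ i j _ _ → ≡.subst₂ _≤_ (≡.sym (nth-[] i)) (≡.sym (nth-[] j)) z≤n)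
  (λ i _ → ≡.subst (_≤ n) (≡.sym (nth-[] i)) z≤n)

module Tableaux {c ℓ} (A : CommutativeSemiring c ℓ) (b : CommutativeSemiring.Carrier A)
                (x : ℕ → CommutativeSemiring.Carrier A) where

  open CommutativeSemiring A
  open import Algebra.Properties.Semiring.Exp semiring using (_^_)
  open import Algebra.Solver.Ring.NaturalCoefficients.Default A
  open import Relation.Binary.Reasoning.Setoid setoid
  open Sums A
  open Weights A b using (e; τ)
  open Patterns A b x

  ind : ∀ {p} {P : Set p} → Dec P → Carrier
  ind d = if does d then 1# else 0#

  ind-⇔ : ∀ {p q} {P : Set p} {Q : Set q} (d : Dec P) (d′ : Dec Q) → (P → Q) → (Q → P) → ind d ≡ ind d′
  ind-⇔ d d′ f g = ≡.cong (if_then 1# else 0#) (does-⇔ (mk⇔ f g) d d′)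

  ind-yes : ∀ {p} {P : Set p} (d : Dec P) → P → ind d ≡ 1#
  ind-yes (yes _) _ = ≡.refl
  ind-yes (no ¬p) p = contradiction p ¬p

  ind-no : ∀ {p} {P : Set p} (d : Dec P) → ¬ P → ind d ≡ 0#
  ind-no (yes p) ¬p = contradiction p ¬p
  ind-no (no _)  _  = ≡.refl

  ind-× : ∀ {p q} {P : Set p} {Q : Set q} (d : Dec P) (d′ : Dec Q) → ind (d ×-dec d′) ≈ ind d * ind d′
  ind-× (yes _) (yes _) = sym (*-identityˡ 1#)
  ind-× (yes _) (no _)  = sym (*-identityˡ 0#)
  ind-× (no _)  d′      = sym (zeroˡ _)

  ind-cong : ∀ {p} {P : Set p} (d : Dec P) {t u} → (P → t ≈ u) → ind d * t ≈ ind d * u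
  ind-cong (yes p) q = *-congˡ (q p)
  ind-cong (no _)  q = trans (zeroˡ _) (sym (zeroˡ _))

  ∑-filter : ∀ {i p} {I : Set i} {P : Pred I p} (P? : Decidable P) L t →
             ∑ (filter P? L) t ≈ ∑[ i ∈ L ] ind (P? i) * t i
  ∑-filter P? []      t = refl
  ∑-filter P? (i ∷ L) t with does (P? i)
  ... | true  = +-cong (sym (*-identityˡ _)) (∑-filter P? L t)
  ... | false = trans (∑-filter P? L t) (sym (trans (+-congʳ (zeroˡ _)) (+-identityˡ _)))

  ∑-sections-suc : ∀ {n} {F : Fin (suc n) → Set} (L : ∀ i → List (F i)) (t : (∀ i → F i) → Carrier) →
    ∑ (sections L) t ≈ ∑[ a ∈ L Fin.zero ] ∑[ T ∈ sections (L ∘ Fin.suc) ] t (∀-cons {P = F} a T)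
  ∑-sections-suc {F = F} L t = ∑-cartesianProductWith (∀-cons {P = F}) (L Fin.zero) (sections (L ∘ Fin.suc)) t

  ∑-functions-suc : ∀ n {X : Set} (L : List X) (t : (Fin (suc n) → X) → Carrier) →
    ∑ (sections {suc n} (λ _ → L)) t ≈
    ∑[ a ∈ L ] ∑[ R ∈ sections {n} (λ _ → L) ] t (∀-cons {P = λ _ → X} a R)
  ∑-functions-suc n {X} L t = ∑-sections-suc {n} {λ _ → X} (λ _ → L) t

  bools : List Bool
  bools = true ∷ false ∷ []

  letters : ∀ n → List (Fin n → Bool)
  letters n = sections {n} (λ _ → bools)

  rows : ∀ n m → List (Row n m)
  rows n m = sections {n} (λ _ → subsets m)

  ∑-letters-suc : ∀ n (t : (Fin (suc n) → Bool) → Carrier) → ∑ (letters (suc n)) t ≈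
    (∑[ B ∈ letters n ] t (∀-cons {P = λ _ → Bool} true B)) + (∑[ B ∈ letters n ] t (∀-cons {P = λ _ → Bool} false B))
  ∑-letters-suc n t = trans (∑-functions-suc n bools t) (+-congˡ (+-identityʳ _))

  Extensional : ∀ {n} {X : Set} → ((Fin n → X) → Carrier) → Set ℓ
  Extensional t = ∀ R R′ → R ≗ R′ → t R ≈ t R′

  ∑-subsets-suc : ∀ m (t : Subset (suc m) → Carrier) →
    ∑ (subsets (suc m)) t ≈ ∑[ a ∈ bools ] ∑[ S ∈ subsets m ] t (a ∷ S)
  ∑-subsets-suc m t = trans (∑-++ (map (true ∷_) (subsets m)) _ t)
    (+-cong (reflexive (∑-map (true ∷_) (subsets m) t))
            (trans (reflexive (∑-map (false ∷_) (subsets m) t)) (sym (+-identityʳ _))))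

  ∑-rows-suc : ∀ n m (t : Row n (suc m) → Carrier) → Extensional t →
    ∑ (rows n (suc m)) t ≈ ∑[ B ∈ letters n ] ∑[ R ∈ rows n m ] t (λ j → B j ∷ R j)
  ∑-rows-suc zero    m t ext = trans (+-congʳ (ext _ _ λ ())) (sym (+-identityʳ _))
  ∑-rows-suc (suc n) m t ext = begin
    ∑ (rows (suc n) (suc m)) t
      ≈⟨ ∑-functions-suc n (subsets (suc m)) t ⟩
    ∑[ S ∈ subsets (suc m) ] ∑[ R ∈ rows n (suc m) ] t (∀-cons {P = λ _ → Subset (suc m)} S R)
      ≈⟨ ∑-subsets-suc m _ ⟩
    ∑[ a ∈ bools ] ∑[ S ∈ subsets m ] ∑[ R ∈ rows n (suc m) ] t (∀-cons {P = λ _ → Subset (suc m)} (a ∷ S) R)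
      ≈⟨ ∑-cong bools (λ a → ∑-cong (subsets m) (λ S →
           ∑-rows-suc n m (λ R → t (∀-cons {P = λ _ → Subset (suc m)} (a ∷ S) R)) (λ _ _ q → ext _ _ (cons q)))) ⟩
    ∑[ a ∈ bools ] ∑[ S ∈ subsets m ] ∑[ B ∈ letters n ] ∑[ R ∈ rows n m ]
      t (∀-cons {P = λ _ → Subset (suc m)} (a ∷ S) (λ j → B j ∷ R j))
      ≈⟨ ∑-cong bools (λ a → trans (∑-comm (subsets m) (letters n) _) (∑-cong (letters n) (λ B →
           ∑-cong (subsets m) (λ S → ∑-cong (rows n m) (λ R → 
             ext (∀-cons {P = λ _ → Subset (suc m)} (a ∷ S) (λ j → B j ∷ R j))
                 (λ j → ∀-cons {P = λ _ → Bool} a B j ∷ ∀-cons {P = λ _ → Subset m} S R j)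
                 (λ { Fin.zero → ≡.refl ; (Fin.suc j) → ≡.refl })))))) ⟩
    ∑[ a ∈ bools ] ∑[ B ∈ letters n ] ∑[ S ∈ subsets m ] ∑[ R ∈ rows n m ]
      t (λ j → ∀-cons {P = λ _ → Bool} a B j ∷ ∀-cons {P = λ _ → Subset m} S R j)
      ≈⟨ ∑-cong bools (λ a → ∑-cong (letters n) (λ B → sym (∑-functions-suc n (subsets m)
           (λ R → t (λ j → ∀-cons {P = λ _ → Bool} a B j ∷ R j))))) ⟩
    ∑[ a ∈ bools ] ∑[ B ∈ letters n ] ∑[ R ∈ rows (suc n) m ] t (λ j → ∀-cons {P = λ _ → Bool} a B j ∷ R j)
      ≈⟨ ∑-functions-suc n bools (λ B → ∑[ R ∈ rows (suc n) m ] t (λ j → B j ∷ R j)) ⟨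
    ∑[ B ∈ letters (suc n) ] ∑[ R ∈ rows (suc n) m ] t (λ j → B j ∷ R j) ∎
    where
    cons : ∀ {S} {R R′ : Row n (suc m)} → R ≗ R′ →
           ∀-cons {P = λ _ → Subset (suc m)} S R ≗ ∀-cons {P = λ _ → Subset (suc m)} S R′
    cons q Fin.zero    = ≡.refl
    cons q (Fin.suc j) = q j

  -- A box that already contains a smaller letter, and one that does not.
  startedBox newBox : ∀ {m} → ℕ → Subset m → Carrier
  startedBox o []          = 1#
  startedBox o (true  ∷ S) = b * x o * startedBox (suc o) S
  startedBox o (false ∷ S) = startedBox (suc o) S
  newBox o []          = 1#
  newBox o (true  ∷ S) = x o * startedBox (suc o) S
  newBox o (false ∷ S) = newBox (suc o) S

  weight : ∀ {n m} → ℕ → ℕ → Row n m → Carrier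
  weight {zero}  o a       R = 1#
  weight {suc n} o zero    R = newBox o (R Fin.zero) * weight o 0 (R ∘ Fin.suc)
  weight {suc n} o (suc a) R = startedBox o (R Fin.zero) * weight o a (R ∘ Fin.suc)

  weight-cong : ∀ {n m} o a {R R′ : Row n m} → R ≗ R′ → weight o a R ≡ weight o a R′
  weight-cong {zero}  o a       q = ≡.refl
  weight-cong {suc n} o zero    q = ≡.cong₂ _*_ (≡.cong (newBox o) (q Fin.zero)) (weight-cong o 0 (q ∘ Fin.suc))
  weight-cong {suc n} o (suc a) q = ≡.cong₂ _*_ (≡.cong (startedBox o) (q Fin.zero)) (weight-cong o a (q ∘ Fin.suc))

  weight-[] : ∀ {n} o a (R : Row n 0) → weight o a R ≈ 1#
  weight-[] {zero}  o a       R = refl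
  weight-[] {suc n} o zero    R with R Fin.zero
  ... | [] = trans (*-identityˡ _) (weight-[] o 0 (R ∘ Fin.suc))
  weight-[] {suc n} o (suc a) R with R Fin.zero
  ... | [] = trans (*-identityˡ _) (weight-[] o a (R ∘ Fin.suc))

  letterWeight : ∀ {n} → Carrier → ℕ → (Fin n → Bool) → Carrier
  letterWeight {zero}  z a       B = 1#
  letterWeight {suc n} z zero    B = (if B Fin.zero then z else 1#) * letterWeight z 0 (B ∘ Fin.suc)
  letterWeight {suc n} z (suc a) B = (if B Fin.zero then b * z else 1#) * letterWeight z a (B ∘ Fin.suc)

  weight-∷ : ∀ {n m} o a u (B : Fin n → Bool) (R : Row n m) → LetterOK a u B →
    weight o a (λ j → B j ∷ R j) ≈ letterWeight (x o) a B * weight (suc o) (next a B) R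
  weight-∷ {zero}  o a       u B R ok = sym (*-identityˡ 1#)
  weight-∷ {suc n} o (suc a) u B R ok with B Fin.zero | weight-∷ o a (ℕ.pred u) (B ∘ Fin.suc) (R ∘ Fin.suc) ok′
    where
    ok′ : LetterOK a (ℕ.pred u) (B ∘ Fin.suc)
    ok′ j t = let p , q , r = ok (Fin.suc j) t in ℕ.s≤s⁻¹ p , ℕₚ.pred-mono-≤ q , ℕ.s≤s⁻¹ r
  ... | true  | ih = trans (*-congˡ ih) (solve 4 (λ u v w y → u :* v :* (w :* y) := u :* w :* (v :* y)) refl _ _ _ _)
  ... | false | ih = trans (*-congˡ ih) (solve 3 (λ v w y → v :* (w :* y) := con 1 :* w :* (v :* y)) refl _ _ _)
  weight-∷ {suc n} o zero    u B R ok with B Fin.zero in eq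
  ... | true  = trans (*-congˡ (weight-∷ o 0 (ℕ.pred u) (B ∘ Fin.suc) (R ∘ Fin.suc) ok′))
                  (solve 4 (λ u v w y → u :* v :* (w :* y) := u :* w :* (v :* y)) refl _ _ _ _)
    where
    ok′ : LetterOK 0 (ℕ.pred u) (B ∘ Fin.suc)
    ok′ j t with ok (Fin.suc j) t
    ... | p , q , r = z≤n , ℕₚ.pred-mono-≤ q , ℕ.s≤s⁻¹ r
  ... | false = trans (*-congˡ (absent o (B ∘ Fin.suc) (R ∘ Fin.suc) none))
                  (solve 3 (λ v w y → v :* (w :* y) := con 1 :* w :* (v :* y)) refl _ _ _)
    where
    none : ∀ j → B (Fin.suc j) ≡ false
    none j with B (Fin.suc j) in t
    ... | false = ≡.refl
    ... | true with ok (Fin.suc j) t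
    ... | p , q , r = contradiction r λ ()
    absent : ∀ {n m} o (B : Fin n → Bool) (R : Row n m) → (∀ j → B j ≡ false) →
      weight o 0 (λ j → B j ∷ R j) ≈ letterWeight (x o) 0 B * weight (suc o) 0 R
    absent {zero}  o B R none = sym (*-identityˡ 1#)
    absent {suc n} o B R none rewrite none Fin.zero =
      trans (*-congˡ (absent o (B ∘ Fin.suc) (R ∘ Fin.suc) (none ∘ Fin.suc)))
        (solve 3 (λ v w y → v :* (w :* y) := con 1 :* w :* (v :* y)) refl _ _ _)

  private
    cons : ∀ {n} → Bool → (Fin n → Bool) → Fin (suc n) → Bool
    cons = ∀-cons {P = λ _ → Bool}

  LetterOK-tail : ∀ {n a u c} {B : Fin n → Bool} → LetterOK (suc a) u (cons c B) → LetterOK a (ℕ.pred u) B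
  LetterOK-tail ok j t = let p , q , r = ok (Fin.suc j) t in ℕ.s≤s⁻¹ p , ℕₚ.pred-mono-≤ q , ℕ.s≤s⁻¹ r

  pred-≤ : ∀ u {j} → ℕ.pred u ≤ j → u ≤ suc j
  pred-≤ zero    _ = z≤n
  pred-≤ (suc u) l = s≤s l

  LetterOK-cons : ∀ {n a u c} {B : Fin n → Bool} → (c ≡ true → suc a ≤ 1 × u ≤ 0) →
    LetterOK a (ℕ.pred u) B → LetterOK (suc a) u (cons c B)
  LetterOK-cons q ok Fin.zero    t = proj₁ (q t) , proj₂ (q t) , s≤s z≤n
  LetterOK-cons {u = u} q ok (Fin.suc j) t = let p , q , r = ok j t in s≤s p , pred-≤ u q , s≤s r

  LetterOK-true⁻ : ∀ {n u} {B : Fin n → Bool} → LetterOK 0 u (cons true B) → LetterOK 0 (ℕ.pred u) B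
  LetterOK-true⁻ ok j t = let p , q , r = ok (Fin.suc j) t in z≤n , ℕₚ.pred-mono-≤ q , ℕ.s≤s⁻¹ r

  LetterOK-true : ∀ {n} {B : Fin n → Bool} → LetterOK 0 0 B → LetterOK 0 0 (cons true B)
  LetterOK-true ok Fin.zero    t = z≤n , z≤n , s≤s z≤n
  LetterOK-true ok (Fin.suc j) t = let p , q , r = ok j t in z≤n , z≤n , s≤s r

  ∑-absent : ∀ n z → ∑[ B ∈ letters n ] ind (letterOK? 0 0 (cons false B)) * letterWeight z 0 B ≈ 1#
  ∑-absent zero    z = trans (∑-cong (letters 0) {u = λ _ → 1#} (λ B → trans (*-identityʳ _)
    (reflexive (ind-yes (letterOK? {1} 0 0 (cons false B)) λ { Fin.zero () })))) (+-identityʳ 1#)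
  ∑-absent (suc n) z = begin
    ∑[ B ∈ letters (suc n) ] ind (letterOK? 0 0 (cons false B)) * letterWeight z 0 B
      ≈⟨ ∑-letters-suc n _ ⟩
    (∑[ B ∈ letters n ] ind (letterOK? 0 0 (cons false (cons true B))) * (z * letterWeight z 0 B)) +
    (∑[ B ∈ letters n ] ind (letterOK? 0 0 (cons false (cons false B))) * (1# * letterWeight z 0 B))
      ≈⟨ +-cong (∑-zero (letters n) (λ {B} _ → trans (*-congʳ (reflexive (ind-no (letterOK? 0 0 (cons false (cons true B)))
                  (λ ok → contradiction (proj₂ (proj₂ (ok (Fin.suc Fin.zero) ≡.refl))) λ ())))) (zeroˡ _)))
                (∑-cong (letters n) (λ B → *-cong (reflexive (ind-⇔ (letterOK? 0 0 (cons false (cons false B))) (letterOK? 0 0 (cons false B)) drop₁ add₁))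
                  (*-identityˡ _))) ⟩
    0# + (∑[ B ∈ letters n ] ind (letterOK? 0 0 (cons false B)) * letterWeight z 0 B)
      ≈⟨ trans (+-identityˡ _) (∑-absent n z) ⟩
    1# ∎
    where
    drop₁ : ∀ {B : Fin n → Bool} → LetterOK 0 0 (cons false (cons false B)) → LetterOK 0 0 (cons false B)
    drop₁ ok (Fin.suc j) t = contradiction (proj₂ (proj₂ (ok (Fin.suc (Fin.suc j)) t))) λ ()
    add₁ : ∀ {B : Fin n → Bool} → LetterOK 0 0 (cons false B) → LetterOK 0 0 (cons false (cons false B))
    add₁ ok (Fin.suc (Fin.suc j)) t = contradiction (proj₂ (proj₂ (ok (Fin.suc j) t))) λ ()

  letterSum : ∀ n z a u (F : ℕ → Carrier) → u ≤ a → a ≤ n →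
    ∑[ B ∈ letters n ] ind (letterOK? a u B) * (letterWeight z a B * F (next a B)) ≈
    ∑[ p ∈ upTo (suc n) ] e z a p * (τ z a u * F p)
  letterSum zero    z zero zero F _ _ = ∑-cong (letters 0) {u = λ _ → 1# * (1# * F 0)}
    (λ B → *-congʳ (reflexive (ind-yes (letterOK? {0} 0 0 B) λ ())))
  letterSum (suc n) z (suc (suc a)) u F u≤a (s≤s a≤n) = begin
    ∑ (letters (suc n)) t
      ≈⟨ ∑-letters-suc n t ⟩
    ∑ (letters n) (t ∘ cons true) + ∑ (letters n) (t ∘ cons false)
      ≈⟨ +-cong (∑-zero (letters n) (λ {B} _ → trans (*-congʳ (reflexive (ind-no (letterOK? (suc (suc a)) u (cons true B))
                   (λ ok → contradiction (proj₁ (ok Fin.zero ≡.refl)) λ { (s≤s ()) })))) (zeroˡ _)))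
                (∑-cong (letters n) (λ B → *-cong
                   (reflexive (ind-⇔ (letterOK? (suc (suc a)) u (cons false B)) (letterOK? (suc a) (ℕ.pred u) B)
                     LetterOK-tail (LetterOK-cons λ ())))
                   (*-congʳ (*-identityˡ _)))) ⟩
    0# + (∑[ B ∈ letters n ] ind (letterOK? (suc a) (ℕ.pred u) B) * (letterWeight z (suc a) B * F (suc (next (suc a) B))))
      ≈⟨ +-congˡ (letterSum n z (suc a) (ℕ.pred u) (F ∘ suc) (ℕₚ.pred-mono-≤ u≤a) a≤n) ⟩
    0# + (∑[ p ∈ upTo (suc n) ] e z (suc a) p * (τ z (suc a) (ℕ.pred u) * F (suc p)))
      ≈⟨ +-cong (sym (zeroˡ _)) (∑-cong (upTo (suc n)) (λ p → *-congˡ (*-congʳ (reflexive (τ-pred u))))) ⟩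
    0# * (τ z (suc (suc a)) u * F 0) + (∑[ p ∈ upTo (suc n) ] e z (suc a) p * (τ z (suc (suc a)) u * F (suc p)))
      ≈⟨ upTo-suc (suc n) _ ⟨
    ∑[ p ∈ upTo (suc (suc n)) ] e z (suc (suc a)) p * (τ z (suc (suc a)) u * F p) ∎
    where
    t : (Fin (suc n) → Bool) → Carrier
    t B = ind (letterOK? (suc (suc a)) u B) * (letterWeight z (suc (suc a)) B * F (next (suc (suc a)) B))
    τ-pred : ∀ u → τ z (suc a) (ℕ.pred u) ≡ τ z (suc (suc a)) u
    τ-pred zero    = ≡.refl
    τ-pred (suc u) = ≡.refl
  letterSum (suc n) z (suc zero) u F u≤1 _ = begin
    ∑ (letters (suc n)) t
      ≈⟨ ∑-letters-suc n t ⟩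
    ∑ (letters n) (t ∘ cons true) + ∑ (letters n) (t ∘ cons false)
      ≈⟨ +-cong (optional u u≤1) rest ⟩
    o u * I + I
      ≈⟨ trans (+-congˡ (sym (*-identityˡ I))) (trans (sym (distribʳ I (o u) 1#)) (*-congʳ (τ-1 u u≤1))) ⟩
    τ z 1 u * I
      ≈⟨ trans (*-∑ (upTo (suc n)) _ _) (∑-cong (upTo (suc n)) (λ p →
           solve 3 (λ t v w → t :* (v :* (con 1 :* w)) := v :* (t :* w)) refl (τ z 1 u) (z ^ p) (F (suc p)))) ⟩
    ∑[ p ∈ upTo (suc n) ] z ^ p * (τ z 1 u * F (suc p))
      ≈⟨ trans (sym (+-identityˡ _)) (+-congʳ (sym (zeroˡ _))) ⟩
    0# * (τ z 1 u * F 0) + (∑[ p ∈ upTo (suc n) ] z ^ p * (τ z 1 u * F (suc p)))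
      ≈⟨ upTo-suc (suc n) _ ⟨
    ∑[ p ∈ upTo (suc (suc n)) ] e z 1 p * (τ z 1 u * F p) ∎
    where
    t : (Fin (suc n) → Bool) → Carrier
    t B = ind (letterOK? 1 u B) * (letterWeight z 1 B * F (next 1 B))
    I : Carrier
    I = ∑[ p ∈ upTo (suc n) ] z ^ p * (1# * F (suc p))
    J : Carrier
    J = ∑[ B ∈ letters n ] ind (letterOK? 0 0 B) * (letterWeight z 0 B * F (suc (next 0 B)))
    J≈I : J ≈ I
    J≈I = letterSum n z 0 0 (F ∘ suc) z≤n z≤n
    o : ℕ → Carrier
    o zero    = b * z
    o (suc u) = 0#
    τ-1 : ∀ u → u ≤ 1 → o u + 1# ≈ τ z 1 u
    τ-1 zero       _ = +-comm _ _
    τ-1 (suc zero) _ = +-identityˡ _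
    τ-1 (suc (suc u)) (s≤s ())
    rest : ∑ (letters n) (t ∘ cons false) ≈ I
    rest = trans (∑-cong (letters n) (λ B → *-cong
        (reflexive (ind-⇔ (letterOK? 1 u (cons false B)) (letterOK? 0 0 B)
          (λ ok j t → let p , q , r = LetterOK-tail ok j t in p , z≤n , r)
          (λ ok → LetterOK-cons (λ ()) λ j t → let p , q , r = ok j t in p , ℕₚ.≤-trans (ℕₚ.pred-mono-≤ u≤1) z≤n , r)))
        (*-congʳ (*-identityˡ _)))) J≈I
    optional : ∀ u → u ≤ 1 → ∑[ B ∈ letters n ] ind (letterOK? 1 u (cons true B)) * (b * z * letterWeight z 0 B * F (suc (next 0 B))) ≈ o u * I
    optional zero _ = trans (∑-cong (letters n) (λ B → trans (*-congʳ
          (reflexive (ind-⇔ (letterOK? 1 0 (cons true B)) (letterOK? 0 0 B) LetterOK-tail (LetterOK-cons λ _ → s≤s z≤n , z≤n))))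
          (solve 4 (λ i z l f → i :* (z :* l :* f) := z :* (i :* (l :* f))) refl _ (b * z) _ _)))
        (trans (sym (*-∑ (letters n) (b * z) _)) (*-congˡ J≈I))
    optional (suc u) _ = trans (∑-zero (letters n) (λ {B} _ → trans (*-congʳ (reflexive (ind-no (letterOK? 1 (suc u) (cons true B))
          (λ ok → contradiction (proj₁ (proj₂ (ok Fin.zero ≡.refl))) λ ())))) (zeroˡ _))) (sym (zeroˡ I))
  letterSum (suc n) z zero zero F _ _ = begin
    ∑ (letters (suc n)) t
      ≈⟨ ∑-letters-suc n t ⟩
    ∑ (letters n) (t ∘ cons true) + ∑ (letters n) (t ∘ cons false)
      ≈⟨ +-cong
           (∑-cong (letters n) (λ B → trans (*-congʳ
             (reflexive (ind-⇔ (letterOK? 0 0 (cons true B)) (letterOK? 0 0 B) LetterOK-true⁻ LetterOK-true)))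
             (solve 4 (λ i z l f → i :* (z :* l :* f) := z :* (i :* (l :* f))) refl _ z _ _)))
           (∑-cong (letters n) (λ B → solve 3 (λ i l f → i :* (con 1 :* l :* f) := i :* l :* f) refl _ _ (F 0))) ⟩
    (∑[ B ∈ letters n ] z * (ind (letterOK? 0 0 B) * (letterWeight z 0 B * F (suc (next 0 B))))) +
    (∑[ B ∈ letters n ] ind (letterOK? 0 0 (cons false B)) * letterWeight z 0 B * F 0)
      ≈⟨ +-cong
           (trans (sym (*-∑ (letters n) z _)) (trans (*-congˡ (letterSum n z 0 0 (F ∘ suc) z≤n z≤n))
             (trans (*-∑ (upTo (suc n)) z _) (∑-cong (upTo (suc n)) (λ p → sym (*-assoc _ _ _))))))
           (trans (sym (∑-* (letters n) (F 0) _)) (trans (*-congʳ (∑-absent n z)) (sym (*-identityˡ _)))) ⟩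
    (∑[ p ∈ upTo (suc n) ] z ^ suc p * (1# * F (suc p))) + 1# * (1# * F 0)
      ≈⟨ +-comm _ _ ⟩
    1# * (1# * F 0) + (∑[ p ∈ upTo (suc n) ] z ^ suc p * (1# * F (suc p)))
      ≈⟨ upTo-suc (suc n) _ ⟨
    ∑[ p ∈ upTo (suc (suc n)) ] z ^ p * (1# * F p) ∎
    where
    t : (Fin (suc n) → Bool) → Carrier
    t B = ind (letterOK? 0 0 B) * (letterWeight z 0 B * F (next 0 B))

  ∑-rows-0 : ∀ n (t : Row n 0 → Carrier) → Extensional t → ∑ (rows n 0) t ≈ t (λ _ → [])
  ∑-rows-0 zero    t ext = trans (+-identityʳ _) (ext _ _ λ ())
  ∑-rows-0 (suc n) t ext = trans (∑-functions-suc n (subsets 0) t) (trans (+-identityʳ _)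
    (trans (∑-rows-0 n (λ R → t (∀-cons {P = λ _ → Subset 0} [] R)) (λ R R′ q → ext _ _ λ { Fin.zero → ≡.refl ; (Fin.suc j) → q j }))
           (ext _ _ λ { Fin.zero → ≡.refl ; (Fin.suc j) → ≡.refl })))

  δ-refl : ∀ n → δ n n ≡ 1#
  δ-refl zero    = ≡.refl
  δ-refl (suc n) = δ-refl n

  δ-< : ∀ {m n} → m < n → δ m n ≡ 0#
  δ-< {zero}  {suc n} _         = ≡.refl
  δ-< {suc m} {suc n} (s≤s m<n) = δ-< m<n

  ind-empty : ∀ {n} a u → a ≤ n → ind (valid? a u (λ (_ : Fin n) → [])) ≡ δ a n
  ind-empty {n} a u a≤n with ℕₚ.m≤n⇒m<n∨m≡n a≤n
  ... | inj₁ a<n = ≡.trans (ind-no (valid? a u (λ (_ : Fin n) → [])) λ V → no-letter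
    (proj₁ (Valid.nonempty V (fromℕ< a<n) (ℕₚ.≤-reflexive (≡.sym (Finₚ.toℕ-fromℕ< a<n)))))) (≡.sym (δ-< a<n))
    where
    no-letter : ¬ Fin 0
    no-letter ()
  ... | inj₂ ≡.refl = ≡.trans (ind-yes (valid? a u (λ (_ : Fin n) → [])) (valid
    (λ j a≤j → contradiction a≤j (ℕₚ.<⇒≱ (Finₚ.toℕ<n j))) (λ j ()) (λ j j′ q ()) (λ j ()))) (≡.sym (δ-refl n))

  τ-> : ∀ z {a p} → a < p → τ z a p ≡ 0#
  τ-> z {zero}  {suc p} _         = ≡.refl
  τ-> z {suc a} {suc p} (s≤s a<p) = τ-> z a<p

  Valid-≤ : ∀ {n m a u} {R : Row n (suc m)} → Counts (suc m) n u → Valid a u R → hd u ≤ a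
  Valid-≤ {n} {m} {a} {u} (counts mono bd) (valid ne _ _ co) = ℕₚ.≮⇒≥ λ a<u →
    let a<n = ℕₚ.<-≤-trans a<u (bd 0 (s≤s z≤n))
        j   = fromℕ< a<n
        q   = Finₚ.toℕ-fromℕ< a<n
        k , k∈ = ne j (ℕₚ.≤-reflexive (≡.sym q))
    in ℕₚ.<⇒≱ a<u (ℕₚ.≤-trans (mono 0 (toℕ k) z≤n (Finₚ.toℕ<n k)) (ℕₚ.≤-trans (co j k k∈) (ℕₚ.≤-reflexive q)))

  rowTerm : ∀ {n m} → ℕ → ℕ → List ℕ → (List ℕ → Carrier) → Row n m → Carrier
  rowTerm o a u g R = ind (valid? a u R) * (weight o a R * g (profile a R))

  rowTerm-ext : ∀ {n m} o a u g → Extensional (rowTerm {n} {m} o a u g)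
  rowTerm-ext o a u g R R′ q = *-cong
    (reflexive (ind-⇔ (valid? a u R) (valid? a u R′) (Valid-resp q) (Valid-resp (λ j → ≡.sym (q j)))))
    (*-cong (reflexive (weight-cong o a q)) (reflexive (≡.cong g (profile-cong a q))))

  rowSum : ∀ m n o a u (g : List ℕ → Carrier) → Counts m n u → a ≤ n →
    ∑ (rows n m) (rowTerm o a u g) ≈ ∑[ v ∈ tuples n m ] rowWeight o n a v * (columnWeight o a v u * g v)
  rowSum zero n o a u g _ a≤n = begin
    ∑ (rows n 0) (rowTerm o a u g)
      ≈⟨ ∑-rows-0 n (rowTerm o a u g) (rowTerm-ext o a u g) ⟩
    ind (valid? a u (λ (_ : Fin n) → [])) * (weight {n} o a (λ _ → []) * g [])
      ≈⟨ *-cong (reflexive (ind-empty a u a≤n)) (*-congʳ (weight-[] {n} o a (λ _ → []))) ⟩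
    δ a n * (1# * g [])
      ≈⟨ +-identityʳ _ ⟨
    δ a n * (1# * g []) + 0# ∎
  rowSum (suc m) n o a u g C a≤n with hd u ≤? a
  ... | no u≰a = trans
    (∑-zero (rows n (suc m)) (λ {R} _ → trans (*-congʳ (reflexive (ind-no (valid? a u R) (λ V → u≰a (Valid-≤ C V))))) (zeroˡ _)))
    (sym (trans (∑-tuples-suc n m _) (∑-zero (upTo (suc n)) (λ {p} _ → ∑-zero (tuples n m) (λ {v} _ →
      trans (*-congˡ (trans (*-congʳ (trans (*-congʳ (reflexive (τ-> (x o) (ℕₚ.≰⇒> u≰a)))) (zeroˡ _))) (zeroˡ _))) (zeroʳ _))))))
  ... | yes u≤a = begin
    ∑ (rows n (suc m)) (rowTerm o a u g)
      ≈⟨ ∑-rows-suc n m (rowTerm o a u g) (rowTerm-ext o a u g) ⟩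
    ∑[ B ∈ letters n ] ∑[ R ∈ rows n m ] rowTerm o a u g (λ j → B j ∷ R j)
      ≈⟨ ∑-cong (letters n) (λ B → trans (∑-cong (rows n m) (peel B))
           (sym (trans (*-congˡ (*-∑ (rows n m) _ _)) (*-∑ (rows n m) _ _)))) ⟩
    ∑[ B ∈ letters n ] ind (letterOK? a (hd u) B) * (letterWeight (x o) a B * F (next a B))
      ≈⟨ letterSum n (x o) a (hd u) F u≤a a≤n ⟩
    ∑[ p ∈ upTo (suc n) ] e (x o) a p * (τ (x o) a (hd u) * F p)
      ≈⟨ upTo-cong n (λ p p≤n → *-congˡ (*-congˡ (rowSum m n (suc o) p (tl u) (λ v → g (p ∷ v)) (Counts-tl C) p≤n))) ⟩
    ∑[ p ∈ upTo (suc n) ] e (x o) a p * (τ (x o) a (hd u) *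
      (∑[ v ∈ tuples n m ] rowWeight (suc o) n p v * (columnWeight (suc o) p v (tl u) * g (p ∷ v))))
      ≈⟨ ∑-cong (upTo (suc n)) (λ p → trans (*-congˡ (*-∑ (tuples n m) _ _)) (trans (*-∑ (tuples n m) _ _)
           (∑-cong (tuples n m) (λ v → solve 5 (λ e t r c g → e :* (t :* (r :* (c :* g))) := (e :* r) :* ((t :* c) :* g)) refl
             (e (x o) a p) (τ (x o) a (hd u)) (rowWeight (suc o) n p v) (columnWeight (suc o) p v (tl u)) (g (p ∷ v)))))) ⟩
    ∑[ p ∈ upTo (suc n) ] ∑[ v ∈ tuples n m ] rowWeight o n a (p ∷ v) * (columnWeight o a (p ∷ v) u * g (p ∷ v))
      ≈⟨ ∑-tuples-suc n m _ ⟨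
    ∑[ v ∈ tuples n (suc m) ] rowWeight o n a v * (columnWeight o a v u * g v) ∎
    where
    F : ℕ → Carrier
    F p = ∑ (rows n m) (rowTerm (suc o) p (tl u) (λ v → g (p ∷ v)))
    peel : ∀ B R → rowTerm o a u g (λ j → B j ∷ R j) ≈
      ind (letterOK? a (hd u) B) * (letterWeight (x o) a B * rowTerm (suc o) (next a B) (tl u) (λ v → g (next a B ∷ v)) R)
    peel B R = begin
      ind (valid? a u BR) * (weight o a BR * g′)
        ≈⟨ *-congʳ (trans (reflexive (ind-⇔ (valid? a u BR) (letterOK? a (hd u) B ×-dec valid? (next a B) (tl u) R)
             (Valid-uncons a≤n) (λ (ok , V) → Valid-cons a≤n ok V)))
             (ind-× (letterOK? a (hd u) B) (valid? (next a B) (tl u) R))) ⟩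
      i * i′ * (weight o a BR * g′)
        ≈⟨ *-assoc _ _ _ ⟩
      i * (i′ * (weight o a BR * g′))
        ≈⟨ ind-cong (letterOK? a (hd u) B) (λ ok → *-congˡ (*-congʳ (weight-∷ o a (hd u) B R ok))) ⟩
      i * (i′ * (letterWeight (x o) a B * weight (suc o) (next a B) R * g′))
        ≈⟨ *-congˡ (solve 4 (λ i l w g → i :* (l :* w :* g) := l :* (i :* (w :* g))) refl
             i′ (letterWeight (x o) a B) (weight (suc o) (next a B) R) g′) ⟩
      i * (letterWeight (x o) a B * (i′ * (weight (suc o) (next a B) R * g′))) ∎
      where
      BR : Row n (suc m)
      BR j = B j ∷ R j
      g′ = g (next a B ∷ profile (next a B) R)
      i = ind (letterOK? a (hd u) B)
      i′ = ind (valid? (next a B) (tl u) R)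

  *-patterns : ∀ o rs a g → a * patterns o rs g ≈ patterns o rs (λ u → a * g u)
  *-patterns o []             a g = refl
  *-patterns o ((n , m) ∷ rs) a g = trans (*-∑ (tuples n m) a _)
    (∑-cong (tuples n m) (λ v → solve 3 (λ a u v → a :* (u :* v) := u :* (a :* v)) refl a _ (g v)))

  ∑-patterns : ∀ {i} {I : Set i} (L : List I) o rs (g : I → List ℕ → Carrier) →
    ∑[ i ∈ L ] patterns o rs (g i) ≈ patterns o rs (λ u → ∑[ i ∈ L ] g i u)
  ∑-patterns L o []             g = refl
  ∑-patterns L o ((n , m) ∷ rs) g = trans (∑-comm L (tuples n m) _)
    (∑-cong (tuples n m) (λ v → sym (*-∑ L _ _)))

  rowWeight-counts : ∀ o n a v → rowWeight o n a v ≈ 0# ⊎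
    (a ≤ n × (∀ i → i < length v → a ≤ nth v i) × Counts (length v) n v)
  rowWeight-counts o n a [] with a ≤? n
  ... | yes a≤n = inj₂ (a≤n , (λ i ()) , Counts-[])
  ... | no a≰n  = inj₁ (rowWeight-> o [] (ℕₚ.≰⇒> a≰n))
  rowWeight-counts o n a (p ∷ v) with a ≤? p | rowWeight-counts (suc o) n p v
  ... | no a≰p  | _       = inj₁ (trans (*-congʳ (e-> (x o) (ℕₚ.≰⇒> a≰p))) (zeroˡ _))
  ... | yes a≤p | inj₁ z  = inj₁ (trans (*-congˡ z) (zeroʳ _))
  ... | yes a≤p | inj₂ (p≤n , p≤ , counts mono bd) = inj₂ (ℕₚ.≤-trans a≤p p≤n ,
    (λ { zero _ → a≤p ; (suc i) (s≤s i<) → ℕₚ.≤-trans a≤p (p≤ i i<) }) ,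
    counts (λ { zero    zero    _         _        → ℕₚ.≤-refl
              ; zero    (suc j) _         (s≤s j<) → p≤ j j<
              ; (suc i) (suc j) (s≤s i≤j) (s≤s j<) → mono i j i≤j j< })
           (λ { zero _ → p≤n ; (suc i) (s≤s i<) → bd i i< }))

  patterns-cong-counts : ∀ o n m rs {g g′} → (∀ u → Counts m n u → g u ≈ g′ u) →
    patterns o ((n , m) ∷ rs) g ≈ patterns o ((n , m) ∷ rs) g′
  patterns-cong-counts o n m rs q = ∑-cong-∈ (tuples n m) λ {v} v∈ → case v v∈ (rowWeight-counts o n 0 v)
    where
    case : ∀ v → v ∈ₗ tuples n m → _ → _
    case v v∈ (inj₁ z) = trans (*-congʳ (trans (*-congʳ z) (zeroˡ _))) (trans (zeroˡ _)
      (sym (trans (*-congʳ (trans (*-congʳ z) (zeroˡ _))) (zeroˡ _))))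
    case v v∈ (inj₂ (_ , _ , C)) = *-congˡ (q v (≡.subst (λ m → Counts m n v) (tuples-length n m v∈) C))

  tableauWeight : ∀ {r} {lam f : Fin r → ℕ} → Filling lam f → Carrier
  tableauWeight {zero}  T = 1#
  tableauWeight {suc r} T = weight 0 0 (T Fin.zero) * tableauWeight (T ∘ Fin.suc)

  fillings : ∀ {r} (lam f : Fin r → ℕ) → List (Filling lam f)
  fillings lam f = sections λ i → rows (lam i) (f i)

  shape : ∀ {r} (lam f : Fin r → ℕ) → List (ℕ × ℕ)
  shape lam f = tabulate λ i → lam i , f i

  fillingsSum : ∀ {r} (lam f : Fin r → ℕ) →
    (∀ i j → i Fin.≤ j → lam j ≤ lam i) → (∀ i j → i Fin.≤ j → f i ≤ f j) → ∀ (g : List ℕ → Carrier) →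
    ∑[ T ∈ fillings lam f ] ind (isFSVT? {lam = lam} {f = f} T) * (tableauWeight {lam = lam} {f = f} T * g (top {lam = lam} {f = f} T)) ≈
    patterns 0 (shape lam f) g
  fillingsSum {zero} lam f dec inc g = trans
    (∑-cong (fillings lam f) {u = λ _ → g []} (λ T → trans
      (*-cong (reflexive (ind-yes (isFSVT? {lam = lam} {f = f} T) ((λ ()) , (λ ()) , λ ()))) (*-identityˡ _)) (*-identityˡ _)))
    (+-identityʳ _)
  fillingsSum {suc r} lam f dec inc g = begin
    ∑ (fillings lam f) t
      ≈⟨ ∑-sections-suc (λ i → rows (lam i) (f i)) t ⟩
    ∑[ R ∈ rows n m ] ∑[ T ∈ fillings lam′ f′ ] t (∀-cons {P = λ i → Row (lam i) (f i)} R T)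
      ≈⟨ ∑-cong (rows n m) (λ R → trans (∑-cong (fillings lam′ f′) (peel R))
           (fillingsSum lam′ f′ dec′ inc′ (λ u → rowTerm 0 0 u g R))) ⟩
    ∑[ R ∈ rows n m ] patterns 0 (shape lam′ f′) (λ u → rowTerm 0 0 u g R)
      ≈⟨ ∑-patterns (rows n m) 0 (shape lam′ f′) _ ⟩
    patterns 0 (shape lam′ f′) (λ u → ∑ (rows n m) (rowTerm 0 0 u g))
      ≈⟨ sumRows lam f dec inc ⟩
    patterns 0 (shape lam′ f′) (λ u → ∑[ v ∈ tuples n m ] rowWeight 0 n 0 v * (columnWeight 0 0 v u * g v))
      ≈⟨ ∑-patterns (tuples n m) 0 (shape lam′ f′) _ ⟨
    ∑[ v ∈ tuples n m ] patterns 0 (shape lam′ f′) (λ u → rowWeight 0 n 0 v * (columnWeight 0 0 v u * g v))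
      ≈⟨ ∑-cong (tuples n m) (λ v → begin
         patterns 0 (shape lam′ f′) (λ u → rowWeight 0 n 0 v * (columnWeight 0 0 v u * g v))
           ≈⟨ patterns-cong 0 (shape lam′ f′) (λ u → solve 3 (λ r c g → r :* (c :* g) := (r :* g) :* c) refl
                (rowWeight 0 n 0 v) (columnWeight 0 0 v u) (g v)) ⟩
         patterns 0 (shape lam′ f′) (λ u → (rowWeight 0 n 0 v * g v) * columnWeight 0 0 v u)
           ≈⟨ *-patterns 0 (shape lam′ f′) _ _ ⟨
         (rowWeight 0 n 0 v * g v) * patterns 0 (shape lam′ f′) (columnWeight 0 0 v)
           ≈⟨ solve 3 (λ r g c → (r :* g) :* c := (r :* c) :* g) refl _ _ _ ⟩
         rowWeight 0 n 0 v * patterns 0 (shape lam′ f′) (columnWeight 0 0 v) * g v ∎) ⟩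
    patterns 0 (shape lam f) g ∎
    where
    n m : ℕ
    n = lam Fin.zero
    m = f Fin.zero
    lam′ f′ : Fin r → ℕ
    lam′ = lam ∘ Fin.suc
    f′ = f ∘ Fin.suc
    dec′ : ∀ i j → i Fin.≤ j → lam′ j ≤ lam′ i
    dec′ i j i≤j = dec (Fin.suc i) (Fin.suc j) (s≤s i≤j)
    inc′ : ∀ i j → i Fin.≤ j → f′ i ≤ f′ j
    inc′ i j i≤j = inc (Fin.suc i) (Fin.suc j) (s≤s i≤j)
    t : Filling lam f → Carrier
    t T = ind (isFSVT? {lam = lam} {f = f} T) * (tableauWeight {lam = lam} {f = f} T * g (top {lam = lam} {f = f} T))
    peel : ∀ R T → t (∀-cons {P = λ i → Row (lam i) (f i)} R T) ≈
      ind (isFSVT? {lam = lam′} {f = f′} T) * (tableauWeight {lam = lam′} {f = f′} T * rowTerm 0 0 (top {lam = lam′} {f = f′} T) g R)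
    peel R T = begin
      ind (isFSVT? {lam = lam} {f = f} RT) * (weight 0 0 R * w * g (profile 0 R))
        ≈⟨ *-congʳ (trans (reflexive (ind-⇔ (isFSVT? {lam = lam} {f = f} RT) (valid? 0 u R ×-dec isFSVT? {lam = lam′} {f = f′} T)
             (IsFSVT-uncons {lam = lam} {f = f} {T = RT}) (λ (V , ok) → IsFSVT-cons {lam = lam} {f = f} {T = RT} inc V ok)))
             (ind-× (valid? 0 u R) (isFSVT? {lam = lam′} {f = f′} T))) ⟩
      i * i′ * (weight 0 0 R * w * g (profile 0 R))
        ≈⟨ solve 5 (λ i i′ r w g → i :* i′ :* (r :* w :* g) := i′ :* (w :* (i :* (r :* g)))) refl i i′ (weight 0 0 R) w (g (profile 0 R)) ⟩
      i′ * (w * (i * (weight 0 0 R * g (profile 0 R)))) ∎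
      where
      RT : Filling lam f
      RT = ∀-cons {P = λ i → Row (lam i) (f i)} R T
      u = top {lam = lam′} {f = f′} T
      w = tableauWeight {lam = lam′} {f = f′} T
      i = ind (valid? 0 u R)
      i′ = ind (isFSVT? {lam = lam′} {f = f′} T)
    sumRows : ∀ {r} (lam f : Fin (suc r) → ℕ) →
      (∀ i j → i Fin.≤ j → lam j ≤ lam i) → (∀ i j → i Fin.≤ j → f i ≤ f j) →
      let n = lam Fin.zero; m = f Fin.zero in
      patterns 0 (shape (lam ∘ Fin.suc) (f ∘ Fin.suc)) (λ u → ∑ (rows n m) (rowTerm 0 0 u g)) ≈
      patterns 0 (shape (lam ∘ Fin.suc) (f ∘ Fin.suc))
        (λ u → ∑[ v ∈ tuples n m ] rowWeight 0 n 0 v * (columnWeight 0 0 v u * g v))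
    sumRows {zero}  lam f dec inc = rowSum (f Fin.zero) (lam Fin.zero) 0 0 [] g Counts-[] z≤n
    sumRows {suc r} lam f dec inc = patterns-cong-counts 0 _ _
      (shape (λ i → lam (Fin.suc (Fin.suc i))) (λ i → f (Fin.suc (Fin.suc i)))) λ u C →
      rowSum (f Fin.zero) (lam Fin.zero) 0 0 u g
        (Counts-mono (inc Fin.zero (Fin.suc Fin.zero) z≤n) (dec Fin.zero (Fin.suc Fin.zero) z≤n) C) z≤n

  monomial : (ℕ → Carrier) → List ℕ → Carrier
  monomial y = Data.List.foldr (λ i t → y i * t) 1#

  monomial-++ : ∀ y u v → monomial y (u ++ v) ≈ monomial y u * monomial y v
  monomial-++ y []      v = sym (*-identityˡ _)
  monomial-++ y (i ∷ u) v = trans (*-congˡ (monomial-++ y u v)) (sym (*-assoc _ _ _))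

  monomial-map-suc : ∀ y u → monomial y (map suc u) ≡ monomial (y ∘ suc) u
  monomial-map-suc y []      = ≡.refl
  monomial-map-suc y (i ∷ u) = ≡.cong (y (suc i) *_) (monomial-map-suc y u)

  boxEntries : ∀ {m} → Subset m → List ℕ
  boxEntries {m} S = map toℕ (filter (_∈? S) (allFin m))

  rowEntries : ∀ {n m} → Row n m → List ℕ
  rowEntries {n} R = concatMap (λ j → boxEntries (R j)) (allFin n)

  concatMap-allFin-suc : ∀ n (g : Fin (suc n) → List ℕ) →
    concatMap g (allFin (suc n)) ≡ g Fin.zero ++ concatMap (g ∘ Fin.suc) (allFin n)
  concatMap-allFin-suc n g = ≡.cong (g Fin.zero ++_) (≡.trans
    (≡.cong (concatMap g) (≡.sym (map-tabulate id Fin.suc))) (concatMap-map g Fin.suc (allFin n)))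

  boxEntries-∷ : ∀ {m} a (S : Subset m) →
    boxEntries (a ∷ S) ≡ (if a then 0 ∷ [] else []) ++ map suc (boxEntries S)
  boxEntries-∷ {m} a S = ≡.trans
    (≡.cong (λ L → map toℕ (filter (_∈? (a ∷ S)) (Fin.zero ∷ L))) (≡.sym (map-tabulate id Fin.suc)))
    (first a)
    where
    rest : ∀ a (L : List (Fin m)) → map toℕ (filter (_∈? (a ∷ S)) (map Fin.suc L)) ≡ map suc (map toℕ (filter (_∈? S) L))
    rest a []      = ≡.refl
    rest a (k ∷ L) with does (k ∈? S)
    ... | true  = ≡.cong (suc (toℕ k) ∷_) (rest a L)
    ... | false = rest a L
    first : ∀ a → map toℕ (filter (_∈? (a ∷ S)) (Fin.zero ∷ map Fin.suc (allFin m))) ≡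
            (if a then 0 ∷ [] else []) ++ map suc (boxEntries S)
    first true  = ≡.cong (0 ∷_) (rest true (allFin m))
    first false = rest false (allFin m)

  startedBox-entries : ∀ {m} o y (S : Subset m) → (∀ i → y i ≡ x (i ℕ.+ o)) →
    b ^ length (boxEntries S) * monomial y (boxEntries S) ≈ startedBox o S
  startedBox-entries o y []      q = *-identityˡ 1#
  startedBox-entries o y (a ∷ S) q rewrite boxEntries-∷ a S = go a
    where
    ih : b ^ length (map suc (boxEntries S)) * monomial (y ∘ suc) (boxEntries S) ≈ startedBox (suc o) S
    ih rewrite length-map suc (boxEntries S) = startedBox-entries (suc o) (y ∘ suc) S
      (λ i → ≡.trans (q (suc i)) (≡.cong x (≡.sym (ℕₚ.+-suc i o))))
    go : ∀ a → let u = (if a then 0 ∷ [] else []) ++ map suc (boxEntries S) in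
      b ^ length u * monomial y u ≈ startedBox o (a ∷ S)
    go true = begin
      b * b ^ length (map suc (boxEntries S)) * (y 0 * monomial y (map suc (boxEntries S)))
        ≈⟨ solve 4 (λ b p y t → b :* p :* (y :* t) := b :* y :* (p :* t)) refl b _ (y 0) _ ⟩
      b * y 0 * (b ^ length (map suc (boxEntries S)) * monomial y (map suc (boxEntries S)))
        ≈⟨ *-cong (*-congˡ (reflexive (q 0))) (trans (*-congˡ (reflexive (monomial-map-suc y (boxEntries S)))) ih) ⟩
      b * x o * startedBox (suc o) S ∎
    go false = trans (*-congˡ (reflexive (monomial-map-suc y (boxEntries S)))) ih

  newBox-entries : ∀ {m} o y (S : Subset m) → (∀ i → y i ≡ x (i ℕ.+ o)) → Nonempty S →
    1 ≤ length (boxEntries S) × b ^ (length (boxEntries S) ∸ 1) * monomial y (boxEntries S) ≈ newBox o S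
  newBox-entries o y (a ∷ S) q ne rewrite boxEntries-∷ a S = go a ne
    where
    q′ : ∀ i → y (suc i) ≡ x (i ℕ.+ suc o)
    q′ i = ≡.trans (q (suc i)) (≡.cong x (≡.sym (ℕₚ.+-suc i o)))
    go : ∀ a → Nonempty (a ∷ S) → let u = (if a then 0 ∷ [] else []) ++ map suc (boxEntries S) in
      1 ≤ length u × b ^ (length u ∸ 1) * monomial y u ≈ newBox o (a ∷ S)
    go true _ = s≤s z≤n , (begin
      b ^ length (map suc (boxEntries S)) * (y 0 * monomial y (map suc (boxEntries S)))
        ≈⟨ *-cong (reflexive (≡.cong (b ^_) (length-map suc (boxEntries S))))
             (*-cong (reflexive (q 0)) (reflexive (monomial-map-suc y (boxEntries S)))) ⟩
      b ^ length (boxEntries S) * (x o * monomial (y ∘ suc) (boxEntries S))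
        ≈⟨ solve 3 (λ p y t → p :* (y :* t) := y :* (p :* t)) refl _ (x o) _ ⟩
      x o * (b ^ length (boxEntries S) * monomial (y ∘ suc) (boxEntries S))
        ≈⟨ *-congˡ (startedBox-entries (suc o) (y ∘ suc) S q′) ⟩
      x o * startedBox (suc o) S ∎)
    go false (Fin.suc k , k∈)
      rewrite length-map suc (boxEntries S) | monomial-map-suc y (boxEntries S) =
      newBox-entries (suc o) (y ∘ suc) S q′ (k , suc∈ k∈)

  ^-∸-+ : ∀ {m m′ n n′} → n ≤ m → n′ ≤ m′ → ∀ t t′ →
    b ^ ((m ℕ.+ m′) ∸ (n ℕ.+ n′)) * (t * t′) ≈ (b ^ (m ∸ n) * t) * (b ^ (m′ ∸ n′) * t′)
  ^-∸-+ {m} {m′} {n} {n′} n≤m n′≤m′ t t′ = begin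
    b ^ ((m ℕ.+ m′) ∸ (n ℕ.+ n′)) * (t * t′)
      ≈⟨ *-congʳ (reflexive (≡.cong (b ^_) split)) ⟩
    b ^ ((m ∸ n) ℕ.+ (m′ ∸ n′)) * (t * t′)
      ≈⟨ *-congʳ (^-homo-* b (m ∸ n) (m′ ∸ n′)) ⟩
    b ^ (m ∸ n) * b ^ (m′ ∸ n′) * (t * t′)
      ≈⟨ solve 4 (λ u v t w → u :* v :* (t :* w) := (u :* t) :* (v :* w)) refl _ _ t t′ ⟩
    (b ^ (m ∸ n) * t) * (b ^ (m′ ∸ n′) * t′) ∎
    where
    open import Algebra.Properties.Semiring.Exp semiring using (^-homo-*)
    split : (m ℕ.+ m′) ∸ (n ℕ.+ n′) ≡ (m ∸ n) ℕ.+ (m′ ∸ n′)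
    split = ≡.trans (≡.sym (ℕₚ.∸-+-assoc (m ℕ.+ m′) n n′)) (≡.trans
      (≡.cong (_∸ n′) (ℕₚ.+-∸-comm m′ n≤m)) (ℕₚ.+-∸-assoc (m ∸ n) n′≤m′))

  rowEntries-weight : ∀ {n m} (R : Row n m) → (∀ j → Nonempty (R j)) →
    n ≤ length (rowEntries R) × b ^ (length (rowEntries R) ∸ n) * monomial x (rowEntries R) ≈ weight 0 0 R
  rowEntries-weight {zero}  R ne = z≤n , *-identityˡ 1#
  rowEntries-weight {suc n} R ne
    rewrite concatMap-allFin-suc n (λ j → boxEntries (R j))
          | length-++ (boxEntries (R Fin.zero)) {rowEntries (R ∘ Fin.suc)}
    with newBox-entries 0 x (R Fin.zero) (λ i → ≡.cong x (≡.sym (ℕₚ.+-identityʳ i))) (ne Fin.zero)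
       | rowEntries-weight (R ∘ Fin.suc) (ne ∘ Fin.suc)
  ... | l , q | l′ , q′ = ℕₚ.+-mono-≤ l l′ , (begin
    b ^ ((length u ℕ.+ length v) ∸ suc n) * monomial x (u ++ v)    ≈⟨ *-congˡ (monomial-++ x u v) ⟩
    b ^ ((length u ℕ.+ length v) ∸ suc n) * (monomial x u * monomial x v)  ≈⟨ ^-∸-+ l l′ _ _ ⟩
    (b ^ (length u ∸ 1) * monomial x u) * (b ^ (length v ∸ n) * monomial x v)  ≈⟨ *-cong q q′ ⟩
    newBox 0 (R Fin.zero) * weight 0 0 (R ∘ Fin.suc) ∎)
    where
    u = boxEntries (R Fin.zero)
    v = rowEntries (R ∘ Fin.suc)

  entries-weight : ∀ {r} {lam f : Fin r → ℕ} (T : Filling lam f) → (∀ i j → Nonempty (T i j)) →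
    ∣ lam ∣ ≤ length (entries T) ×
    b ^ (length (entries T) ∸ ∣ lam ∣) * monomial x (entries T) ≈ tableauWeight {lam = lam} {f = f} T
  entries-weight {zero}          T ne = z≤n , *-identityˡ 1#
  entries-weight {suc r} {lam} {f} T ne
    rewrite concatMap-allFin-suc r (λ i → rowEntries (T i))
          | length-++ (rowEntries (T Fin.zero)) {entries {lam = lam ∘ Fin.suc} {f = f ∘ Fin.suc} (T ∘ Fin.suc)}
    with rowEntries-weight (T Fin.zero) (ne Fin.zero)
       | entries-weight {lam = lam ∘ Fin.suc} {f = f ∘ Fin.suc} (T ∘ Fin.suc) (ne ∘ Fin.suc)
  ... | l , q | l′ , q′ = ℕₚ.+-mono-≤ l l′ , (begin
    b ^ ((length u ℕ.+ length v) ∸ (lam Fin.zero ℕ.+ N)) * monomial x (u ++ v)    ≈⟨ *-congˡ (monomial-++ x u v) ⟩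
    b ^ ((length u ℕ.+ length v) ∸ (lam Fin.zero ℕ.+ N)) * (monomial x u * monomial x v)  ≈⟨ ^-∸-+ l l′ _ _ ⟩
    (b ^ (length u ∸ lam Fin.zero) * monomial x u) * (b ^ (length v ∸ N) * monomial x v)  ≈⟨ *-cong q q′ ⟩
    weight 0 0 (T Fin.zero) * tableauWeight {lam = lam ∘ Fin.suc} {f = f ∘ Fin.suc} (T ∘ Fin.suc) ∎)
    where
    u = rowEntries (T Fin.zero)
    v = entries {lam = lam ∘ Fin.suc} {f = f ∘ Fin.suc} (T ∘ Fin.suc)
    N = ∣ lam ∘ Fin.suc ∣

  FSVT-patterns : ∀ {r} (lam f : Fin r → ℕ) →
    (∀ i j → i Fin.≤ j → lam j ≤ lam i) → (∀ i j → i Fin.≤ j → f i ≤ f j) →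
    ∑[ T ∈ FSVT lam f ] b ^ (length (entries T) ∸ ∣ lam ∣) * monomial x (entries T) ≈
    patterns 0 (shape lam f) (λ _ → 1#)
  FSVT-patterns lam f dec inc = trans (∑-filter (isFSVT? {lam = lam} {f = f}) (fillings lam f) _)
    (trans (∑-cong (fillings lam f) (λ T → ind-cong (isFSVT? {lam = lam} {f = f} T) (λ (ne , _) →
      trans (proj₂ (entries-weight {lam = lam} {f = f} T ne)) (sym (*-identityʳ _)))))
      (fillingsSum lam f dec inc (λ _ → 1#)))

-- Chains of the operators π_k

-- A row (n , d) at position t has n boxes and may use t + d + 1 letters.
rowsAt : ℕ → List (ℕ × ℕ) → List (ℕ × ℕ)
rowsAt t []             = []
rowsAt t ((n , d) ∷ rs) = (n , suc t ℕ.+ d) ∷ rowsAt (suc t) rs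

rowsAt-suc : ∀ t rs → map (λ (n , m) → n , suc m) (rowsAt t rs) ≡ rowsAt (suc t) rs
rowsAt-suc t []             = ≡.refl
rowsAt-suc t ((n , d) ∷ rs) = ≡.cong (_ ∷_) (rowsAt-suc (suc t) rs)

Flagged : List (ℕ × ℕ) → Set
Flagged = Linked (λ (n , d) (n′ , d′) → n′ ≤ n × d ≤ suc d′)

run : ℕ → ℕ → List ℕ
run k zero    = []
run k (suc d) = k ∷ run (suc k) d

run-upTo : ∀ k d → run k d ≡ map (k ℕ.+_) (upTo d)
run-upTo k zero    = ≡.refl
run-upTo k (suc d) = ≡.cong₂ _∷_ (≡.sym (ℕₚ.+-identityʳ k)) (≡.trans (run-upTo (suc k) d)
  (≡.trans (map-cong (λ i → ≡.sym (ℕₚ.+-suc k i)) (upTo d))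
    (≡.trans (map-∘ (upTo d)) (≡.cong (map (k ℕ.+_)) (map-upTo suc d)))))

word : ℕ → List (ℕ × ℕ) → List ℕ
word o []             = []
word o ((n , d) ∷ rs) = word (suc o) rs ++ run o d

word-codeWord : ∀ o rs → word o rs ≡ map (o ℕ.+_) (codeWord (map proj₂ rs))
word-codeWord o []             = ≡.refl
word-codeWord o ((n , d) ∷ rs) = ≡.trans
  (≡.cong₂ _++_ (≡.trans (word-codeWord (suc o) rs) (≡.trans
      (map-cong (λ i → ≡.sym (ℕₚ.+-suc o i)) (codeWord (map proj₂ rs))) (map-∘ (codeWord (map proj₂ rs)))))
    (run-upTo o d))
  (≡.sym (map-++ (o ℕ.+_) (map suc (codeWord (map proj₂ rs))) (upTo d)))

module Assembly {c ℓ} (R : CommutativeRing c ℓ) (β : CommutativeRing.Carrier R) where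

  private module R = CommutativeRing R
  open PowerSeries R β
  open Polynomials R β
  open CommutativeSemiring polynomials
  open import Algebra.Properties.Semiring.Exp semiring using (_^_)
  open import Algebra.Properties.Semiring.Exp R.semiring using () renaming (_^_ to _^ᴿ_)
  open Sums polynomials
  open Patterns polynomials (con β) var
  open Tableaux polynomials (con β) var using (monomial; monomial-map-suc; concatMap-allFin-suc; FSVT-patterns; shape; monomial-++)

  data Chain : List ℕ → Polynomial → Polynomial → Set (c Level.⊔ ℓ) where
    stop : ∀ {p g} → p ≈ g → Chain [] p g
    step : ∀ {i u p q g} → At.Π i p q → Chain u q g → Chain (i ∷ u) p g

  Chain-sound : ∀ {u p g} → Chain u p g → πWord u ⟦ p ⟧ ≈ₛ ⟦ g ⟧
  Chain-sound (stop e) = e 1ₛ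
  Chain-sound (step {i} {u} {p} {q} π-pq ch) α = R.trans (πWord-cong u {π i ⟦ p ⟧} {⟦ q ⟧} (π-act i p q π-pq) α) (Chain-sound ch α)

  Chain-respˡ : ∀ {u p p′ g} → p ≈ p′ → Chain u p′ g → Chain u p g
  Chain-respˡ {p = p} {p′} {g} e (stop e′) = stop (trans {p} {p′} {g} e e′)
  Chain-respˡ {p = p} {p′} e (step {i} {q = q} r ch) = step (At.Π-resp i {p} {p′} {q} {q} e (refl {q}) r) ch

  Chain-++ : ∀ {u v p q g} → Chain u p q → Chain v q g → Chain (u ++ v) p g
  Chain-++ (stop e)    ch′ = Chain-respˡ e ch′
  Chain-++ (step r ch) ch′ = step r (Chain-++ ch ch′)

  Chain-* : ∀ {u z p g} → All (λ i → At.Sym i z) u → Chain u p g → Chain u (z * p) (z * g)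
  Chain-* {z = z} {p} {g} []       (stop e)    = stop (*-congˡ {z} {p} {g} e)
  Chain-* {z = z} {p} (z-sym ∷ zs) (step {i} {q = q} r ch) = step (At.Π-* i {z} {p} {q} z-sym r) (Chain-* zs ch)

  rename-var : ∀ i j → j ≢ i → j ≢ suc i → rename i (var j) ≈ var j
  rename-var i j j≢i j≢si = reflexive (≡.cong var (s-other i j j≢i j≢si))

  module StepAt (o j : ℕ) = Step polynomials (con β) var o j (rename (j ℕ.+ o)) (rename-hom (j ℕ.+ o)) (refl {con β})
    (reflexive (≡.cong var (s-at (j ℕ.+ o)))) (reflexive (≡.cong var (s-at-suc (j ℕ.+ o)))) (rename-var (j ℕ.+ o))

  lowerRowsAt : ∀ o j n d t rs → Flagged ((n , d) ∷ rs) → j < t ℕ.+ d → StepAt.LowerRows o j n (rowsAt (suc t) rs)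
  lowerRowsAt o j n d t []               _                   _   = StepAt.[]
  lowerRowsAt o j n d t ((n′ , d′) ∷ rs) ((n′≤n , d≤) ∷ fl) j< =
    ≡.subst (λ m → StepAt.LowerRows o j n ((n′ , m) ∷ rowsAt (suc (suc t)) rs)) q
      (StepAt._∷_ {l = (t ℕ.+ d′) ∸ j} n′≤n (lowerRowsAt o j n′ d′ (suc t) rs fl (s≤s j≤)))
    where
    j≤ : j ≤ t ℕ.+ d′
    j≤ = ℕ.s≤s⁻¹ (ℕₚ.≤-trans j< (ℕₚ.≤-trans (ℕₚ.+-monoʳ-≤ t d≤) (ℕₚ.≤-reflexive (ℕₚ.+-suc t d′))))
    q : j ℕ.+ (2 ℕ.+ ((t ℕ.+ d′) ∸ j)) ≡ suc (suc t) ℕ.+ d′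
    q = ≡.trans (ℕₚ.+-suc j _) (≡.cong suc (≡.trans (ℕₚ.+-suc j _) (≡.cong suc (ℕₚ.m+[n∸m]≡n j≤))))

  lowerRows-≤ : ∀ {o j n N rs} → n ≤ N → StepAt.LowerRows o j n rs → StepAt.LowerRows o j N rs
  lowerRows-≤ n≤N StepAt.[]              = StepAt.[]
  lowerRows-≤ n≤N (n′≤n StepAt.∷ low) = ℕₚ.≤-trans n′≤n n≤N StepAt.∷ low

  flagChain : ∀ o n d rs → Flagged ((n , d) ∷ rs) → ∀ j e → j ℕ.+ e ≡ d →
    Chain (run (j ℕ.+ o) e) (patterns o ((n ℕ.+ e , suc j) ∷ rowsAt 1 rs) (λ _ → 1#))
                            (patterns o ((n , suc d) ∷ rowsAt 1 rs) (λ _ → 1#))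
  flagChain o n d rs fl j zero    q rewrite ℕₚ.+-identityʳ n | ℕₚ.+-identityʳ j | q = stop (refl {patterns o ((n , suc d) ∷ rowsAt 1 rs) (λ _ → 1#)})
  flagChain o n d rs fl j (suc e) q = step
    (≡.subst₂ (λ p p′ → At.Π (j ℕ.+ o) (patterns o (p ∷ rowsAt 1 rs) (λ _ → 1#)) (patterns o (p′ ∷ rowsAt 1 rs) (λ _ → 1#)))
      (≡.cong₂ _,_ (≡.sym (ℕₚ.+-suc n e)) (ℕₚ.+-comm j 1)) (≡.cong (n ℕ.+ e ,_) (ℕₚ.+-comm j 2))
      (StepAt.patterns-Π o j {n ℕ.+ e} {rowsAt 1 rs}
        (lowerRows-≤ (ℕₚ.m≤m+n n e) (lowerRowsAt o j n d 0 rs fl (≡.subst (j <_) q (ℕₚ.m<m+n j (s≤s z≤n)))))))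
    (flagChain o n d rs fl (suc j) e (≡.trans (≡.sym (ℕₚ.+-suc j e)) q))

  start : ℕ → List (ℕ × ℕ) → Polynomial
  start o []             = 1#
  start o ((n , d) ∷ rs) = var o ^ (n ℕ.+ d) * start (suc o) rs

  word-> : ∀ o k rs → o < k → All (λ i → At.Sym i (var o)) (word k rs)
  word-> o k []             o<k = []
  word-> o k ((n , d) ∷ rs) o<k = append (word-> o (suc k) rs (ℕₚ.m≤n⇒m≤1+n o<k)) (run-> k d o<k)
    where
    open import Data.List.Relation.Unary.All.Properties using () renaming (++⁺ to append)
    run-> : ∀ k d → o < k → All (λ i → At.Sym i (var o)) (run k d)
    run-> k zero    o<k = []
    run-> k (suc d) o<k = rename-var k o (ℕₚ.<⇒≢ o<k) (ℕₚ.<⇒≢ (ℕₚ.m≤n⇒m≤1+n o<k)) ∷ run-> (suc k) d (ℕₚ.m≤n⇒m≤1+n o<k)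

  Flagged-tail : ∀ {r rs} → Flagged (r ∷ rs) → Flagged rs
  Flagged-tail [-]      = []
  Flagged-tail (_ ∷ fl) = fl

  chain : ∀ o rs → Flagged rs → Chain (word o rs) (start o rs) (patterns o (rowsAt 0 rs) (λ _ → 1#))
  chain o []             fl = stop (refl {1#})
  chain o ((n , d) ∷ rs) fl = Chain-++ (Chain-* syms (chain (suc o) rs (Flagged-tail fl)))
    (Chain-respˡ peel (flagChain o n d rs fl 0 d ≡.refl))
    where
    syms : All (λ i → At.Sym i (var o ^ (n ℕ.+ d))) (word (suc o) rs)
    syms = map-All (λ {i} → At.Sym-^ i {var o} (n ℕ.+ d)) (word-> o (suc o) rs ℕₚ.≤-refl)
      where open import Data.List.Relation.Unary.All using () renaming (map to map-All)
    peel : var o ^ (n ℕ.+ d) * patterns (suc o) (rowsAt 0 rs) (λ _ → 1#) ≈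
           patterns o ((n ℕ.+ d , 1) ∷ rowsAt 1 rs) (λ _ → 1#)
    peel = ≡.subst (λ rs′ → var o ^ (n ℕ.+ d) * patterns (suc o) (rowsAt 0 rs) (λ _ → 1#) ≈ patterns o ((n ℕ.+ d , 1) ∷ rs′) (λ _ → 1#))
      (rowsAt-suc 0 rs) (sym {patterns o ((n ℕ.+ d , 1) ∷ map (λ (n , m) → n , suc m) (rowsAt 0 rs)) (λ _ → 1#)}
        {var o ^ (n ℕ.+ d) * patterns (suc o) (rowsAt 0 rs) (λ _ → 1#)} (patterns-peel o (n ℕ.+ d) (rowsAt 0 rs)))

  ^-var : ∀ y k → monomial y (replicate k 0) ≡ y 0 ^ k
  ^-var y zero    = ≡.refl
  ^-var y (suc k) = ≡.cong (y 0 *_) (^-var y k)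

  start-monomial : ∀ {r} (lam d : Fin r → ℕ) o y → (∀ i → y i ≡ var (i ℕ.+ o)) →
    start o (tabulate (λ i → lam i , d i)) ≈ monomial y (concatMap (λ i → replicate (lam i ℕ.+ d i) (toℕ i)) (allFin r))
  start-monomial {zero}  lam d o y q = refl {1#}
  start-monomial {suc r} lam d o y q = begin
    var o ^ k * start (suc o) (tabulate (λ i → lam (Fin.suc i) , d (Fin.suc i)))
      ≈⟨ *-cong {var o ^ k} {monomial y (replicate k 0)} {start (suc o) (tabulate (λ i → lam (Fin.suc i) , d (Fin.suc i)))} {monomial (y ∘ suc) (concatMap rest (allFin r))} (reflexive (≡.sym (≡.trans (^-var y k) (≡.cong (_^ k) (q 0)))))
           (start-monomial (lam ∘ Fin.suc) (d ∘ Fin.suc) (suc o) (y ∘ suc)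
             (λ i → ≡.trans (q (suc i)) (≡.cong var (≡.sym (ℕₚ.+-suc i o))))) ⟩
    monomial y (replicate k 0) * monomial (y ∘ suc) (concatMap rest (allFin r))
      ≡⟨ ≡.cong (monomial y (replicate k 0) *_) (monomial-map-suc y (concatMap rest (allFin r))) ⟨
    monomial y (replicate k 0) * monomial y (map suc (concatMap rest (allFin r)))
      ≈⟨ monomial-++ y (replicate k 0) _ ⟨
    monomial y (replicate k 0 ++ map suc (concatMap rest (allFin r)))
      ≡⟨ ≡.cong (λ u → monomial y (replicate k 0 ++ u)) (≡.trans (map-concatMap suc rest (allFin r))
           (concatMap-cong (λ i → map-replicate suc (lam (Fin.suc i) ℕ.+ d (Fin.suc i)) (toℕ i)) (allFin r))) ⟩
    monomial y (replicate k 0 ++ concatMap (λ i → replicate (lam (Fin.suc i) ℕ.+ d (Fin.suc i)) (suc (toℕ i))) (allFin r))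
      ≡⟨ ≡.cong (monomial y) (concatMap-allFin-suc r (λ i → replicate (lam i ℕ.+ d i) (toℕ i))) ⟨
    monomial y (concatMap (λ i → replicate (lam i ℕ.+ d i) (toℕ i)) (allFin (suc r))) ∎
    where
    open import Relation.Binary.Reasoning.Setoid setoid hiding (start; stop)
    k = lam Fin.zero ℕ.+ d Fin.zero
    rest : Fin r → List ℕ
    rest i = replicate (lam (Fin.suc i) ℕ.+ d (Fin.suc i)) (toℕ i)

  rowsAt-tabulate : ∀ {r} t (lam f : Fin r → ℕ) → (∀ i → suc t ℕ.+ toℕ i ≤ f i) →
    rowsAt t (tabulate (λ i → lam i , f i ∸ (suc t ℕ.+ toℕ i))) ≡ shape lam f
  rowsAt-tabulate {zero}  t lam f f≥ = ≡.refl
  rowsAt-tabulate {suc r} t lam f f≥ = ≡.cong₂ _∷_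
    (≡.cong (lam Fin.zero ,_) (≡.trans (≡.cong (λ a → suc t ℕ.+ (f Fin.zero ∸ a)) (ℕₚ.+-identityʳ (suc t)))
      (ℕₚ.m+[n∸m]≡n (ℕₚ.≤-trans (ℕₚ.≤-reflexive (≡.sym (ℕₚ.+-identityʳ (suc t)))) (f≥ Fin.zero)))))
    (≡.trans (≡.cong (rowsAt (suc t)) (tabulate-cong (λ i → ≡.cong (λ a → lam (Fin.suc i) , f (Fin.suc i) ∸ a) (ℕₚ.+-suc (suc t) (toℕ i)))))
      (rowsAt-tabulate (suc t) (lam ∘ Fin.suc) (f ∘ Fin.suc)
        (λ i → ℕₚ.≤-trans (ℕₚ.≤-reflexive (≡.sym (ℕₚ.+-suc (suc t) (toℕ i)))) (f≥ (Fin.suc i)))))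

  flagged-tabulate : ∀ {r} (lam d : Fin r → ℕ) →
    (∀ i j → i Fin.≤ j → lam j ≤ lam i) → (∀ i j → toℕ j ≡ suc (toℕ i) → d i ≤ suc (d j)) →
    Flagged (tabulate (λ i → lam i , d i))
  flagged-tabulate {zero}        lam d dec q = []
  flagged-tabulate {suc zero}    lam d dec q = [-]
  flagged-tabulate {suc (suc r)} lam d dec q =
    (dec Fin.zero (Fin.suc Fin.zero) z≤n , q Fin.zero (Fin.suc Fin.zero) ≡.refl) ∷
    flagged-tabulate (lam ∘ Fin.suc) (d ∘ Fin.suc) (λ i j i≤j → dec (Fin.suc i) (Fin.suc j) (s≤s i≤j))
      (λ i j e → q (Fin.suc i) (Fin.suc j) (≡.cong suc e))

  ⟦monomial⟧ : ∀ u → ⟦ monomial var u ⟧ ≈ₛ ∏x u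
  ⟦monomial⟧ []      α = R.*-identityˡ _
  ⟦monomial⟧ (i ∷ u) α = x-cong {i} {⟦ monomial var u ⟧} {∏x u} (⟦monomial⟧ u) α

  ⟦con-^⟧ : ∀ a n h → act (con a ^ n) h ≈ₛ (a ^ᴿ n) • h
  ⟦con-^⟧ a zero    h α = R.refl
  ⟦con-^⟧ a (suc n) h α = R.trans (R.*-congˡ (⟦con-^⟧ a n h α)) (R.sym (R.*-assoc _ _ _))

  G-polynomial : ∀ {r} (lam f : Fin r → ℕ) →
    G lam f ≈ₛ ⟦ ∑[ T ∈ FSVT lam f ] con β ^ (length (entries T) ∸ ∣ lam ∣) * monomial var (entries T) ⟧
  G-polynomial lam f = go (FSVT lam f)
    where
    go : ∀ L → foldr _+ₛ_ 0ₛ (map (λ T → β ^ᴿ (length (entries {lam = lam} {f = f} T) ∸ ∣ lam ∣) • ∏x (entries T)) L) ≈ₛ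
         ⟦ ∑[ T ∈ L ] con β ^ (length (entries T) ∸ ∣ lam ∣) * monomial var (entries {lam = lam} {f = f} T) ⟧
    go []      α = R.sym (R.zeroˡ _)
    go (T ∷ L) α = R.+-cong
      (R.trans (R.*-congˡ (R.sym (⟦monomial⟧ (entries T) α)))
        (R.sym (⟦con-^⟧ β (length (entries T) ∸ ∣ lam ∣) ⟦ monomial var (entries T) ⟧ α)))
      (go L α)

  flagWord-word : ∀ {r} (lam f : Fin r → ℕ) → flagWord f ≡ word 0 (tabulate (λ i → lam i , f i ∸ suc (toℕ i)))
  flagWord-word lam f = ≡.trans (flagWord-codeWord f) (≡.sym (≡.trans
    (word-codeWord 0 (tabulate (λ i → lam i , f i ∸ suc (toℕ i))))
    (≡.trans (map-id _) (≡.cong codeWord (map-tabulate (λ i → lam i , f i ∸ suc (toℕ i)) proj₂)))))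

  G-πWord : ∀ {r} (lam f : Fin r → ℕ) → IsPartition lam → IsFlagging f → (∀ i → suc (toℕ i) ≤ f i) →
    G lam f ≈ₛ πWord (flagWord f) (x^ (startExponent lam f))
  G-πWord {r} lam f isP isF f≥ = ≈ₛ-sym {πWord (flagWord f) (x^ a)} {G lam f} λ α →
    R.trans (R.reflexive (≡.cong (λ u → coeff (πWord u (x^ a)) α) (flagWord-word lam f)))
    (R.trans (πWord-cong (word 0 rs) {x^ a} {⟦ start 0 rs ⟧} initial α)
    (R.trans (Chain-sound (chain 0 rs flagged) α)
    (R.trans (R.reflexive (≡.cong (λ rs → coeff ⟦ patterns 0 rs (λ _ → 1#) ⟧ α) (rowsAt-tabulate 0 lam f f≥)))
    (R.trans (R.sym (FSVT-patterns lam f (IsPartition.decreasing isP) (IsFlagging.increasing isF) 1ₛ α))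
    (R.sym (G-polynomial lam f α))))))
    where
    d a : Fin r → ℕ
    d i = f i ∸ suc (toℕ i)
    a = startExponent lam f
    rs : List (ℕ × ℕ)
    rs = tabulate (λ i → lam i , d i)
    initial : x^ a ≈ₛ ⟦ start 0 rs ⟧
    initial α = R.trans
      (R.reflexive (≡.cong (λ u → coeff (∏x u) α)
        (concatMap-cong (λ i → ≡.cong (λ n → replicate n (toℕ i)) (ℕₚ.+-∸-assoc (lam i) (f≥ i))) (allFin r))))
      (R.trans (R.sym (⟦monomial⟧ (concatMap (λ i → replicate (lam i ℕ.+ d i) (toℕ i)) (allFin r)) α))
        (R.sym (start-monomial lam d 0 var (λ i → ≡.cong var (≡.sym (ℕₚ.+-identityʳ i))) 1ₛ α)))
    m∸n≤ : ∀ m n → m ∸ n ≤ suc (m ∸ suc n)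
    m∸n≤ zero    zero    = z≤n
    m∸n≤ zero    (suc n) = z≤n
    m∸n≤ (suc m) zero    = ℕₚ.≤-refl
    m∸n≤ (suc m) (suc n) = m∸n≤ m n
    flagged : Flagged rs
    flagged = flagged-tabulate lam d (IsPartition.decreasing isP) λ i j q →
      ℕₚ.≤-trans (ℕₚ.∸-monoˡ-≤ (suc (toℕ i)) (IsFlagging.increasing isF i j (ℕₚ.≤-trans (ℕₚ.n≤1+n _) (ℕₚ.≤-reflexive (≡.sym q)))))
        (≡.subst (λ k → f j ∸ suc (toℕ i) ≤ suc (f j ∸ suc k)) (≡.sym q) (m∸n≤ (f j) (suc (toℕ i))))

open import Defs

theorem3p3 : (r : ℕ) (lam f : Fin r → ℕ) →
    IsPartition lam → IsFlagging f →
    ((i : Fin r) → suc (toℕ i) ≤ f i) →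
    ((i j : Fin r) → toℕ i ≡ 0 → toℕ j ≡ 1 → f i ≡ 1 → 1 < f j) →
    G lam f ≈π[ perm (flagWord f) ] x^ (startExponent lam f)
theorem3p3 r lam f isPartition isFlagging f≥ _ =
  flagWord f ,
  ≡.subst (λ u → IsReducedExpression u (perm u)) (≡.sym (flagWord-codeWord f)) (codeWord-reduced (flagCode f)) ,
  Assembly.G-πWord ℤ[β] βₚ lam f isPartition isFlagging f≥
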